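{- Let $N$ be a timed Petri net (TPN). The set $\mathit{ZEROTIME}$ of all zerotime-markings of $N$ is effectively constructible as a multi-region upward closure (MRUC); that is, there is an algorithm which, given a TPN $N$, outputs a finite set $\alpha$ of regions such that $[\![\alpha]\!]=\mathit{ZEROTIME}$.
   Context: **Timed Petri nets.** $\mathbb N$ contains $0$. An interval has a lower bound in $\mathbb N$ and an upper bound in $\mathbb N\cup\{\infty\}$, and may be open, closed or half-open. A timed Petri net (TPN) is a tuple $N=(P,T,\mathit{In},\mathit{Out})$ with finite sets $P$ (places), $T$ (transitions) and partial functions $\mathit{In},\mathit{Out}$ from $T\times P$ to intervals; $p$ is an input (output) place of $t$ if $\mathit{In}(t,p)$ ($\mathit{Out}(t,p)$) is defined. A marking is a finite multiset over $P\times\mathbb R^{\ge 0}$; an element $(p,x)$ is a token of age $x$ in place $p$. The relation $\le$ and the operations $+,-$ on multisets are pointwise. Timed transition: for real $x>0$, $M_1\to_x M_2$ if $M_2$ is obtained from $M_1$ by increasing the age of every token by $x$. Discrete transition: $M_1\to_t M_2$ if there are multisets $b_1\le M_1$ and $b_2$, where $b_1$ consists of exactly one token $(p,x)$ with $x\in\mathit{In}(t,p)$ for each input place $p$ of $t$, $b_2$ consists of exactly one token $(q,y)$ with $y\in\mathit{Out}(t,q)$ for each output place $q$ of $t$, and $M_2=(M_1-b_1)+b_2$. Let $\to_D=\bigcup_{t\in T}\to_t$. **Computations.** An $M_0$-disc-computation is a finite or infinite sequence $M_0\to_D^+M_0'\to_{x_0}M_1\to_D^+M_1'\to_{x_1}M_2\to_D^+\cdots$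 with real $x_i>0$ (if it is infinite with finitely many timed transitions it ends with an infinite sequence of discrete transitions). An $M$-time-computation is $M\to_xM_0$ (real $x>0$) followed by an $M_0$-disc-computation. An $M$-computation is one of either kind. Thus timed transitions never directly follow each other and every infinite computation contains infinitely many discrete transitions. The delay $\Delta(\pi)$ is the sum of the delays of all timed transitions of $\pi$. **Zerotime-markings.** $M$ is a zerotime-marking if there exists an infinite $M$-computation $\pi$ with $\Delta(\pi)=0$. **Regions.** Let $\max$ be the maximal integer appearing on the arcs of $N$. A region is a triple $(b_0,w,b_{\max})$ where $b_0$ is a finite multiset over $P\times\{0,\dots,\max\}$, $w=b_1\cdots b_m$ is a finite word of nonempty finite multisets over $P\times\{0,\dots,\max-1\}$, and $b_{\max}=b_{m+1}$ is a finite multiset over $P$. A marking $M=[(p_1,x_1),\dots,(p_n,x_n)]$ satisfies $R$ (written $M\in[\![R]\!]$) if there is a bijection $h$ from the tokens of $M$ to the elements (with multiplicity) of $b_0,\dots,b_{m+1}$ such that, if $h(i)$ is an element of $b_j$: its place is $p_i$; $j=m+1$ iff $x_i>\max$; if $x_i\le\max$ then the integer in the element is $\lfloor x_i\rfloor$, and the fractional part of $x_i$ is $0$ iff $j=0$; and for $x_{i_1},x_{i_2}<\max$ with $h(i_1)$ in $b_{j_1}$ and $h(i_2)$ in $b_{j_2}$, the fractional part of $x_{i_1}$ is smaller than that of $x_{i_2}$ iff $j_1<j_2$. Let $[\![R]\!]^{\uparrow}=\{M\mid\exists M'\in[\![R]\!].\,M'\le M\}$. A multi-region upward closure (MRUC)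 is a finite set of regions $\alpha=\{R_1,\dots,R_n\}$, and it denotes the set of markings $[\![\alpha]\!]=\bigcup_i[\![R_i]\!]^{\uparrow}$. -}

module Defs where

open import Data.Nat.Base as ℕ using (ℕ; zero; suc; _⊔_)
import Data.Nat.Properties as ℕ
open import Data.Integer.Base using (+_)
open import Data.Rational as ℚ using (ℚ; 0ℚ; ½; ∣_∣)
import Data.Rational.Properties as ℚ
open import Algebra.Bundles using (AbelianGroup)
open import Algebra.Properties.AbelianGroup using (⁻¹-anti-homo-//; //-rightDividesˡ)
open import Algebra.Properties.CommutativeSemigroup using (interchange)
open import Data.Fin.Base using (Fin; toℕ)
open import Data.List.Base
  using (List; []; _∷_; _++_; map; mapMaybe; concatMap; foldr; length; lookup; allFin)
open import Data.List.NonEmpty.Base as List⁺ using (List⁺)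
open import Data.List.Relation.Unary.Any using (Any)
import Data.List.Relation.Binary.Permutation.Setoid as Permutation
open import Data.Maybe.Base as Maybe using (Maybe; just; nothing)
open import Data.Product.Base using (∃-syntax; Σ-syntax; _×_; _,_; proj₁; proj₂; map₂)
open import Data.Product.Relation.Binary.Pointwise.NonDependent using (×-setoid)
open import Data.Sum.Base using (_⊎_; inj₁; inj₂)
open import Data.Unit.Base using (⊤)
open import Function.Bundles using (_⇔_; _⤖_; module Bijection)
open import Relation.Nullary.Negation.Core using (¬_)
open import Level using (0ℓ)
open import Relation.Binary.Bundles using (Setoid)
open import Relation.Binary.Construct.Closure.Transitive using (TransClosure)
open import Relation.Binary.PropositionalEquality as ≡
  using (_≡_; refl; sym; trans; cong; subst)

------------------------------------------------------------------------
-- Real numbers: Cauchy sequences of rationals up to _≃_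

record ℝ : Set where
  constructor mkℝ
  field
    seq    : ℕ → ℚ
    cauchy : ∀ ε → 0ℚ ℚ.< ε →
             ∃[ N ] ∀ m n → N ℕ.≤ m → N ℕ.≤ n → ∣ seq m ℚ.- seq n ∣ ℚ.< ε

open ℝ public

infix 4 _≃_ _<_ _≤_

_≃_ : ℝ → ℝ → Set
x ≃ y = ∀ ε → 0ℚ ℚ.< ε → ∃[ N ] ∀ n → N ℕ.≤ n → ∣ seq x n ℚ.- seq y n ∣ ℚ.< ε

_<_ : ℝ → ℝ → Set
x < y = ∃[ ε ] 0ℚ ℚ.< ε × ∃[ N ] ∀ n → N ℕ.≤ n → seq x n ℚ.+ ε ℚ.< seq y n

_≤_ : ℝ → ℝ → Set
x ≤ y = ¬ (y < x)

private abstract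
  half-pos : ∀ {ε} → 0ℚ ℚ.< ε → 0ℚ ℚ.< ε ℚ.* ½
  half-pos {ε} 0<ε = subst (ℚ._< ε ℚ.* ½) (ℚ.*-zeroˡ ½) (ℚ.*-monoˡ-<-pos ½ 0<ε)

  halves : ∀ ε → ε ℚ.* ½ ℚ.+ ε ℚ.* ½ ≡ ε
  halves ε = trans (sym (ℚ.*-distribˡ-+ ε ½ ½)) (ℚ.*-identityʳ ε)

  self-dist : ∀ {ε} q → 0ℚ ℚ.< ε → ∣ q ℚ.- q ∣ ℚ.< ε
  self-dist {ε} q 0<ε = subst (λ d → ∣ d ∣ ℚ.< ε) (sym (ℚ.+-inverseʳ q)) 0<ε

  dist-sym : ∀ p q → ∣ p ℚ.- q ∣ ≡ ∣ q ℚ.- p ∣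
  dist-sym p q = trans (cong ∣_∣ (sym (⁻¹-anti-homo-// ℚ.+-0-abelianGroup q p))) (ℚ.∣-p∣≡∣p∣ (q ℚ.- p))

  sum<ε : ∀ {ε} p q → ∣ p ∣ ℚ.< ε ℚ.* ½ → ∣ q ∣ ℚ.< ε ℚ.* ½ → ∣ p ℚ.+ q ∣ ℚ.< ε
  sum<ε {ε} p q p< q< = subst (∣ p ℚ.+ q ∣ ℚ.<_) (halves ε)
    (ℚ.≤-<-trans (ℚ.∣p+q∣≤∣p∣+∣q∣ p q) (ℚ.+-mono-< p< q<))

  +-dist : ∀ {ε} a b c d → ∣ a ℚ.- b ∣ ℚ.< ε ℚ.* ½ → ∣ c ℚ.- d ∣ ℚ.< ε ℚ.* ½ →
           ∣ (a ℚ.+ c) ℚ.- (b ℚ.+ d) ∣ ℚ.< ε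
  +-dist {ε} a b c d ab< cd< = subst (λ x → ∣ x ∣ ℚ.< ε)
    (trans (interchange (AbelianGroup.commutativeSemigroup ℚ.+-0-abelianGroup) a (ℚ.- b) c (ℚ.- d))
           (cong ((a ℚ.+ c) ℚ.+_) (sym (ℚ.neg-distrib-+ b d))))
    (sum<ε (a ℚ.- b) (c ℚ.- d) ab< cd<)

  neg-dist : ∀ {ε} a b → ∣ a ℚ.- b ∣ ℚ.< ε → ∣ (ℚ.- a) ℚ.- (ℚ.- b) ∣ ℚ.< ε
  neg-dist {ε} a b = subst (ℚ._< ε)
    (trans (sym (ℚ.∣-p∣≡∣p∣ (a ℚ.- b))) (cong ∣_∣ (ℚ.neg-distrib-+ a (ℚ.- b))))

  dist-triangle : ∀ {ε} a b c → ∣ a ℚ.- b ∣ ℚ.< ε ℚ.* ½ → ∣ b ℚ.- c ∣ ℚ.< ε ℚ.* ½ →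
                  ∣ a ℚ.- c ∣ ℚ.< ε
  dist-triangle {ε} a b c ab< bc< = subst (λ x → ∣ x ∣ ℚ.< ε)
    (trans (sym (ℚ.+-assoc (a ℚ.- b) b (ℚ.- c)))
           (cong (ℚ._- c) (//-rightDividesˡ ℚ.+-0-abelianGroup b a)))
    (sum<ε (a ℚ.- b) (b ℚ.- c) ab< bc<)

fromℚ : ℚ → ℝ
fromℚ q = mkℝ (λ _ → q) λ ε 0<ε → 0 , λ _ _ _ _ → self-dist q 0<ε

fromℕ : ℕ → ℝ
fromℕ n = fromℚ (+ n ℚ./ 1)

0ℝ : ℝ
0ℝ = fromℕ 0

infixl 6 _+_ _-_
infix  8 -_

_+_ : ℝ → ℝ → ℝ
x + y = mkℝ (λ n → seq x n ℚ.+ seq y n) λ ε 0<ε →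
  let (N , h) = cauchy x (ε ℚ.* ½) (half-pos 0<ε)
      (K , k) = cauchy y (ε ℚ.* ½) (half-pos 0<ε)
  in N ⊔ K , λ m n ≤m ≤n → +-dist (seq x m) (seq x n) (seq y m) (seq y n)
       (h m n (ℕ.m⊔n≤o⇒m≤o N K ≤m) (ℕ.m⊔n≤o⇒m≤o N K ≤n))
       (k m n (ℕ.m⊔n≤o⇒n≤o N K ≤m) (ℕ.m⊔n≤o⇒n≤o N K ≤n))

-_ : ℝ → ℝ
- x = mkℝ (λ n → ℚ.- seq x n) λ ε 0<ε →
  let (N , h) = cauchy x ε 0<ε
  in N , λ m n ≤m ≤n → neg-dist (seq x m) (seq x n) (h m n ≤m ≤n)

_-_ : ℝ → ℝ → ℝ
x - y = x + (- y)

private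
  ≃-refl : ∀ {x} → x ≃ x
  ≃-refl {x} ε 0<ε = 0 , λ n _ → self-dist (seq x n) 0<ε

  ≃-sym : ∀ {x y} → x ≃ y → y ≃ x
  ≃-sym {x} {y} x≃y ε 0<ε =
    let (N , h) = x≃y ε 0<ε
    in N , λ n ≤n → subst (ℚ._< ε) (dist-sym (seq x n) (seq y n)) (h n ≤n)

  ≃-trans : ∀ {x y z} → x ≃ y → y ≃ z → x ≃ z
  ≃-trans {x} {y} {z} x≃y y≃z ε 0<ε =
    let (N , h) = x≃y (ε ℚ.* ½) (half-pos 0<ε)
        (K , k) = y≃z (ε ℚ.* ½) (half-pos 0<ε)
    in N ⊔ K , λ n ≤n → dist-triangle (seq x n) (seq y n) (seq z n)
         (h n (ℕ.m⊔n≤o⇒m≤o N K ≤n)) (k n (ℕ.m⊔n≤o⇒n≤o N K ≤n))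

  shift-≤ : ∀ a d ε → 0ℚ ℚ.< d → a ℚ.+ ε ℚ.≤ a ℚ.+ d ℚ.+ ε
  shift-≤ a d ε 0<d = ℚ.+-monoˡ-≤ ε
    (subst (ℚ._≤ a ℚ.+ d) (ℚ.+-identityʳ a) (ℚ.+-monoʳ-≤ a (ℚ.<⇒≤ 0<d)))

  +-nonneg : ∀ a d → 0ℝ ≤ a → 0ℝ < d → 0ℝ ≤ a + d
  +-nonneg a d 0≤a (δ , 0<δ , K , k) (ε , 0<ε , N , h) = 0≤a
    ( ε , 0<ε , N ⊔ K
    , λ n ≤n → ℚ.≤-<-trans
        (shift-≤ (seq a n) (seq d n) ε
          (ℚ.<-trans (subst (0ℚ ℚ.<_) (sym (ℚ.+-identityˡ δ)) 0<δ)
                     (k n (ℕ.m⊔n≤o⇒n≤o N K ≤n))))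
        (h n (ℕ.m⊔n≤o⇒m≤o N K ≤n)) )

record ℝ≥0 : Set where
  constructor mkℝ≥0
  field
    val    : ℝ
    nonneg : 0ℝ ≤ val

open ℝ≥0 public

ℝ≥0-setoid : Setoid 0ℓ 0ℓ
ℝ≥0-setoid = record
  { Carrier       = ℝ≥0
  ; _≈_           = λ x y → val x ≃ val y
  ; isEquivalence = record
    { refl  = λ {x} → ≃-refl {val x}
    ; sym   = λ {x} {y} → ≃-sym {val x} {val y}
    ; trans = λ {x} {y} {z} → ≃-trans {val x} {val y} {val z}
    }
  }

record ℝ⁺ : Set where
  constructor mkℝ⁺
  field
    val⁺ : ℝ
    pos  : 0ℝ < val⁺

open ℝ⁺ public

infixl 6 _+⁺_

_+⁺_ : ℝ≥0 → ℝ⁺ → ℝ≥0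
a +⁺ d = mkℝ≥0 (val a + val⁺ d) (+-nonneg (val a) (val⁺ d) (nonneg a) (pos d))

IsFloor : ℝ → ℕ → Set
IsFloor x k = fromℕ k ≤ x × x < fromℕ (suc k)

IsFrac : ℝ → ℝ → Set
IsFrac x f = ∃[ k ] IsFloor x k × f ≃ x - fromℕ k

FracZero : ℝ → Set
FracZero x = IsFrac x 0ℝ

FracLess : ℝ → ℝ → Set
FracLess x y = ∃[ f ] ∃[ g ] IsFrac x f × IsFrac y g × f < g

infix 4 _⟶_

_⟶_ : (ℕ → ℝ) → ℝ → Set
s ⟶ l = ∀ ε → 0ℚ ℚ.< ε →
  ∃[ N ] ∀ n → N ℕ.≤ n → l - fromℚ ε < s n × s n < l + fromℚ ε

------------------------------------------------------------------------
-- Timed Petri nets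

data Bracket : Set where
  closed open′ : Bracket

data Upper : Set where
  finite : ℕ → Bracket → Upper
  ∞      : Upper

record Interval : Set where
  constructor interval
  field
    lower        : ℕ
    lowerBracket : Bracket
    upper        : Upper

infix 4 _∈ᴵ_

_∈ᴵ_ : ℝ → Interval → Set
x ∈ᴵ interval l b u = AboveLower b × BelowUpper u
  where
  AboveLower : Bracket → Set
  AboveLower closed = fromℕ l ≤ x
  AboveLower open′  = fromℕ l < x

  BelowUpper : Upper → Set
  BelowUpper (finite m closed) = x ≤ fromℕ m
  BelowUpper (finite m open′)  = x < fromℕ m
  BelowUpper ∞                 = ⊤

record TPN : Set where
  field
    #P #T  : ℕ
    In Out : Fin #T → Fin #P → Maybe Interval

  Place Transition : Set
  Place      = Fin #P
  Transition = Fin #T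

constants : Interval → List ℕ
constants (interval l _ (finite m _)) = l ∷ m ∷ []
constants (interval l _ ∞)            = l ∷ []

-- The largest integer on the arcs of N (0 if N has no arcs).
maxConst : TPN → ℕ
maxConst N = foldr _⊔_ 0
  (concatMap (λ t → concatMap (λ p → arc (In t p) ++ arc (Out t p)) (allFin #P)) (allFin #T))
  where
  open TPN N

  arc : Maybe Interval → List ℕ
  arc = Maybe.maybe′ constants []

module _ (N : TPN) where
  open TPN N

  Token : Set
  Token = Place × ℝ≥0

  age : Token → ℝ
  age (_ , x) = val x

  -- Finite multisets are lists up to permutation, with equality of
  -- reals as the equality of ages.
  Marking : Set
  Marking = List Token

  open Permutation (×-setoid (≡.setoid Place) ℝ≥0-setoid)
    public using () renaming (_↭_ to _≋_)

  infix 4 _≤ᴹ_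

  _≤ᴹ_ : Marking → Marking → Set
  M ≤ᴹ M′ = ∃[ c ] M′ ≋ M ++ c

  Timed : ℝ⁺ → Marking → Marking → Set
  Timed x M₁ M₂ = M₂ ≋ map (map₂ (_+⁺ x)) M₁

  -- b consists of exactly one token (p , a p) with a p in arcs p for each
  -- p such that arcs p is defined; the other values of a are irrelevant.
  OnePerArc : (Place → Maybe Interval) → Marking → Set
  OnePerArc arcs b = Σ[ a ∈ (Place → ℝ≥0) ]
    (∀ p I → arcs p ≡ just I → val (a p) ∈ᴵ I) ×
    b ≋ mapMaybe (λ p → Maybe.map (λ _ → p , a p) (arcs p)) (allFin #P)

  -- The multiset c is M₁ - b₁.
  Fire : Transition → Marking → Marking → Set
  Fire t M₁ M₂ = ∃[ b₁ ] ∃[ b₂ ] ∃[ c ]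
    OnePerArc (In t) b₁ × OnePerArc (Out t) b₂ × M₁ ≋ b₁ ++ c × M₂ ≋ c ++ b₂

  Disc : Marking → Marking → Set
  Disc M₁ M₂ = ∃[ t ] Fire t M₁ M₂

  Disc⁺ : Marking → Marking → Set
  Disc⁺ = TransClosure Disc

  ----------------------------------------------------------------------
  -- Infinite computations

  -- M₀ →D⁺ M₀′ →x₀ M₁ →D⁺ M₁′ →x₁ ⋯ with infinitely many timed transitions.
  record InfinitelyTimed (M : Marking) : Set where
    field
      marking marking′ : ℕ → Marking
      delay            : ℕ → ℝ⁺
      start            : marking 0 ≋ M
      discrete         : ∀ i → Disc⁺ (marking i) (marking′ i)
      timed            : ∀ i → Timed (delay i) (marking′ i) (marking (suc i))

  -- Finitely many timed transitions, then an infinite sequence of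
  -- discrete ones.
  data FinitelyTimed (M : Marking) : Set where
    discreteForever : (marking : ℕ → Marking) → marking 0 ≋ M →
                      (∀ i → Disc (marking i) (marking (suc i))) → FinitelyTimed M
    phase           : ∀ {M′ M″} → Disc⁺ M M′ → (x : ℝ⁺) → Timed x M′ M″ →
                      FinitelyTimed M″ → FinitelyTimed M

  data InfDiscComputation (M : Marking) : Set where
    finitely   : FinitelyTimed M → InfDiscComputation M
    infinitely : InfinitelyTimed M → InfDiscComputation M

  data InfComputation (M : Marking) : Set where
    disc : InfDiscComputation M → InfComputation M
    time : ∀ {M₀} (x : ℝ⁺) → Timed x M M₀ → InfDiscComputation M₀ → InfComputation M

  Delays : Set
  Delays = List ℝ ⊎ (ℕ → ℝ)

  consDelay : ℝ → Delays → Delays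
  consDelay x (inj₁ xs) = inj₁ (x ∷ xs)
  consDelay x (inj₂ xs) = inj₂ λ { zero → x ; (suc n) → xs n }

  delaysᶠ : ∀ {M} → FinitelyTimed M → List ℝ
  delaysᶠ (discreteForever _ _ _) = []
  delaysᶠ (phase _ x _ π)         = val⁺ x ∷ delaysᶠ π

  delaysᵈ : ∀ {M} → InfDiscComputation M → Delays
  delaysᵈ (finitely π)   = inj₁ (delaysᶠ π)
  delaysᵈ (infinitely π) = inj₂ λ i → val⁺ (InfinitelyTimed.delay π i)

  delays : ∀ {M} → InfComputation M → Delays
  delays (disc π)     = delaysᵈ π
  delays (time x _ π) = consDelay (val⁺ x) (delaysᵈ π)

  partialSum : (ℕ → ℝ) → ℕ → ℝ
  partialSum xs zero    = 0ℝ
  partialSum xs (suc n) = partialSum xs n + xs n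

  HasSum : Delays → ℝ → Set
  HasSum (inj₁ xs) d = foldr _+_ 0ℝ xs ≃ d
  HasSum (inj₂ xs) d = partialSum xs ⟶ d

  -- Δ(π) = d for real d; an infinite total delay is related to no d.
  HasDelay : ∀ {M} → InfComputation M → ℝ → Set
  HasDelay π d = HasSum (delays π) d

  Zerotime : Marking → Set
  Zerotime M = ∃[ π ] HasDelay {M} π 0ℝ

  ----------------------------------------------------------------------
  -- Regions

  private
    max = maxConst N

  record Region : Set where
    constructor region
    field
      b₀   : List (Place × Fin (suc max))
      w    : List (List⁺ (Place × Fin max))
      bmax : List Place

  module _ (R : Region) where
    open Region R

    -- Elements, with multiplicity, of b₀ , b₁ ⋯ bₘ , bₘ₊₁.
    data Element : Set where
      inZero : Fin (length b₀) → Element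
      inWord : (j : Fin (length w)) → Fin (List⁺.length (lookup w j)) → Element
      inMax  : Fin (length bmax) → Element

    block : Element → ℕ
    block (inZero _)   = 0
    block (inWord j _) = suc (toℕ j)
    block (inMax _)    = suc (length w)

    placeOf : Element → Place
    placeOf (inZero i)   = proj₁ (lookup b₀ i)
    placeOf (inWord j i) = proj₁ (lookup (List⁺.toList (lookup w j)) i)
    placeOf (inMax i)    = lookup bmax i

    integerOf : Element → Maybe ℕ
    integerOf (inZero i)   = just (toℕ (proj₂ (lookup b₀ i)))
    integerOf (inWord j i) = just (toℕ (proj₂ (lookup (List⁺.toList (lookup w j)) i)))
    integerOf (inMax _)    = nothing

    record Satisfies (M : Marking) : Set where
      field
        bijection : Fin (length M) ⤖ Element

      h : Fin (length M) → Element
      h = Bijection.to bijection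

      x : Fin (length M) → ℝ
      x i = age (lookup M i)

      field
        places   : ∀ i → placeOf (h i) ≡ proj₁ (lookup M i)
        above    : ∀ i → block (h i) ≡ suc (length w) ⇔ fromℕ max < x i
        integers : ∀ i → x i ≤ fromℕ max →
                   ∃[ k ] integerOf (h i) ≡ just k × IsFloor (x i) k
        zeros    : ∀ i → x i ≤ fromℕ max → FracZero (x i) ⇔ block (h i) ≡ 0
        order    : ∀ i₁ i₂ → x i₁ < fromℕ max → x i₂ < fromℕ max →
                   FracLess (x i₁) (x i₂) ⇔ block (h i₁) ℕ.< block (h i₂)

  infix 4 _∈⟦_⟧ _∈⟦_⟧↑

  _∈⟦_⟧ : Marking → Region → Set
  M ∈⟦ R ⟧ = Satisfies R M

  _∈⟦_⟧↑ : Marking → Region → Set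
  M ∈⟦ R ⟧↑ = ∃[ M′ ] M′ ∈⟦ R ⟧ × M′ ≤ᴹ M

  MRUC : Set
  MRUC = List Region

  denotation : MRUC → Marking → Set
  denotation α M = Any (M ∈⟦_⟧↑) α

{-# OPTIONS --safe #-}
module Submission where

-- No time passes in a computation of total delay zero, since every delay of a timed
-- transition is positive. Hence M is a zerotime-marking iff an infinite sequence of discrete
-- transitions starts in M (zerotime⇒discrete, discrete⇒zerotime). Without the passage of
-- time an age matters only through its comparisons with the integers up to max, that is,
-- through one of 2 max + 2 classes. Forgetting everything but place and class turns the
-- discrete part of N into a finite Petri net over the keys (place , class), and firing
-- sequences correspond in both directions (disc⇒step, step⇒disc).
--
-- By Dickson's lemma an infinite run of a Petri net contains markings m i and m j with
-- i < j and m i bounded by m j, so it yields a run u followed by a nonempty v whose effect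
-- is nonnegative on every key; conversely v can then be repeated forever. Such a pair u , v
-- is called self-covering. The crucial point is a computable bound, depending on the net
-- only and not on the marking, on the length of a shortest self-covering pair (shortCover).
-- This is Rackoff's argument, by induction on the number of keys whose nonnegativity is
-- imposed along the run. If the count of one of these keys exceeds the bound for fewer keys,
-- its constraint can be dropped from that point on, and the part before is a walk in a finite
-- graph that can be shortened. Otherwise v is a closed walk in a finite graph. It is
-- decomposed into a short closed walk through all its vertices and short cycles attached to
-- it (decompose). Among these parts, the closed walk and boundedly many cycles already have
-- a nonnegative total effect (groupWith), because any list of bounded integer vectors of
-- nonnegative total splits into short lists of nonnegative total: for one coordinate, order
-- the list so that its partial sums stay bounded, and cut the resulting walk at repeated
-- partial sums.
--
-- A run of bounded length uses boundedly many tokens of each key. So M is a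
-- zerotime-marking iff it has a submarking of bounded size whose keys admit a short
-- self-covering pair. The algorithm enumerates all regions with parts of bounded size and
-- keeps those whose multiset of keys passes this decidable test (zerotimeRegions). All
-- markings that satisfy a region have the keys of the region (satisfies⇒flat), and every
-- marking satisfies some region, found by sorting its tokens with fractional ages into
-- blocks of equal fractional part (arrange).

open import Defs
open import Axiom.ExcludedMiddle using (ExcludedMiddle)
open import Data.Product.Base using (Σ-syntax)
open import Function.Bundles using (_⇔_)
open import Level using (0ℓ)

open import Data.Empty using (⊥-elim)
open import Data.Fin.Base as Fin using (Fin; zero; suc; toℕ; cast; punchIn; punchOut)
import Data.Fin.Properties as Fin
open import Data.Integer.Base as ℤ using (ℤ; +_; 0ℤ; -[1+_])
import Data.Integer.Properties as ℤ
open import Data.Integer.Tactic.RingSolver using (solve-∀)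
open import Data.List.Base
  using (List; []; _∷_; [_]; _++_; map; mapMaybe; catMaybes; concat; concatMap; foldr; filter; length; lookup;
         allFin; cartesianProduct; cartesianProductWith)
import Data.List.Properties as List
open import Data.List.NonEmpty.Base as List⁺ using (List⁺; _∷_)
open import Data.List.Membership.Propositional using (_∈_; lose; find)
open import Data.List.Membership.Propositional.Properties
open import Data.List.Membership.Propositional.Properties.WithK using (unique∧set⇒bag)
open import Data.List.Relation.Binary.BagAndSetEquality using (∼bag⇒↭)
import Data.List.Relation.Binary.Permutation.Homogeneous as Hom
open import Data.List.Relation.Binary.Permutation.Propositional as Perm hiding (trans)
open import Data.List.Relation.Binary.Permutation.Propositional.Properties
open import Data.List.Relation.Binary.Pointwise.Base using (Pointwise; []; _∷_)
open import Data.List.Relation.Unary.All as All using (All; []; _∷_)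
import Data.List.Relation.Unary.All.Properties as All
open import Data.List.Relation.Unary.AllPairs using (AllPairs; []; _∷_)
open import Data.List.Relation.Unary.Any as Any using (Any; here; there)
open import Data.List.Relation.Unary.Any.Properties using (lookup-index)
open import Data.List.Relation.Unary.Unique.Propositional using (Unique)
import Data.List.Relation.Unary.Unique.Propositional.Properties as Unique
open import Data.Maybe.Base as Maybe using (Maybe; just; nothing)
open import Data.Nat.Base as ℕ using (ℕ; zero; suc; z≤n; s≤s; _⊔_)
import Data.Nat.Properties as ℕ
open import Data.Product.Base using (∃-syntax; _×_; _,_; proj₁; proj₂)
open import Data.Product.Properties using (≡-dec)
open import Data.Rational as ℚ using (ℚ; 0ℚ; ½; ∣_∣)
import Data.Rational.Properties as ℚ
open import Data.Rational.Solver using (module +-*-Solver)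
import Data.Rational.Unnormalised.Base as ℚᵘ
import Data.Rational.Unnormalised.Properties as ℚᵘ
open import Data.Sum.Base using (_⊎_; inj₁; inj₂; [_,_]′)
open import Data.Unit.Base using (⊤; tt)
open import Function.Base using (_∘_; id; case_of_)
open import Function.Bundles using (_⤖_; mk⇔; mk⤖; module Bijection; module Equivalence)
open import Relation.Binary.Definitions using (DecidableEquality; tri<; tri≈; tri>)
open import Relation.Binary.PropositionalEquality
  using (_≡_; _≢_; refl; sym; trans; cong; cong₂; subst; subst₂)
open import Relation.Nullary using (¬_; yes; no; Dec)
open import Relation.Nullary.Decidable using (map′; _×-dec_; ¬?; decidable-stable)

open +-*-Solver using (solve; _:+_; _:*_; :-_; _:=_; con)

-- Totals of integer weights along lists

-- The sum of the weights of the entries of a list.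
total : ∀ {A : Set} → (A → ℤ) → List A → ℤ
total a []       = 0ℤ
total a (x ∷ xs) = a x ℤ.+ total a xs

total-++ : ∀ {A : Set} (a : A → ℤ) xs ys → total a (xs ++ ys) ≡ total a xs ℤ.+ total a ys
total-++ a []       ys = sym (ℤ.+-identityˡ _)
total-++ a (x ∷ xs) ys = trans (cong (λ z → a x ℤ.+ z) (total-++ a xs ys)) (sym (ℤ.+-assoc (a x) (total a xs) (total a ys)))

total-↭ : ∀ {A : Set} (a : A → ℤ) {xs ys} → xs ↭ ys → total a xs ≡ total a ys
total-↭ a refl         = refl
total-↭ a (prep x p)   = cong (λ z → a x ℤ.+ z) (total-↭ a p)
total-↭ a (swap x y p) = trans (cong (λ z → a x ℤ.+ (a y ℤ.+ z)) (total-↭ a p)) (exchange (a x) (a y) _)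
  where
  exchange : ∀ i j k → i ℤ.+ (j ℤ.+ k) ≡ j ℤ.+ (i ℤ.+ k)
  exchange = solve-∀
total-↭ a (Perm.trans p q)  = trans (total-↭ a p) (total-↭ a q)

total-concat : ∀ {A : Set} (a : A → ℤ) xss → total a (concat xss) ≡ total (total a) xss
total-concat a []         = refl
total-concat a (xs ∷ xss) = trans (total-++ a xs (concat xss)) (cong (λ z → total a xs ℤ.+ z) (total-concat a xss))

total-map : ∀ {A B : Set} (a : B → ℤ) (f : A → B) xs → total a (map f xs) ≡ total (λ x → a (f x)) xs
total-map a f []       = refl
total-map a f (x ∷ xs) = cong (λ z → a (f x) ℤ.+ z) (total-map a f xs)

total-nonneg : ∀ {A : Set} {a : A → ℤ} {xs} → All (λ x → 0ℤ ℤ.≤ a x) xs → 0ℤ ℤ.≤ total a xs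
total-nonneg []       = ℤ.≤-refl
total-nonneg (p ∷ ps) = ℤ.+-mono-≤ p (total-nonneg ps)

∣total∣≤ : ∀ {A : Set} {a : A → ℤ} {B xs} → All (λ x → ℤ.∣ a x ∣ ℕ.≤ B) xs →
           ℤ.∣ total a xs ∣ ℕ.≤ length xs ℕ.* B
∣total∣≤ []                         = z≤n
∣total∣≤ {a = a} {xs = x ∷ xs} (p ∷ ps) =
  ℕ.≤-trans (ℤ.∣i+j∣≤∣i∣+∣j∣ (a x) (total a xs)) (ℕ.+-mono-≤ p (∣total∣≤ ps))

lookup-injective : ∀ {A : Set} {xs : List A} → Unique xs → ∀ i j → lookup xs i ≡ lookup xs j → i ≡ j
lookup-injective {xs = x ∷ xs} (x∉ ∷ u) zero    zero    e = refl
lookup-injective {xs = x ∷ xs} (x∉ ∷ u) zero    (suc j) e = ⊥-elim (All.lookup x∉ (∈-lookup j) e)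
lookup-injective {xs = x ∷ xs} (x∉ ∷ u) (suc i) zero    e = ⊥-elim (All.lookup x∉ (∈-lookup i) (sym e))
lookup-injective {xs = x ∷ xs} (x∉ ∷ u) (suc i) (suc j) e = cong suc (lookup-injective u i j e)

unique⇒length≤ : ∀ {n} {xs : List (Fin n)} → Unique xs → length xs ℕ.≤ n
unique⇒length≤ {n} {xs} u with length xs ℕ.≤? n
... | yes ≤n = ≤n
... | no ≰n with Fin.pigeonhole (ℕ.≰⇒> ≰n) (lookup xs)
... | i , j , i<j , e = ⊥-elim (Fin.<⇒≢ i<j (lookup-injective u i j e))

concat-↭ : ∀ {A : Set} {xss yss : List (List A)} → xss ↭ yss → concat xss ↭ concat yss
concat-↭ refl           = refl
concat-↭ (prep xs p)    = ++⁺ˡ xs (concat-↭ p)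
concat-↭ (swap xs ys p) = ↭-trans (shifts xs ys) (++⁺ˡ ys (++⁺ˡ xs (concat-↭ p)))
concat-↭ (Perm.trans p q)    = ↭-trans (concat-↭ p) (concat-↭ q)

-- Walks in finite labelled graphs

-- A bound for the length of a walk with given ends through given vertices in a graph with
-- n vertices: at most n steps, and at most n + 1 more for each vertex to be reached.
skeletonBound : ℕ → ℕ
skeletonBound n = n ℕ.+ n ℕ.* suc n

-- Edge x t y is the type of edges from x to y with label t.
module Walks {n : ℕ} {T : Set} (Edge : Fin n → T → Fin n → Set) where

  infixr 5 _∷_

  -- Walks, indexed by the word of their labels.
  data Path : Fin n → List T → Fin n → Set where
    []  : ∀ {x} → Path x [] x
    _∷_ : ∀ {x t y σ z} → Edge x t y → Path y σ z → Path x (t ∷ σ) z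

  infixr 5 _++ᴾ_

  _++ᴾ_ : ∀ {x σ y τ z} → Path x σ y → Path y τ z → Path x (σ ++ τ) z
  []      ++ᴾ q = q
  (e ∷ p) ++ᴾ q = e ∷ (p ++ᴾ q)

  splitᴾ : ∀ {x z} σ {τ} → Path x (σ ++ τ) z → ∃[ y ] Path x σ y × Path y τ z
  splitᴾ []      p       = _ , [] , p
  splitᴾ (t ∷ σ) (e ∷ p) = let (y , q , r) = splitᴾ σ p in y , e ∷ q , r

  -- The vertex v occurs on the walk.
  data Visits (v : Fin n) : ∀ {x σ z} → Path x σ z → Set where
    here  : ∀ {σ z} {p : Path v σ z} → Visits v p
    there : ∀ {x t y σ z} {e : Edge x t y} {p : Path y σ z} → Visits v p → Visits v (e ∷ p)

  visits-++ : ∀ {v x σ y τ z} (p : Path x σ y) {q : Path y τ z} → Visits v q → Visits v (p ++ᴾ q)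
  visits-++ []      h = h
  visits-++ (e ∷ p) h = there (visits-++ p h)

  vertices : ∀ {x σ z} → Path x σ z → List (Fin n)
  vertices ([] {x})      = x ∷ []
  vertices (_∷_ {x} e p) = x ∷ vertices p

  length-vertices : ∀ {x σ z} (p : Path x σ z) → length (vertices p) ≡ suc (length σ)
  length-vertices []      = refl
  length-vertices (e ∷ p) = cong suc (length-vertices p)

  simple⇒short : ∀ {x σ z} (p : Path x σ z) → Unique (vertices p) → length σ ℕ.≤ n
  simple⇒short p u = ℕ.≤-trans (ℕ.n≤1+n _) (subst (ℕ._≤ n) (length-vertices p) (unique⇒length≤ u))

  -- A path cut at one of its vertices; the second part inherits simplicity.
  cutAt : ∀ {v x σ z} (p : Path x σ z) → Unique (vertices p) → v ∈ vertices p →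
          ∃[ α ] ∃[ β ] Σ[ q ∈ Path x α v ] Σ[ r ∈ Path v β z ] σ ≡ α ++ β × Unique (vertices r)
  cutAt []      u       (here refl) = [] , [] , [] , [] , refl , u
  cutAt (e ∷ p) u       (here refl) = [] , _ , [] , e ∷ p , refl , u
  cutAt (_∷_ {t = t} e p) (_ ∷ u) (there v∈) =
    let (α , β , q , r , eq , u′) = cutAt p u v∈
    in t ∷ α , β , e ∷ q , r , cong (t ∷_) eq , u′

  -- A closed walk, also the empty one.
  record Cycle : Set where
    constructor cycle
    field
      {base} : Fin n
      {word} : List T
      loop   : Path base word base

  open Cycle public

  words : List Cycle → List T
  words cs = concat (map word cs)

  private
    -- Reading a walk from its end, the part already read is kept as a simple stem followed by
    -- a skeleton that visits all vertices seen so far; the remaining edges form short cycles.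
    record Decomposition {x z : Fin n} (σ : List T) : Set where
      constructor decomposition
      field
        {mid}     : Fin n
        {τ s}     : List T
        stem      : Path x τ mid
        skeleton  : Path mid s z
        simple    : Unique (vertices stem)
        seen      : List (Fin n)
        distinct  : Unique seen
        visited   : All (λ v → Visits v skeleton) seen
        short     : length s ℕ.≤ length seen ℕ.* suc n
        cycles    : List Cycle
        attached  : All (λ c → base c ∈ seen) cycles
        cyclesShort : All (λ c → length (word c) ℕ.≤ suc n) cycles
        split     : σ ↭ τ ++ s ++ words cycles

    decompose′ : ∀ {x σ z} → Path x σ z → Decomposition {x} {z} σ
    decompose′ {x} [] = decomposition [] [] ([] ∷ []) (x ∷ []) ([] ∷ []) (here ∷ []) z≤n [] [] [] refl
    decompose′ {x} (_∷_ {t = t} e p) with decompose′ p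
    ... | decomposition {τ = τ} {s} stem skel simple seen dist vis short cs att cshort sp
      with Any.any? (x Fin.≟_) seen
    -- A new vertex x: the stem becomes part of the skeleton.
    ... | no x∉ = decomposition [] (e ∷ (stem ++ᴾ skel)) ([] ∷ [])
            (x ∷ seen) (All.¬Any⇒All¬ seen x∉ ∷ dist)
            (here ∷ All.map (λ h → there (visits-++ stem h)) vis)
            (s≤s (subst (ℕ._≤ n ℕ.+ length seen ℕ.* suc n) (sym (List.length-++ τ))
              (ℕ.+-mono-≤ (simple⇒short stem simple) short)))
            cs (All.map there att) cshort
            (prep t (↭-trans sp (↭-reflexive (sym (List.++-assoc τ s (words cs))))))
    ... | yes x∈ with Any.any? (x Fin.≟_) (vertices stem)
    -- The vertex x is known but not on the stem, which is extended.
    ... | no x∉ = decomposition (e ∷ stem) skel (All.¬Any⇒All¬ _ x∉ ∷ simple)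
            seen dist vis short cs att cshort (prep t sp)
    ... | yes x∈stem with cutAt stem simple x∈stem
    -- The vertex x is on the stem: the loop at x is split off as a cycle.
    ... | α , β , q , r , refl , u = decomposition r skel u seen dist vis short
            (cycle (e ∷ q) ∷ cs) (x∈ ∷ att)
            (s≤s (ℕ.≤-trans (ℕ.m≤m+n (length α) (length β))
                   (subst (ℕ._≤ n) (List.length-++ α) (simple⇒short stem simple))) ∷ cshort)
            (↭-trans (prep t (↭-trans sp (↭-trans (↭-reflexive (List.++-assoc α β _))
               (↭-trans (shifts α β) (++⁺ˡ β (shifts α s))))))
             (↭-trans (↭-sym (shift t β _)) (++⁺ˡ β (↭-sym (shift t s _)))))

  abstract
    -- Every walk is, up to reordering of its edges, a short walk with the same ends
    -- together with short cycles based at vertices of that short walk.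
    decompose : ∀ {x σ z} → Path x σ z →
      ∃[ s ] Σ[ p ∈ Path x s z ] length s ℕ.≤ skeletonBound n ×
      ∃[ cs ] All (λ c → Visits (base c) p) cs × All (λ c → length (word c) ℕ.≤ suc n) cs ×
      σ ↭ s ++ words cs
    decompose p with decompose′ p
    ... | decomposition {τ = τ} {s} stem skel simple seen dist vis short cs att cshort sp =
      τ ++ s , stem ++ᴾ skel
      , subst (ℕ._≤ skeletonBound n) (sym (List.length-++ τ))
          (ℕ.+-mono-≤ (simple⇒short stem simple)
            (ℕ.≤-trans short (ℕ.*-monoˡ-≤ (suc n) (unique⇒length≤ dist))))
      , cs , All.map (λ b∈ → visits-++ stem (All.lookup vis b∈)) att , cshort
      , ↭-trans sp (↭-reflexive (sym (List.++-assoc τ s (words cs))))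

    -- The cycle is inserted at its base, and all vertices are still visited.
    insertCycle : ∀ {x s z} (p : Path x s z) (c : Cycle) → Visits (base c) p →
      ∃[ s′ ] Σ[ p′ ∈ Path x s′ z ] s′ ↭ word c ++ s × (∀ {v} → Visits v p → Visits v p′)
    insertCycle p       c here      = _ , loop c ++ᴾ p , refl , visits-++ (loop c)
    insertCycle (_∷_ {x} {t} e p) c (there h) =
      let (s′ , p′ , s′↭ , keep) = insertCycle p c h
      in t ∷ s′ , e ∷ p′ , ↭-trans (prep t s′↭) (↭-sym (shift t (word c) _))
       , λ { here → here ; (there h′) → there (keep h′) }

    insertCycles : ∀ {x s z} (p : Path x s z) (cs : List Cycle) → All (λ c → Visits (base c) p) cs →
      ∃[ s′ ] Path x s′ z × s′ ↭ s ++ words cs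
    insertCycles {s = s} p []       []       = _ , p , ↭-reflexive (sym (List.++-identityʳ s))
    insertCycles {s = s} p (c ∷ cs) (h ∷ hs) =
      let (s₁ , p₁ , s₁↭ , keep) = insertCycle p c h
          (s₂ , p₂ , s₂↭)        = insertCycles p₁ cs (All.map keep hs)
      in s₂ , p₂ , ↭-trans s₂↭ (↭-trans (++⁺ʳ (words cs) s₁↭)
           (↭-trans (↭-reflexive (List.++-assoc (word c) s (words cs))) (shifts (word c) s)))

-- Splitting a list of nonnegative total into short parts of nonnegative total

private
  ∣i∣≤B⇒-B≤i : ∀ {i B} → ℤ.∣ i ∣ ℕ.≤ B → ℤ.- (+ B) ℤ.≤ i
  ∣i∣≤B⇒-B≤i {+ n}              _   = ℤ.neg-≤-pos
  ∣i∣≤B⇒-B≤i { -[1+ n ]} {suc B} (s≤s p) = ℤ.-≤- p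

  ∣i∣≤B⇒i≤B : ∀ {i B} → ℤ.∣ i ∣ ℕ.≤ B → i ℤ.≤ + B
  ∣i∣≤B⇒i≤B {+ n}      p = ℤ.+≤+ p
  ∣i∣≤B⇒i≤B { -[1+ n ]} _ = ℤ.-≤+

-- The length of the parts for one coordinate and items of absolute value at most B: the
-- parts come from walks in a graph with the 2 B + 1 partial sums from - B to B.
groupBound₁ : ℕ → ℕ
groupBound₁ B = suc (skeletonBound n ℕ.+ suc n)
  where n = suc (B ℕ.+ B)

module _ {A : Set} (a : A → ℤ) (B : ℕ) where

  private
    n : ℕ
    n = suc (B ℕ.+ B)

    -- The integer represented by a vertex; vertices are shifted by B.
    sumAt : Fin n → ℤ
    sumAt v = + toℕ v ℤ.- + B

    encode : ∀ z → ℤ.- (+ B) ℤ.≤ z → z ℤ.≤ + B → ∃[ v ] sumAt v ≡ z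
    encode z lo hi = Fin.fromℕ< bound
                   , trans (cong (λ k → + k ℤ.- + B) (Fin.toℕ-fromℕ< bound)) (trans (cong (ℤ._- + B) eq) (cancel z (+ B)))
      where
      cancel : ∀ i j → (i ℤ.+ j) ℤ.- j ≡ i
      cancel = solve-∀
      eq : + ℤ.∣ z ℤ.+ + B ∣ ≡ z ℤ.+ + B
      eq = ℤ.0≤i⇒+∣i∣≡i (subst (ℤ._≤ z ℤ.+ + B) (ℤ.+-inverseˡ (+ B)) (ℤ.+-monoˡ-≤ (+ B) lo))
      bound : ℤ.∣ z ℤ.+ + B ∣ ℕ.< suc (B ℕ.+ B)
      bound = s≤s (ℤ.drop‿+≤+ (subst (ℤ._≤ + (B ℕ.+ B)) (sym eq) (ℤ.+-monoˡ-≤ (+ B) hi)))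

    -- The vertices are the partial sums in [- B , B].
    open Walks {n} {A} (λ x i y → sumAt y ≡ sumAt x ℤ.+ a i)

    path-total : ∀ {x σ z} → Path x σ z → sumAt z ≡ sumAt x ℤ.+ total a σ
    path-total []      = sym (ℤ.+-identityʳ _)
    path-total {x} (_∷_ {t = t} {σ = σ} e p) =
      trans (path-total p) (trans (cong (ℤ._+ total a σ) e) (ℤ.+-assoc (sumAt x) (a t) (total a σ)))

    -- A negative item is taken when the partial sum is nonnegative, and a nonnegative item
    -- otherwise, so the partial sums remain between - B and B. The process ends with a
    -- nonnegative partial sum when the negative items are exhausted; nonnegative items may remain.
    arrange : ∀ v ns ps →
      All (λ i → a i ℤ.< 0ℤ × ℤ.∣ a i ∣ ℕ.≤ B) ns → All (λ i → 0ℤ ℤ.≤ a i × ℤ.∣ a i ∣ ℕ.≤ B) ps →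
      0ℤ ℤ.≤ sumAt v ℤ.+ (total a ns ℤ.+ total a ps) →
      ∃[ σ ] ∃[ z ] Path v σ z × ∃[ rest ] 0ℤ ℤ.≤ sumAt z × ns ++ ps ↭ σ ++ rest × All (λ i → 0ℤ ℤ.≤ a i) rest
    arrange v ns ps Ns Ps tot with 0ℤ ℤ.≤? sumAt v
    arrange v []       ps []             Ps tot | yes 0≤v = [] , v , [] , ps , 0≤v , refl , All.map proj₁ Ps
    arrange v (i ∷ ns) ps ((i<0 , i≤) ∷ Ns) Ps tot | yes 0≤v =
      let (w , w≡) = encode (sumAt v ℤ.+ a i)
            (subst (ℤ._≤ sumAt v ℤ.+ a i) (ℤ.+-identityˡ _) (ℤ.+-mono-≤ 0≤v (∣i∣≤B⇒-B≤i i≤)))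
            (subst (sumAt v ℤ.+ a i ℤ.≤_) (ℤ.+-identityʳ _) (ℤ.+-mono-≤ v≤B (ℤ.<⇒≤ i<0)))
          (σ , z , p , rest , 0≤z , perm , R) = arrange w ns ps Ns Ps
            (subst (0ℤ ℤ.≤_) (trans (shuffle (sumAt v) (a i) (total a ns) (total a ps))
              (cong (ℤ._+ (total a ns ℤ.+ total a ps)) (sym w≡))) tot)
      in i ∷ σ , z , w≡ ∷ p , rest , 0≤z , prep i perm , R
      where
      shuffle : ∀ x y z w → x ℤ.+ (y ℤ.+ z ℤ.+ w) ≡ x ℤ.+ y ℤ.+ (z ℤ.+ w)
      shuffle = solve-∀
      v≤B : sumAt v ℤ.≤ + B
      v≤B = subst (sumAt v ℤ.≤_) (cancel (+ B)) (ℤ.+-monoˡ-≤ (ℤ.- (+ B)) (ℤ.+≤+ (ℕ.≤-pred (Fin.toℕ<n v))))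
        where
        cancel : ∀ j → (j ℤ.+ j) ℤ.- j ≡ j
        cancel = solve-∀
    arrange v ns []       Ns []             tot | no ≰v =
      ⊥-elim (ℤ.<⇒≱ (subst (sumAt v ℤ.+ (total a ns ℤ.+ 0ℤ) ℤ.<_) (ℤ.+-identityʳ _)
        (ℤ.+-mono-<-≤ (ℤ.≰⇒> ≰v) (subst (ℤ._≤ 0ℤ) (sym (ℤ.+-identityʳ _)) (nonpos Ns)))) tot)
      where
      nonpos : ∀ {ns} → All (λ i → a i ℤ.< 0ℤ × ℤ.∣ a i ∣ ℕ.≤ B) ns → total a ns ℤ.≤ 0ℤ
      nonpos []              = ℤ.≤-refl
      nonpos ((i<0 , _) ∷ Ns) = ℤ.+-mono-≤ (ℤ.<⇒≤ i<0) (nonpos Ns)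
    arrange v ns (i ∷ ps) Ns ((0≤i , i≤) ∷ Ps) tot | no ≰v =
      let (w , w≡) = encode (sumAt v ℤ.+ a i)
            (subst (ℤ._≤ sumAt v ℤ.+ a i) (ℤ.+-identityʳ _) (ℤ.+-mono-≤ -B≤v 0≤i))
            (subst (sumAt v ℤ.+ a i ℤ.≤_) (ℤ.+-identityˡ _) (ℤ.+-mono-≤ (ℤ.<⇒≤ (ℤ.≰⇒> ≰v)) (∣i∣≤B⇒i≤B i≤)))
          (σ , z , p , rest , 0≤z , perm , R) = arrange w ns ps Ns Ps
            (subst (0ℤ ℤ.≤_) (trans (shuffle (sumAt v) (a i) (total a ns) (total a ps))
              (cong (ℤ._+ (total a ns ℤ.+ total a ps)) (sym w≡))) tot)
      in i ∷ σ , z , w≡ ∷ p , rest , 0≤z , ↭-trans (shift i ns ps) (prep i perm) , R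
      where
      shuffle : ∀ x y z w → x ℤ.+ (z ℤ.+ (y ℤ.+ w)) ≡ x ℤ.+ y ℤ.+ (z ℤ.+ w)
      shuffle = solve-∀
      -B≤v : ℤ.- (+ B) ℤ.≤ sumAt v
      -B≤v = subst (ℤ._≤ sumAt v) (ℤ.+-identityˡ _) (ℤ.+-monoˡ-≤ (ℤ.- (+ B)) (ℤ.+≤+ (z≤n {toℕ v})))

    bySign : ∀ xs → All (λ i → ℤ.∣ a i ∣ ℕ.≤ B) xs → ∃[ ns ] ∃[ ps ] xs ↭ ns ++ ps ×
      All (λ i → a i ℤ.< 0ℤ × ℤ.∣ a i ∣ ℕ.≤ B) ns × All (λ i → 0ℤ ℤ.≤ a i × ℤ.∣ a i ∣ ℕ.≤ B) ps
    bySign []       []       = [] , [] , refl , [] , []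
    bySign (i ∷ xs) (i≤ ∷ h) with bySign xs h | 0ℤ ℤ.≤? a i
    ... | ns , ps , perm , Ns , Ps | yes 0≤i = ns , i ∷ ps , ↭-trans (prep i perm) (↭-sym (shift i ns ps)) , Ns , (0≤i , i≤) ∷ Ps
    ... | ns , ps , perm , Ns , Ps | no ≰i   = i ∷ ns , ps , prep i perm , (ℤ.≰⇒> ≰i , i≤) ∷ Ns , Ps

  abstract
    -- The cycles of the walk of partial sums have total 0, its skeleton ends in a nonnegative
    -- sum, and the remaining items are singletons.
    group₁ : ∀ xs → All (λ i → ℤ.∣ a i ∣ ℕ.≤ B) xs → 0ℤ ℤ.≤ total a xs →
      ∃[ gs ] concat gs ↭ xs × All (λ g → length g ℕ.≤ groupBound₁ B × 0ℤ ℤ.≤ total a g) gs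
    group₁ xs xs≤ 0≤ =
      let (ns , ps , perm , Ns , Ps) = bySign xs xs≤
          (o , o≡)                   = encode 0ℤ ℤ.neg-≤-pos (ℤ.+≤+ z≤n)
          start                      = trans (total-↭ a perm) (trans (total-++ a ns ps) (sym (trans (cong (ℤ._+ (total a ns ℤ.+ total a ps)) o≡) (ℤ.+-identityˡ _))))
          (σ , z , p , rest , 0≤z , perm′ , R) = arrange o ns ps Ns Ps (subst (0ℤ ℤ.≤_) start 0≤)
          (s , q , s≤ , cs , _ , cs≤ , perm″)  = decompose p
      in s ∷ map word cs ++ map [_] rest
       , ↭-sym (↭-trans perm (↭-trans perm′ (↭-trans (++⁺ʳ rest perm″) (↭-reflexive
           (trans (List.++-assoc s (words cs) rest) (cong (s ++_)
             (trans (cong (words cs ++_) (sym (List.concat-map-[_] rest))) (List.concat-++ (map word cs) _))))))))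
       , (ℕ.≤-trans s≤ (ℕ.m≤n⇒m≤1+n (ℕ.m≤m+n _ _))
           , subst (0ℤ ℤ.≤_) (trans (path-total q) (trans (cong (ℤ._+ total a s) o≡) (ℤ.+-identityˡ _))) 0≤z)
         ∷ All.++⁺ (All.map⁺ (All.map (λ {c} c≤ → ℕ.≤-trans c≤ (ℕ.m≤n⇒m≤1+n (ℕ.m≤n+m _ (skeletonBound n))) , ℤ.≤-reflexive (sym (cycle-total c))) cs≤))
                   (All.map⁺ (All.map (λ 0≤i → s≤s z≤n , subst (0ℤ ℤ.≤_) (sym (ℤ.+-identityʳ _)) 0≤i) R))
      where
      cycle-total : ∀ c → total a (word c) ≡ 0ℤ
      cycle-total c = trans (difference (sumAt (base c)) (total a (word c)))
        (trans (cong (ℤ._- sumAt (base c)) (sym (path-total (loop c)))) (ℤ.+-inverseʳ (sumAt (base c))))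
        where
        difference : ∀ x y → y ≡ x ℤ.+ y ℤ.- x
        difference = solve-∀

-- The length of the parts for d coordinates.
groupBound : (B d : ℕ) → ℕ
groupBound B zero    = 1
groupBound B (suc d) = groupBound₁ (groupBound B d ℕ.* B) ℕ.* groupBound B d

length-concat≤ : ∀ {A : Set} {L : ℕ} {xss : List (List A)} → All (λ xs → length xs ℕ.≤ L) xss →
                 length (concat xss) ℕ.≤ length xss ℕ.* L
length-concat≤ []                        = z≤n
length-concat≤ {xss = xs ∷ xss} (p ∷ ps) =
  subst (ℕ._≤ _) (sym (List.length-++ xs)) (ℕ.+-mono-≤ p (length-concat≤ ps))

abstract
  -- One coordinate after the other: the parts for the earlier coordinates are the items to be
  -- grouped for the next one.
  group : ∀ {A X : Set} (a : X → A → ℤ) (B : ℕ) (coords : List X) xs →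
    All (λ i → ∀ x → ℤ.∣ a x i ∣ ℕ.≤ B) xs → (∀ x → 0ℤ ℤ.≤ total (a x) xs) →
    ∃[ gs ] concat gs ↭ xs ×
    All (λ g → length g ℕ.≤ groupBound B (length coords) × All (λ x → 0ℤ ℤ.≤ total (a x) g) coords) gs
  group a B []       xs xs≤ 0≤ = map [_] xs , ↭-reflexive (List.concat-map-[_] xs) , All.map⁺ (All.universal (λ _ → s≤s z≤n , []) xs)
  group a B (x ∷ coords) xs xs≤ 0≤ =
    let (gs , gs↭ , G) = group a B coords xs xs≤ 0≤
        L = groupBound B (length coords)
        small : All (λ g → All (λ i → ℤ.∣ a x i ∣ ℕ.≤ B) g) gs
        small = All.concat⁻ (All-resp-↭ (↭-sym gs↭) (All.map (λ h → h x) xs≤))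
        sums : All (λ g → ℤ.∣ total (a x) g ∣ ℕ.≤ L ℕ.* B) gs
        sums = All.zipWith (λ { ((g≤ , _) , sm) → ℕ.≤-trans (∣total∣≤ sm) (ℕ.*-monoˡ-≤ B g≤) }) (G , small)
        (hs , hs↭ , H) = group₁ (total (a x)) (L ℕ.* B) gs sums
          (subst (0ℤ ℤ.≤_) (trans (total-↭ (a x) (↭-sym gs↭)) (total-concat (a x) gs)) (0≤ x))
        inner = All.concat⁻ (All-resp-↭ (↭-sym hs↭) G)
    in map concat hs
     , ↭-trans (↭-reflexive (List.concat-concat hs)) (↭-trans (concat-↭ hs↭) gs↭)
     , All.map⁺ (All.zipWith (λ { {h} ((h≤ , 0≤h) , inn) →
           ℕ.≤-trans (length-concat≤ (All.map proj₁ inn)) (ℕ.*-monoˡ-≤ L h≤)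
         , subst (0ℤ ℤ.≤_) (sym (total-concat (a x) h)) 0≤h
           ∷ All.tabulate (λ {y} y∈ → subst (0ℤ ℤ.≤_) (sym (total-concat (a y) h))
               (total-nonneg (All.map (λ r → All.lookup (proj₂ r) y∈) inn))) }) (H , inner))

  -- The part that contains a distinguished item of weight b.
  groupWith : ∀ {A X : Set} (a : X → A → ℤ) (b : X → ℤ) (B : ℕ) (coords : List X) (xs : List A) →
    (∀ x → ℤ.∣ b x ∣ ℕ.≤ B) → All (λ i → ∀ x → ℤ.∣ a x i ∣ ℕ.≤ B) xs →
    (∀ x → 0ℤ ℤ.≤ b x ℤ.+ total (a x) xs) →
    ∃[ ys ] ∃[ zs ] xs ↭ ys ++ zs × length ys ℕ.≤ groupBound B (length coords) ×
    All (λ x → 0ℤ ℤ.≤ b x ℤ.+ total (a x) ys) coords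
  groupWith {A} {X} a b B coords xs b≤ xs≤ 0≤ = fromGroups
    (group a′ B coords (nothing ∷ map just xs) (b≤ ∷ All.map⁺ xs≤)
      (λ x → subst (λ z → 0ℤ ℤ.≤ b x ℤ.+ z) (sym (total-map (a′ x) just xs)) (0≤ x)))
    where
    -- The distinguished item is nothing; the others are just.
    a′ : X → Maybe A → ℤ
    a′ x (just i) = a x i
    a′ x nothing  = b x
    Result : Set
    Result = ∃[ ys ] ∃[ zs ] xs ↭ ys ++ zs × length ys ℕ.≤ groupBound B (length coords) ×
      All (λ x → 0ℤ ℤ.≤ b x ℤ.+ total (a x) ys) coords
    Small : List (Maybe A) → Set
    Small g = length g ℕ.≤ groupBound B (length coords) × All (λ x → 0ℤ ℤ.≤ total (a′ x) g) coords
    catMaybes-map-just : ∀ (ys : List A) → catMaybes (map just ys) ≡ ys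
    catMaybes-map-just []       = refl
    catMaybes-map-just (y ∷ ys) = cong (y ∷_) (catMaybes-map-just ys)
    fromJusts : ∀ {ms : List (Maybe A)} → All (λ m → ∃[ i ] m ≡ just i) ms → ∃[ ys ] ms ≡ map just ys
    fromJusts []                = [] , refl
    fromJusts ((i , refl) ∷ js) = let (ys , eq) = fromJusts js in i ∷ ys , cong (just i ∷_) eq

    fromPart : ∀ {g ys others} → Small g → g ↭ nothing ∷ map just ys → map just ys ++ others ↭ map just xs → Result
    fromPart {g} {ys} {others} (g≤ , g0) g↭ perm = ys , catMaybes others
      , ↭-trans (↭-reflexive (sym (catMaybes-map-just xs)))
          (↭-trans (catMaybes-↭ (↭-sym perm))
            (↭-reflexive (trans (List.catMaybes-++ (map just ys) others) (cong (_++ catMaybes others) (catMaybes-map-just ys)))))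
      , ℕ.≤-trans (subst (ℕ._≤ length g) (List.length-map just ys)
          (ℕ.≤-trans (ℕ.n≤1+n _) (ℕ.≤-reflexive (sym (↭-length g↭))))) g≤
      , All.map (λ {x} → subst (0ℤ ℤ.≤_) (trans (total-↭ (a′ x) g↭) (cong (λ z → b x ℤ.+ z) (total-map (a′ x) just ys)))) g0

    fromJustPart : ∀ {g ms others} → Small g → g ↭ nothing ∷ ms → ms ++ others ↭ map just xs →
      ∃[ ys ] ms ≡ map just ys → Result
    fromJustPart small g↭ perm (ys , refl) = fromPart small g↭ perm

    fromSplit : ∀ {g ms others} → Small g → g ↭ nothing ∷ ms → nothing ∷ (ms ++ others) ↭ nothing ∷ map just xs → Result
    fromSplit {ms = ms} small g↭ whole = fromJustPart small g↭ (drop-∷ whole)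
      (fromJusts (All.++⁻ˡ ms (All-resp-↭ (↭-sym (drop-∷ whole)) (All.map⁺ (All.universal (λ i → i , refl) xs)))))

    -- The part g contains the distinguished item, hence no other item of g is distinguished.
    fromMember : ∀ {gs g} → concat gs ↭ nothing ∷ map just xs → All Small gs → g ∈ gs → nothing ∈ g → Result
    fromMember {g = g} gs↭ G g∈ nothing∈ with ∈-∃++ g∈ | ∈-∃++ nothing∈
    ... | us , vs , refl | ls , rs , refl = fromSplit (All.lookup G g∈) (shift nothing ls rs)
      (↭-trans (↭-sym (↭-trans (concat-↭ (shift g us vs)) (++⁺ʳ (concat (us ++ vs)) (shift nothing ls rs)))) gs↭)

    fromGroups : ∃[ gs ] concat gs ↭ nothing ∷ map just xs × All Small gs → Result
    fromGroups (gs , gs↭ , G) =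
      let (g , nothing∈g , g∈gs) = ∈-concat⁻′ gs (∈-resp-↭ (↭-sym gs↭) (here refl))
      in fromMember gs↭ G g∈gs nothing∈g

-- Petri nets and bounds on self-covering pairs

-- The n-fold repetition of v.
repeat : ∀ {A : Set} → ℕ → List A → List A
repeat zero    v = []
repeat (suc n) v = v ++ repeat n v

abstract
  -- In a graph with n vertices, a bound for a closed walk of nonnegative effect on d
  -- coordinates.
  loopBound : (d n : ℕ) → ℕ
  loopBound d n = suc (skeletonBound n ℕ.+ groupBound (suc (skeletonBound n) ℕ.+ suc n) d ℕ.* suc n)

  loopBound-sufficient : ∀ d n {a b} → a ℕ.≤ skeletonBound n →
    b ℕ.≤ groupBound (suc (skeletonBound n) ℕ.+ suc n) d ℕ.* suc n → suc (a ℕ.+ b) ℕ.≤ loopBound d n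
  loopBound-sufficient d n a≤ b≤ = s≤s (ℕ.+-mono-≤ a≤ b≤)

-- In such a graph, a bound for a self-covering pair.
cycleBound : (d n : ℕ) → ℕ
cycleBound d n = skeletonBound n ℕ.+ loopBound d n

-- A bound for a walk that may leave such a graph with its last step.
exceedBound : ℕ → ℕ
exceedBound n = suc (skeletonBound n)

-- The length bound for k constrained coordinates, and the value above which one of
-- them no longer needs to be constrained.
mutual
  coverBound : (d k : ℕ) → ℕ
  coverBound d k = cycleBound d n ℕ.+ (exceedBound n ℕ.+ threshold d k)
    where n = threshold d k ℕ.^ k

  threshold : (d k : ℕ) → ℕ
  threshold d zero    = 1
  threshold d (suc k) = suc (coverBound d k)

-- A Petri net with transitions T and places X, all of whose arcs have weight at most 1.
-- Markings take integer values, since some places may be exempted from being nonnegative.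
module Nets {T X : Set} (pre post : T → X → ℕ)
  (pre≤1 : ∀ t x → pre t x ℕ.≤ 1) (post≤1 : ∀ t x → post t x ℕ.≤ 1) where

  -- The change of the number of tokens.
  Δ : X → T → ℤ
  Δ x t = + post t x ℤ.- + pre t x

  effect : X → List T → ℤ
  effect x = total (Δ x)

  fire : (X → ℤ) → T → X → ℤ
  fire m t x = m x ℤ.+ Δ x t

  after : (X → ℤ) → List T → X → ℤ
  after m []      = m
  after m (t ∷ σ) = after (fire m t) σ

  after≡ : ∀ m σ x → after m σ x ≡ m x ℤ.+ effect x σ
  after≡ m []      x = sym (ℤ.+-identityʳ _)
  after≡ m (t ∷ σ) x = trans (after≡ (fire m t) σ x) (ℤ.+-assoc (m x) (Δ x t) (effect x σ))

  after-grows : ∀ m σ x → 0ℤ ℤ.≤ effect x σ → m x ℤ.≤ after m σ x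
  after-grows m σ x g = subst₂ ℤ._≤_ (ℤ.+-identityʳ _) (sym (after≡ m σ x)) (ℤ.+-monoʳ-≤ (m x) g)

  ∣Δ∣≤1 : ∀ x t → ℤ.∣ Δ x t ∣ ℕ.≤ 1
  ∣Δ∣≤1 x t with post t x | pre t x | post≤1 t x | pre≤1 t x
  ... | 0 | 0 | _ | _ = z≤n
  ... | 0 | 1 | _ | _ = s≤s z≤n
  ... | 1 | 0 | _ | _ = s≤s z≤n
  ... | 1 | 1 | _ | _ = z≤n
  ... | suc (suc _) | _ | s≤s () | _
  ... | _ | suc (suc _) | _ | s≤s ()

  ∣effect∣≤ : ∀ x σ → ℤ.∣ effect x σ ∣ ℕ.≤ length σ
  ∣effect∣≤ x σ = subst (ℤ.∣ effect x σ ∣ ℕ.≤_) (ℕ.*-identityʳ _) (∣total∣≤ (All.universal (∣Δ∣≤1 x) σ))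

  -- Only the k places in the image of sel are constrained.
  module _ {k : ℕ} (sel : Fin k → X) where

    Enabled : (X → ℤ) → T → Set
    Enabled m t = ∀ i → + pre t (sel i) ℤ.≤ m (sel i)

    -- The word can be fired, as far as the constrained places are concerned.
    data Run : (X → ℤ) → List T → Set where
      []  : ∀ {m} → Run m []
      _∷_ : ∀ {m t σ} → Enabled m t → Run (fire m t) σ → Run m (t ∷ σ)

    run-mono : ∀ {m m′ σ} → (∀ i → m (sel i) ℤ.≤ m′ (sel i)) → Run m σ → Run m′ σ
    run-mono ≤′ []      = []
    run-mono ≤′ (e ∷ r) = (λ i → ℤ.≤-trans (e i) (≤′ i)) ∷ run-mono (λ i → ℤ.+-monoˡ-≤ _ (≤′ i)) r

    run-++ : ∀ {m} σ {τ} → Run m σ → Run (after m σ) τ → Run m (σ ++ τ)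
    run-++ []      []      q = q
    run-++ (t ∷ σ) (e ∷ r) q = e ∷ run-++ σ r q

    run-split : ∀ {m} σ {τ} → Run m (σ ++ τ) → Run m σ × Run (after m σ) τ
    run-split []      r       = [] , r
    run-split (t ∷ σ) (e ∷ r) = let (p , q) = run-split σ r in e ∷ p , q

    -- A nonnegative coordinate stays nonnegative.
    fire-nonneg : ∀ {m t} → Enabled m t → ∀ i → 0ℤ ℤ.≤ fire m t (sel i)
    fire-nonneg {m} {t} e i = subst (0ℤ ℤ.≤_) (rearrange (m (sel i)) (+ pre t (sel i)) (+ post t (sel i)))
      (ℤ.+-mono-≤ (ℤ.i≤j⇒0≤j-i (e i)) (ℤ.+≤+ z≤n))
      where
      rearrange : ∀ x y z → x ℤ.- y ℤ.+ z ≡ x ℤ.+ (z ℤ.- y)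
      rearrange = solve-∀

    after-nonneg : ∀ {m σ} → Run m σ → (∀ i → 0ℤ ℤ.≤ m (sel i)) → ∀ i → 0ℤ ℤ.≤ after m σ (sel i)
    after-nonneg []                0≤ = 0≤
    after-nonneg (_∷_ {m} {t} e r) 0≤ = after-nonneg r (fire-nonneg {m} {t} e)

  -- After u the word v can be repeated forever, as far as the constrained places are
  -- concerned, and its effect is nonnegative on all places.
  record SelfCovering {k} (sel : Fin k → X) (m : X → ℤ) (u v : List T) : Set where
    constructor covering
    field
      nonempty : v ≢ []
      run      : Run sel m (u ++ v)
      gain     : ∀ x → 0ℤ ℤ.≤ effect x v

  repeat-run : ∀ {k} (sel : Fin k → X) {m} v n → Run sel m v → (∀ x → 0ℤ ℤ.≤ effect x v) → Run sel m (repeat n v)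
  repeat-run sel v zero r g = []
  repeat-run sel {m} v (suc n) r g = run-++ sel v r
    (repeat-run sel v n (run-mono sel (λ i → after-grows m v (sel i) (g (sel i))) r) g)

  -- Dropping the constraint on a coordinate that is at least the length of the run is harmless.
  run-add : ∀ {k} (sel : Fin (suc k) → X) j {m σ} → + length σ ℤ.≤ m (sel j) → Run (sel ∘ punchIn j) m σ → Run sel m σ
  run-add sel j         len []      = []
  run-add sel j {m} {t ∷ σ} len (e ∷ r) = enabled ∷ run-add sel j len′ r
    where
    enabled : Enabled sel m t
    enabled i with j Fin.≟ i
    ... | yes refl = ℤ.≤-trans (ℤ.+≤+ (ℕ.≤-trans (pre≤1 t (sel j)) (s≤s z≤n))) len
    ... | no j≢i   = subst (λ i → + pre t (sel i) ℤ.≤ m (sel i)) (Fin.punchIn-punchOut j≢i) (e (punchOut j≢i))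
    len′ : + length σ ℤ.≤ fire m t (sel j)
    len′ = subst (+ length σ ℤ.≤_) (rearrange (m (sel j)) (+ pre t (sel j)) (+ post t (sel j)))
      (ℤ.≤-trans (ℤ.≤-trans (ℤ.≤-reflexive (sym (cancel (+ length σ))))
        (ℤ.+-mono-≤ len (ℤ.neg-mono-≤ (ℤ.+≤+ (pre≤1 t (sel j)))))) (ℤ.i≤i+j _ (+ post t (sel j))))
      where
      rearrange : ∀ x y z → x ℤ.- y ℤ.+ z ≡ x ℤ.+ (z ℤ.- y)
      rearrange = solve-∀
      cancel : ∀ x → (+ 1 ℤ.+ x) ℤ.- + 1 ≡ x
      cancel = solve-∀

  effect-repeat : ∀ x n v → effect x (repeat n v) ≡ + n ℤ.* effect x v
  effect-repeat x zero    v = sym (ℤ.*-zeroˡ (effect x v))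
  effect-repeat x (suc n) v = trans (total-++ (Δ x) v (repeat n v))
    (trans (cong (λ z → effect x v ℤ.+ z) (effect-repeat x n v)) (sym (ℤ.suc-* (+ n) (effect x v))))

  after-++ : ∀ m σ τ → after m (σ ++ τ) ≡ after (after m σ) τ
  after-++ m []      τ = refl
  after-++ m (t ∷ σ) τ = after-++ (fire m t) σ τ

  run-drop : ∀ {k} (sel : Fin (suc k) → X) j {m σ} → Run sel m σ → Run (sel ∘ punchIn j) m σ
  run-drop sel j []      = []
  run-drop sel j (e ∷ r) = (λ i → e (punchIn j i)) ∷ run-drop sel j r

  -- Markings whose constrained coordinates are all below K form a finite graph.
  module Bounded {k : ℕ} (sel : Fin k → X) (K : ℕ) where

    n : ℕ
    n = K ℕ.^ k

    -- The vertices encode the assignments of values below K to the constrained places.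
    value : Fin n → Fin k → ℕ
    value v i = toℕ (Fin.finToFun {K} {k} v i)

    Edge : Fin n → T → Fin n → Set
    Edge v t w = (∀ i → pre t (sel i) ℕ.≤ value v i) × (∀ i → + value w i ≡ + value v i ℤ.+ Δ (sel i) t)

    open Walks Edge public

    -- The vertex records the constrained places of the marking.
    Match : Fin n → (X → ℤ) → Set
    Match v m = ∀ i → + value v i ≡ m (sel i)

    value-injective : ∀ {v w} → (∀ i → value v i ≡ value w i) → v ≡ w
    value-injective {v} {w} h = trans (sym (Fin.funToFin-finToFin {k} {K} v))
      (trans (funToFin-cong k (λ i → Fin.toℕ-injective (h i))) (Fin.funToFin-finToFin {k} {K} w))
      where
      funToFin-cong : ∀ k {f g : Fin k → Fin K} → (∀ i → f i ≡ g i) → Fin.funToFin f ≡ Fin.funToFin g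
      funToFin-cong zero    h = refl
      funToFin-cong (suc k) h = cong₂ Fin.combine (h zero) (funToFin-cong k (h ∘ suc))

    encode : ∀ m → (∀ i → 0ℤ ℤ.≤ m (sel i)) → (∀ i → m (sel i) ℤ.< + K) → ∃[ v ] Match v m
    encode m 0≤ <K = Fin.funToFin digit , λ i → trans
        (cong (λ d → + toℕ d) (Fin.finToFun-funToFin digit i))
        (trans (cong +_ (Fin.toℕ-fromℕ< (bound i))) (ℤ.0≤i⇒+∣i∣≡i (0≤ i)))
      where
      bound : ∀ i → ℤ.∣ m (sel i) ∣ ℕ.< K
      bound i = ℤ.drop‿+<+ (subst (ℤ._< + K) (sym (ℤ.0≤i⇒+∣i∣≡i (0≤ i))) (<K i))
      digit : Fin k → Fin K
      digit i = Fin.fromℕ< (bound i)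

    path-run : ∀ {v σ w m} → Path v σ w → Match v m → Run sel m σ × Match w (after m σ)
    path-run []                            M = [] , M
    path-run {m = m} (_∷_ {t = t} (en , step) p) M =
      let (r , M′) = path-run p (λ i → trans (step i) (cong (ℤ._+ Δ (sel i) t) (M i)))
      in (λ i → subst (+ pre t (sel i) ℤ.≤_) (M i) (ℤ.+≤+ (en i))) ∷ r , M′

    path-effect : ∀ {v σ w} → Path v σ w → ∀ i → + value w i ≡ + value v i ℤ.+ effect (sel i) σ
    path-effect []                                      i = sym (ℤ.+-identityʳ _)
    path-effect {v} (_∷_ {t = t} {σ = σ} (_ , step) p) i =
      trans (path-effect p i) (trans (cong (ℤ._+ effect (sel i) σ) (step i)) (ℤ.+-assoc (+ value v i) (Δ (sel i) t) (effect (sel i) σ)))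

    edge : ∀ {v w m t} → Match v m → Match w (fire m t) → Enabled sel m t → Edge v t w
    edge {t = t} Mv Mw en = (λ i → ℤ.drop‿+≤+ (subst (+ pre t (sel i) ℤ.≤_) (sym (Mv i)) (en i)))
                          , λ i → trans (Mw i) (cong (ℤ._+ Δ (sel i) t) (sym (Mv i)))

    -- p stays in the graph, except possibly for its last step.
    Prefix : (X → ℤ) → List T → Set
    Prefix m p = p ≡ [] ⊎ (∃[ v ] ∃[ w ] ∃[ σ ] ∃[ t ] p ≡ σ ++ [ t ] × Match v m × Path v σ w)

    -- A constrained place has at least K tokens after some prefix p, which leaves the graph at
    -- most with its last step.
    Exceeds : (X → ℤ) → List T → Set
    Exceeds m σ = ∃[ p ] ∃[ r ] σ ≡ p ++ r × (∃[ j ] + K ℤ.≤ after m p (sel j)) × Prefix m p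

    -- A run either stays inside the graph or leaves it for a first time.
    explore : ∀ {m σ} → (∀ i → 0ℤ ℤ.≤ m (sel i)) → Run sel m σ →
              (∃[ v ] ∃[ w ] Match v m × Path v σ w) ⊎ Exceeds m σ
    explore {m} {σ} 0≤ r with Fin.any? (λ j → + K ℤ.≤? m (sel j))
    ... | yes (j , K≤) = inj₂ ([] , σ , refl , (j , K≤) , inj₁ refl)
    ... | no ≰ with encode m 0≤ (λ i → ℤ.≰⇒> (λ K≤ → ≰ (i , K≤)))
    explore {m} 0≤ []      | no ≰ | v , M = inj₁ (v , v , M , [])
    explore {m} 0≤ (_∷_ {t = t} e r) | no ≰ | v , M with explore (fire-nonneg sel {m} {t} e) r
    ... | inj₁ (v′ , w , M′ , p) = inj₁ (v , w , M , edge {m = m} M M′ e ∷ p)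
    ... | inj₂ (p , r′ , refl , big , inj₁ refl) =
          inj₂ (t ∷ p , r′ , refl , big , inj₂ (v , v , [] , t , refl , M , []))
    ... | inj₂ (p , r′ , refl , big , inj₂ (v′ , w , σ , t′ , refl , M′ , q)) =
          inj₂ (t ∷ p , r′ , refl , big , inj₂ (v , w , t ∷ σ , t′ , refl , M , edge {m = m} M M′ e ∷ q))

    shortenPrefix : ∀ {m p} → Prefix m p → Run sel m p →
      ∃[ p′ ] length p′ ℕ.≤ exceedBound n × Run sel m p′ × (∀ i → after m p′ (sel i) ≡ after m p (sel i))
    shortenPrefix (inj₁ refl) r = [] , z≤n , [] , λ i → refl
    shortenPrefix {m} (inj₂ (v , w , σ , t , refl , M , q)) r =
      let (s , q′ , s≤ , _) = decompose q
          (r₁ , M₁)  = path-run q′ M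
          (_ , M₂)   = path-run q M
          (_ , last) = run-split sel σ r
          same : ∀ i → after m s (sel i) ≡ after m σ (sel i)
          same i = trans (sym (M₁ i)) (M₂ i)
      in s ++ [ t ]
       , subst (ℕ._≤ exceedBound n) (trans (ℕ.+-comm 1 (length s)) (sym (List.length-++ s))) (s≤s s≤)
       , run-++ sel s r₁ (run-mono sel (λ i → ℤ.≤-reflexive (sym (same i))) last)
       , λ i → trans (cong (λ f → f (sel i)) (after-++ m s [ t ]))
               (trans (cong (ℤ._+ Δ (sel i) t) (same i)) (sym (cong (λ f → f (sel i)) (after-++ m σ [ t ]))))

    module _ (coords : List X) (complete : ∀ x → x ∈ coords) where

      private
        d : ℕ
        d = length coords

        words-effect : ∀ x s zs → effect x (s ++ words zs) ≡ effect x s ℤ.+ total (λ c → effect x (word c)) zs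
        words-effect x s zs = trans (total-++ (Δ x) s (words zs)) (cong (λ z → effect x s ℤ.+ z)
          (trans (total-concat (Δ x) (map word zs)) (total-map (effect x) word zs)))

      -- The first edge is kept apart from the decomposition, so that the new closed walk is
      -- nonempty.
      shortLoop : ∀ {q t y σ} → Edge q t y → Path y σ q → (∀ x → 0ℤ ℤ.≤ effect x (t ∷ σ)) →
        ∃[ σ′ ] Path y σ′ q × (∀ x → 0ℤ ℤ.≤ effect x (t ∷ σ′)) × length (t ∷ σ′) ℕ.≤ loopBound d n
      shortLoop {t = t} e p gain with decompose p
      ... | s , ps , s≤ , cs , att , cs≤ , perm =
        let (ys , zs , cs↭ , ys≤ , G) = parts
            (s′ , ps′ , s′↭)          = insertCycles ps ys (All.++⁻ˡ ys (All-resp-↭ cs↭ att))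
        in s′ , ps′
        , (λ x → subst (0ℤ ℤ.≤_)
             (trans (ℤ.+-assoc (Δ x t) (effect x s) (total (λ c → effect x (word c)) ys))
               (cong (λ z → Δ x t ℤ.+ z) (sym (trans (total-↭ (Δ x) s′↭) (words-effect x s ys)))))
             (All.lookup G (complete x)))
        , subst (λ l → suc l ℕ.≤ loopBound d n) (sym (trans (↭-length s′↭) (List.length-++ s)))
            (loopBound-sufficient d n s≤ (ℕ.≤-trans (length-concat≤ (All.map⁺ (All.++⁻ˡ ys (All-resp-↭ cs↭ cs≤))))
              (ℕ.*-monoˡ-≤ (suc n) (subst (ℕ._≤ groupBound B d) (sym (List.length-map word ys)) ys≤))))
        where
        B : ℕ
        B = suc (skeletonBound n) ℕ.+ suc n
        parts : ∃[ ys ] ∃[ zs ] cs ↭ ys ++ zs × length ys ℕ.≤ groupBound B d ×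
                All (λ x → 0ℤ ℤ.≤ effect x (t ∷ s) ℤ.+ total (λ c → effect x (word c)) ys) coords
        parts = groupWith (λ x c → effect x (word c)) (λ x → effect x (t ∷ s)) B coords cs
          (λ x → ℕ.≤-trans (∣effect∣≤ x (t ∷ s)) (ℕ.≤-trans (s≤s s≤) (ℕ.m≤m+n (suc (skeletonBound n)) (suc n))))
          (All.map (λ {c} c≤ x → ℕ.≤-trans (∣effect∣≤ x (word c)) (ℕ.≤-trans c≤ (ℕ.m≤n+m (suc n) (suc (skeletonBound n))))) cs≤)
          (λ x → subst (0ℤ ℤ.≤_) (trans (cong (λ z → Δ x t ℤ.+ z) (trans (total-↭ (Δ x) perm) (words-effect x s cs)))
                    (sym (ℤ.+-assoc (Δ x t) (effect x s) _))) (gain x))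

      -- If v has no effect on the constrained places, it is a closed walk.
      shortCycle : ∀ {m a q r u v} → Match a m → Path a u q → Path q v r → (∀ i → effect (sel i) v ≡ 0ℤ) →
        v ≢ [] → (∀ x → 0ℤ ℤ.≤ effect x v) →
        ∃[ u′ ] ∃[ v′ ] SelfCovering sel m u′ v′ × length (u′ ++ v′) ℕ.≤ cycleBound d n
      shortCycle M pᵤ [] e≡0 v≢[] gain = ⊥-elim (v≢[] refl)
      shortCycle {m} {q = q} {r} M pᵤ (_∷_ {t = t} {y = y} {σ = σ} e p) e≡0 v≢[] gain =
        same (value-injective (λ i → ℤ.+-injective (trans (path-effect (_∷_ {x = q} e p) i)
                  (trans (cong (λ z → + value q i ℤ.+ z) (e≡0 i)) (ℤ.+-identityʳ (+ value q i))))))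
        where
        same : r ≡ q → ∃[ u′ ] ∃[ v′ ] SelfCovering sel m u′ v′ × length (u′ ++ v′) ℕ.≤ cycleBound d n
        same refl with shortLoop e p gain | decompose pᵤ
        ... | σ′ , p′ , gain′ , short | su , pu , su≤ , _ = su , t ∷ σ′
          , covering (λ ()) (proj₁ (path-run (pu ++ᴾ e ∷ p′) M)) gain′
          , subst (ℕ._≤ cycleBound d n) (sym (List.length-++ su)) (ℕ.+-mono-≤ su≤ short)

  effect-repeat-nonneg : ∀ x n v → 0ℤ ℤ.≤ effect x v → 0ℤ ℤ.≤ effect x (repeat n v)
  effect-repeat-nonneg x zero    v g = ℤ.≤-refl
  effect-repeat-nonneg x (suc n) v g = subst (0ℤ ℤ.≤_) (sym (total-++ (Δ x) v (repeat n v)))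
    (ℤ.+-mono-≤ g (effect-repeat-nonneg x n v g))

  module _ (coords : List X) (complete : ∀ x → x ∈ coords) where

    private
      d : ℕ
      d = length coords

      -- K repetitions that keep a value below K have effect 0.
      no-gain : ∀ K {e a b} → 0ℤ ℤ.≤ e → 0ℤ ℤ.≤ a → b ℤ.< + K → b ≡ a ℤ.+ + K ℤ.* e → e ≡ 0ℤ
      no-gain K {+ zero}  0≤e 0≤a b<K eq = refl
      no-gain K {+ suc e} {a} {b} 0≤e 0≤a b<K eq = ⊥-elim (ℤ.<⇒≱ b<K (begin
        + K                        ≤⟨ ℤ.+≤+ (ℕ.m≤m*n K (suc e)) ⟩
        + (K ℕ.* suc e)            ≡⟨ ℤ.pos-* K (suc e) ⟩
        + K ℤ.* + suc e            ≡⟨ sym (ℤ.+-identityˡ _) ⟩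
        0ℤ ℤ.+ + K ℤ.* + suc e     ≤⟨ ℤ.+-monoˡ-≤ (+ K ℤ.* + suc e) 0≤a ⟩
        a ℤ.+ + K ℤ.* + suc e      ≡⟨ sym eq ⟩
        b                          ∎))
        where open ℤ.≤-Reasoning

      -- The case in which the run stays below the threshold.
      coverBounded : ∀ {k} (sel : Fin k → X) K {m u v} → let open Bounded sel (suc K) in
        (∀ i → 0ℤ ℤ.≤ m (sel i)) → SelfCovering sel m u v →
        (∃[ a ] ∃[ w ] Match a m × Path a (u ++ repeat (suc K) v) w) →
        ∃[ u′ ] ∃[ v′ ] SelfCovering sel m u′ v′ × length (u′ ++ v′) ℕ.≤ cycleBound d n
      coverBounded sel K {m} {u} {v} 0≤ (covering v≢[] _ gain) (a , w , M , p) with Bounded.splitᴾ sel (suc K) u p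
      ... | q , pᵤ , p′ with Bounded.splitᴾ sel (suc K) v p′
      ... | q′ , pᵥ , _ = shortCycle coords complete M pᵤ pᵥ
          (λ i → no-gain (suc K) (gain (sel i)) (ℤ.+≤+ z≤n) (ℤ.+<+ (Fin.toℕ<n (Fin.finToFun {suc K} w i)))
            (trans (path-effect p′ i) (cong (λ z → + value q i ℤ.+ z) (effect-repeat (sel i) (suc K) v))))
          v≢[] gain
        where open Bounded sel (suc K)

      -- The whole word can be shortened, given how to do so where some coordinate exceeds K.
      coverFrom : ∀ {k} (sel : Fin k → X) K →
        (∀ j {m u v} → (∀ i → 0ℤ ℤ.≤ m (sel i)) → + suc K ℤ.≤ m (sel j) → SelfCovering sel m u v →
          ∃[ u′ ] ∃[ v′ ] SelfCovering sel m u′ v′ × length (u′ ++ v′) ℕ.≤ suc K) →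
        ∀ {m u v} → (∀ i → 0ℤ ℤ.≤ m (sel i)) → SelfCovering sel m u v →
        ∃[ u′ ] ∃[ v′ ] SelfCovering sel m u′ v′ ×
          length (u′ ++ v′) ℕ.≤ cycleBound d (suc K ℕ.^ k) ℕ.+ (exceedBound (suc K ℕ.^ k) ℕ.+ suc K)
      coverFrom {k} sel K large {m} {u} {v} 0≤ C@(covering v≢[] run gain) =
        cases (explore 0≤ (run-++ sel u runᵤ (repeat-run sel v (suc K) runᵥ gain)))
        where
        open Bounded sel (suc K)
        runᵤ : Run sel m u
        runᵤ = proj₁ (run-split sel u run)
        runᵥ : Run sel (after m u) v
        runᵥ = proj₂ (run-split sel u run)
        -- The repetitions of v exceed the threshold if v increases some constrained place.
        x : List T
        x = u ++ repeat (suc K) v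
        run-x : Run sel m (x ++ v)
        run-x = run-++ sel x (run-++ sel u runᵤ (repeat-run sel v (suc K) runᵥ gain))
          (run-mono sel (λ i → subst (λ f → after m u (sel i) ℤ.≤ f (sel i)) (sym (after-++ m u (repeat (suc K) v)))
              (after-grows (after m u) (repeat (suc K) v) (sel i) (effect-repeat-nonneg (sel i) (suc K) v (gain (sel i)))))
            runᵥ)
        cases : (∃[ a ] ∃[ w ] Match a m × Path a x w) ⊎ Exceeds m x →
          ∃[ u′ ] ∃[ v′ ] SelfCovering sel m u′ v′ × length (u′ ++ v′) ℕ.≤ cycleBound d n ℕ.+ (exceedBound n ℕ.+ suc K)
        cases (inj₁ bounded) with coverBounded sel K 0≤ C bounded
        ... | u′ , v′ , C′ , len = u′ , v′ , C′ , ℕ.≤-trans len (ℕ.m≤m+n _ _)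
        cases (inj₂ (p , r , x≡ , (j , K≤) , prefix))
          with run-split sel p (subst (Run sel m) (trans (cong (_++ v) x≡) (List.++-assoc p r v)) run-x)
        ... | run-p , run-rv with shortenPrefix prefix run-p
                            | large j (after-nonneg sel run-p 0≤) K≤ (covering {u = r} {v} v≢[] run-rv gain)
        ... | p′ , p′≤ , run-p′ , same | u₂ , v₂ , covering v₂≢[] run₂ gain₂ , len =
              p′ ++ u₂ , v₂
            , covering v₂≢[]
                (subst (Run sel m) (sym (List.++-assoc p′ u₂ v₂))
                  (run-++ sel p′ run-p′ (run-mono sel (λ i → ℤ.≤-reflexive (sym (same i))) run₂)))
                gain₂
            , ℕ.≤-trans (subst (ℕ._≤ exceedBound n ℕ.+ suc K)
                  (trans (sym (List.length-++ p′)) (cong length (sym (List.++-assoc p′ u₂ v₂))))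
                  (ℕ.+-mono-≤ p′≤ len))
                (ℕ.m≤n+m _ (cycleBound d n))

    -- Rackoff's argument, by induction on the number of constrained coordinates.
    shortCover : ∀ k (sel : Fin k → X) {m u v} →
      (∀ i → 0ℤ ℤ.≤ m (sel i)) → SelfCovering sel m u v →
      ∃[ u′ ] ∃[ v′ ] SelfCovering sel m u′ v′ × length (u′ ++ v′) ℕ.≤ coverBound d k
    shortCover zero    sel = coverFrom sel 0 (λ ())
    shortCover (suc k) sel = coverFrom sel (coverBound d k) large
      where
      -- Above the threshold the constraint on place j can be dropped, as the pair found without
      -- it is shorter than the number of tokens on j.
      large : ∀ j {m u v} → (∀ i → 0ℤ ℤ.≤ m (sel i)) → + suc (coverBound d k) ℤ.≤ m (sel j) → SelfCovering sel m u v →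
        ∃[ u′ ] ∃[ v′ ] SelfCovering sel m u′ v′ × length (u′ ++ v′) ℕ.≤ suc (coverBound d k)
      large j 0≤ K≤ (covering v≢[] run gain)
        with shortCover k (sel ∘ punchIn j) (0≤ ∘ punchIn j) (covering v≢[] (run-drop sel j run) gain)
      ... | u′ , v′ , covering v′≢[] run′ gain′ , len = u′ , v′
        , covering v′≢[] (run-add sel j (ℤ.≤-trans (ℤ.+≤+ (ℕ.m≤n⇒m≤1+n len)) K≤) run′) gain′
        , ℕ.m≤n⇒m≤1+n len

-- Lists of bounded length

-- All lists of length at most n with entries from xs.
listsUpTo : ∀ {A : Set} → ℕ → List A → List (List A)
listsUpTo zero    xs = [ [] ]
listsUpTo (suc n) xs = [] ∷ cartesianProductWith _∷_ xs (listsUpTo n xs)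

∈-listsUpTo : ∀ {A : Set} n {xs ys : List A} → All (_∈ xs) ys → length ys ℕ.≤ n → ys ∈ listsUpTo n xs
∈-listsUpTo zero    []       _       = here refl
∈-listsUpTo (suc n) []       _       = here refl
∈-listsUpTo (suc n) (y ∷ ys) (s≤s ≤) = there (∈-cartesianProductWith⁺ _∷_ y (∈-listsUpTo n ys ≤))

-- Dickson's lemma for sequences

module Dickson (em : ExcludedMiddle 0ℓ) where

  -- g is strictly increasing and s is nondecreasing along g.
  Increasing : (ℕ → ℕ) → Set
  Increasing g = ∀ i → g i ℕ.< g (suc i)

  Along : (ℕ → ℕ) → (ℕ → ℕ) → Set
  Along s g = ∀ i j → i ℕ.≤ j → s (g i) ℕ.≤ s (g j)

  steps⇒mono : ∀ (s : ℕ → ℕ) → (∀ i → s i ℕ.≤ s (suc i)) → ∀ {i j} → i ℕ.≤ j → s i ℕ.≤ s j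
  steps⇒mono s step = go ∘ ℕ.≤⇒≤′
    where
    go : ∀ {i j} → i ℕ.≤′ j → s i ℕ.≤ s j
    go (ℕ.≤′-reflexive refl) = ℕ.≤-refl
    go (ℕ.≤′-step p)         = ℕ.≤-trans (go p) (step _)

  -- The least value from position n on, found by classical descent.
  tail-minimum : ∀ (s : ℕ → ℕ) n → ∃[ k ] n ℕ.≤ k × (∀ l → n ℕ.≤ l → s k ℕ.≤ s l)
  tail-minimum s n = descend (s n) n ℕ.≤-refl ℕ.≤-refl
    where
    descend : ∀ b k → n ℕ.≤ k → s k ℕ.≤ b → ∃[ k ] n ℕ.≤ k × (∀ l → n ℕ.≤ l → s k ℕ.≤ s l)
    descend b k n≤k ≤b with em {∃[ l ] n ℕ.≤ l × s l ℕ.< s k}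
    ... | no none = k , n≤k , λ l n≤l → ℕ.≮⇒≥ (λ l< → none (l , n≤l , l<))
    descend zero    k n≤k ≤b | yes (l , n≤l , l<) = ⊥-elim (ℕ.n≮0 (ℕ.<-≤-trans l< ≤b))
    descend (suc b) k n≤k ≤b | yes (l , n≤l , l<) = descend b l n≤l (ℕ.≤-pred (ℕ.≤-trans l< ≤b))

  nondecreasing-subsequence : ∀ (s : ℕ → ℕ) → ∃[ g ] Increasing g × Along s g
  nondecreasing-subsequence s = g , increasing , (λ i j → steps⇒mono (s ∘ g) step)
    where
    next : ℕ → ℕ
    next n = proj₁ (tail-minimum s n)
    start : ℕ → ℕ
    start zero    = 0
    start (suc i) = suc (next (start i))
    g : ℕ → ℕ
    g i = next (start i)
    increasing : Increasing g
    increasing i = proj₁ (proj₂ (tail-minimum s (start (suc i))))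
    step : ∀ i → s (g i) ℕ.≤ s (g (suc i))
    step i = proj₂ (proj₂ (tail-minimum s (start i))) _
      (ℕ.≤-trans (proj₁ (proj₂ (tail-minimum s (start i)))) (ℕ.<⇒≤ (increasing i)))

  common-subsequence : ∀ {X : Set} (s : X → ℕ → ℕ) (xs : List X) →
    ∃[ g ] Increasing g × All (λ x → Along (s x) g) xs
  common-subsequence s []       = id , (λ i → ℕ.≤-refl) , []
  common-subsequence s (x ∷ xs) =
    let (g , g< , G) = common-subsequence s xs
        (h , h< , H) = nondecreasing-subsequence (s x ∘ g)
        g-mono : ∀ {i j} → i ℕ.< j → g i ℕ.< g j
        g-mono i<j = ℕ.≤-trans (g< _) (steps⇒mono g (ℕ.<⇒≤ ∘ g<) i<j)
    in g ∘ h , g-mono ∘ h< , H ∷ All.map (λ A i j i≤j → A (h i) (h j) (steps⇒mono h (ℕ.<⇒≤ ∘ h<) i≤j)) G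

  dickson : ∀ {X : Set} (s : X → ℕ → ℕ) (xs : List X) →
    ∃[ i ] ∃[ j ] i ℕ.< j × (∀ {x} → x ∈ xs → s x i ℕ.≤ s x j)
  dickson s xs = let (g , g< , G) = common-subsequence s xs
                 in g 0 , g 1 , g< 0 , λ x∈ → All.lookup G x∈ 0 1 z≤n

-- Deciding whether a marking of a finite net has a self-covering run

-- Nets with finitely many transitions and places, listed by ts and coords.
module FiniteNets {T X : Set} (pre post : T → X → ℕ)
  (pre≤1 : ∀ t x → pre t x ℕ.≤ 1) (post≤1 : ∀ t x → post t x ℕ.≤ 1)
  (ts : List T) (ts-complete : ∀ t → t ∈ ts)
  (coords : List X) (coords-complete : ∀ x → x ∈ coords) where

  open Nets pre post pre≤1 post≤1 public

  -- All coordinates are constrained.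
  everywhere : Fin (length coords) → X
  everywhere = lookup coords

  atEach : ∀ {P : X → Set} → (∀ i → P (everywhere i)) → ∀ x → P x
  atEach {P} h x = subst P (sym (lookup-index x∈)) (h (Any.index x∈))
    where
    x∈ : x ∈ coords
    x∈ = coords-complete x

  -- Self-covering pairs with all places constrained.
  Covering : (X → ℤ) → List T → List T → Set
  Covering = SelfCovering everywhere

  enabled? : ∀ m t → Dec (Enabled everywhere m t)
  enabled? m t = Fin.all? (λ i → + pre t (everywhere i) ℤ.≤? m (everywhere i))

  run? : ∀ m σ → Dec (Run everywhere m σ)
  run? m []      = yes []
  run? m (t ∷ σ) = map′ (λ (e , r) → e ∷ r) (λ { (e ∷ r) → e , r }) (enabled? m t ×-dec run? (fire m t) σ)

  covering? : ∀ m u v → Dec (Covering m u v)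
  covering? m u v = map′ (λ (n , r , g) → covering n r (atEach g)) (λ (covering n r g) → n , r , g ∘ everywhere)
    (nonempty? v ×-dec run? m (u ++ v) ×-dec Fin.all? (λ i → 0ℤ ℤ.≤? effect (everywhere i) v))
    where
    nonempty? : ∀ v → Dec (v ≢ [])
    nonempty? []      = no (λ ≢ → ≢ refl)
    nonempty? (_ ∷ _) = yes (λ ())

  bound : ℕ
  bound = coverBound (length coords) (length coords)

  candidates : List (List T × List T)
  candidates = cartesianProduct (listsUpTo bound ts) (listsUpTo bound ts)

  -- The decidable condition on a marking that characterises its having an infinite run,
  -- for markings without negative values.
  ShortlyCovering : (X → ℤ) → Set
  ShortlyCovering m = Any (λ (u , v) → Covering m u v × length (u ++ v) ℕ.≤ bound) candidates

  shortlyCovering? : ∀ m → Dec (ShortlyCovering m)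
  shortlyCovering? m = Any.any? (λ (u , v) → covering? m u v ×-dec (length (u ++ v) ℕ.≤? bound)) candidates

  covering⇒shortly : ∀ {m u v} → (∀ x → 0ℤ ℤ.≤ m x) → Covering m u v → ShortlyCovering m
  covering⇒shortly 0≤ C =
    let (u , v , C′ , len) = shortCover coords coords-complete (length coords) everywhere (0≤ ∘ everywhere) C
        word∈ : ∀ σ → length σ ℕ.≤ bound → σ ∈ listsUpTo bound ts
        word∈ σ ≤ = ∈-listsUpTo bound (All.universal ts-complete σ) ≤
        len′ = subst (ℕ._≤ bound) (List.length-++ u) len
    in lose (∈-cartesianProduct⁺ (word∈ u (ℕ.m+n≤o⇒m≤o (length u) len′)) (word∈ v (ℕ.m+n≤o⇒n≤o (length u) len′))) (C′ , len)

  covering-mono : ∀ {m m′ u v} → (∀ x → m x ℤ.≤ m′ x) → Covering m u v → Covering m′ u v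
  covering-mono ≤′ (covering n r g) = covering n (run-mono everywhere (≤′ ∘ everywhere) r) g

  shortlyCovering-mono : ∀ {m m′} → (∀ x → m x ℤ.≤ m′ x) → ShortlyCovering m → ShortlyCovering m′
  shortlyCovering-mono ≤′ = Any.map (λ (C , len) → covering-mono ≤′ C , len)

  -- The number of tokens on a place may be reduced as long as it stays at least N, since a run
  -- of length at most N consumes at most N tokens from it.
  run-cap : ∀ {m m′ σ} N → length σ ℕ.≤ N → (∀ i → m′ (everywhere i) ℤ.< m (everywhere i) → + N ℤ.≤ m′ (everywhere i)) →
    Run everywhere m σ → Run everywhere m′ σ
  run-cap N _ h [] = []
  run-cap {m} {m′} (suc N) (s≤s len) h (_∷_ {t = t} e r) = enabled ∷ run-cap N len h′ r
    where
    enabled : Enabled everywhere m′ t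
    enabled i with m (everywhere i) ℤ.≤? m′ (everywhere i)
    ... | yes ≤ = ℤ.≤-trans (e i) ≤
    ... | no ≰  = ℤ.≤-trans (ℤ.+≤+ (ℕ.≤-trans (pre≤1 t (everywhere i)) (s≤s z≤n))) (h i (ℤ.≰⇒> ≰))
    h′ : ∀ i → fire m′ t (everywhere i) ℤ.< fire m t (everywhere i) → + N ℤ.≤ fire m′ t (everywhere i)
    h′ i lt = ℤ.≤-trans (subst (ℤ._≤ m′ x ℤ.- + 1) (cancel (+ N))
        (ℤ.+-monoˡ-≤ (ℤ.- + 1) (h i (ℤ.≰⇒> (λ ≤ → ℤ.<⇒≱ lt (ℤ.+-monoˡ-≤ (Δ x t) ≤))))))
      (ℤ.+-monoʳ-≤ (m′ x) (ℤ.≤-trans (ℤ.neg-mono-≤ (ℤ.+≤+ (pre≤1 t x)))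
        (ℤ.i≤j+i (ℤ.- + pre t x) (+ post t x))))
      where
      x = everywhere i
      cancel : ∀ z → (+ 1 ℤ.+ z) ℤ.- + 1 ≡ z
      cancel = solve-∀

  -- An infinite run, given by its markings and its transitions.
  module _ (em : ExcludedMiddle 0ℓ) (μ : ℕ → X → ℕ) (τ : ℕ → T)
    (en : ∀ n x → pre (τ n) x ℕ.≤ μ n x)
    (step : ∀ n x → + μ (suc n) x ≡ + μ n x ℤ.+ Δ x (τ n)) where

    private
      segment : ℕ → ℕ → List T
      segment i zero    = []
      segment i (suc l) = τ i ∷ segment (suc i) l

      at : ℕ → X → ℤ
      at n x = + μ n x

      segment-run : ∀ i l {m} → (∀ x → m x ≡ at i x) →
        Run everywhere m (segment i l) × (∀ x → after m (segment i l) x ≡ at (i ℕ.+ l) x)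
      segment-run i zero    h = [] , λ x → trans (h x) (cong (λ n → at n x) (sym (ℕ.+-identityʳ i)))
      segment-run i (suc l) h =
        let (r , h′) = segment-run (suc i) l (λ x → trans (cong (ℤ._+ Δ x (τ i)) (h x)) (sym (step i x)))
        in (λ j → subst (+ pre (τ i) (everywhere j) ℤ.≤_) (sym (h (everywhere j))) (ℤ.+≤+ (en i (everywhere j)))) ∷ r
         , λ x → trans (h′ x) (cong (λ n → at n x) (sym (ℕ.+-suc i l)))

    -- Dickson's lemma yields positions i < j with growing markings; u leads to position i, and
    -- v from there to position j.
    infinite⇒covering : ∃[ u ] ∃[ v ] Covering (at 0) u v
    infinite⇒covering with Dickson.dickson em (λ x n → μ n x) coords
    ... | i , j , i<j , grows with ℕ.m≤n⇒∃[o]m+o≡n i<j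
    ... | l , refl =
      let (rᵤ , hᵤ) = segment-run 0 i (λ x → refl)
          (rᵥ , hᵥ) = segment-run i (suc l) {after (at 0) (segment 0 i)} hᵤ
      in segment 0 i , segment i (suc l) , covering (λ ()) (run-++ everywhere (segment 0 i) rᵤ rᵥ)
           (λ x → gain (trans (sym (hᵥ x)) (trans (after≡ (after (at 0) (segment 0 i)) (segment i (suc l)) x) (cong (ℤ._+ effect x (segment i (suc l))) (hᵤ x))))
             (subst (λ n → at i x ℤ.≤ at n x) (sym (ℕ.+-suc i l)) (ℤ.+≤+ (grows (coords-complete x)))))
      where
      gain : ∀ {a b e} → b ≡ a ℤ.+ e → a ℤ.≤ b → 0ℤ ℤ.≤ e
      gain {a} {b} {e} refl a≤b = subst (0ℤ ℤ.≤_) (cancel a e) (ℤ.i≤j⇒0≤j-i a≤b)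
        where
        cancel : ∀ a e → a ℤ.+ e ℤ.- a ≡ e
        cancel = solve-∀

-- Rational arithmetic

private
  half : ℚ → ℚ
  half ε = ε ℚ.* ½

  half+half : ∀ ε → half ε ℚ.+ half ε ≡ ε
  half+half = solve 1 (λ e → e :* con ½ :+ e :* con ½ := e) refl

  half>0 : ∀ {ε} → 0ℚ ℚ.< ε → 0ℚ ℚ.< half ε
  half>0 {ε} 0<ε = subst (ℚ._< half ε) (ℚ.*-zeroˡ ½) (ℚ.*-monoˡ-<-pos ½ 0<ε)

  cancel-< : ∀ {x y} s → x ℚ.+ s ℚ.< y ℚ.+ s → x ℚ.< y
  cancel-< {x} {y} s h = subst₂ ℚ._<_ (undo x s) (undo y s) (ℚ.+-monoˡ-< (ℚ.- s) h)
    where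
    undo : ∀ x s → (x ℚ.+ s) ℚ.+ (ℚ.- s) ≡ x
    undo = solve 2 (λ x s → (x :+ s) :+ (:- s) := x) refl

  -- The two one-sided consequences of closeness.
  near : ∀ a b {δ} → ∣ a ℚ.- b ∣ ℚ.< δ → a ℚ.< b ℚ.+ δ
  near a b {δ} h = subst (ℚ._< b ℚ.+ δ) (undo a b) (ℚ.+-monoʳ-< b (ℚ.≤-<-trans (p≤∣p∣ (a ℚ.- b)) h))
    where
    undo : ∀ a b → b ℚ.+ (a ℚ.+ (ℚ.- b)) ≡ a
    undo = solve 2 (λ a b → b :+ (a :+ (:- b)) := a) refl
    p≤∣p∣ : ∀ p → p ℚ.≤ ∣ p ∣
    p≤∣p∣ p with ℚ.≤-total 0ℚ p
    ... | inj₁ 0≤p = ℚ.≤-reflexive (sym (ℚ.0≤p⇒∣p∣≡p 0≤p))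
    ... | inj₂ p≤0 = ℚ.≤-trans p≤0 (ℚ.0≤∣p∣ p)

  near′ : ∀ a b {δ} → ∣ a ℚ.- b ∣ ℚ.< δ → b ℚ.< a ℚ.+ δ
  near′ a b {δ} h = near b a (subst (ℚ._< δ) (trans (sym (ℚ.∣-p∣≡∣p∣ (a ℚ.- b))) (cong ∣_∣ (flip a b))) h)
    where
    flip : ∀ a b → ℚ.- (a ℚ.+ (ℚ.- b)) ≡ b ℚ.+ (ℚ.- a)
    flip = solve 2 (λ a b → :- (a :+ (:- b)) := b :+ (:- a)) refl

  x<x+ε : ∀ x {ε} → 0ℚ ℚ.< ε → x ℚ.< x ℚ.+ ε
  x<x+ε x {ε} 0<ε = subst (ℚ._< x ℚ.+ ε) (ℚ.+-identityʳ x) (ℚ.+-monoʳ-< x 0<ε)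

  -- The gap ε between x and y is divided into eighths below: the Cauchy conditions consume a few
  -- of them, and a quarter remains as the gap of the conclusion.
  eighth : ∀ ε → ε ≡ (let c = half (half (half ε)) in ((c ℚ.+ c) ℚ.+ (c ℚ.+ c)) ℚ.+ ((c ℚ.+ c) ℚ.+ (c ℚ.+ c)))
  eighth = solve 1 (λ e → let c = ((e :* con ½) :* con ½) :* con ½ in
    e := ((c :+ c) :+ (c :+ c)) :+ ((c :+ c) :+ (c :+ c))) refl

-- The order of the reals

≃-reflexive : ∀ {x y} → (∀ n → seq x n ≡ seq y n) → x ≃ y
≃-reflexive {x} {y} h ε 0<ε = 0 , λ n _ → subst (λ q → ∣ q ∣ ℚ.< ε)
  (sym (trans (cong (ℚ._- seq y n) (h n)) (ℚ.+-inverseʳ (seq y n)))) 0<ε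

≃-sym : ∀ {x y} → x ≃ y → y ≃ x
≃-sym {x} {y} x≃y ε 0<ε =
  let (N , h) = x≃y ε 0<ε
  in N , λ n ≤n → subst (ℚ._< ε) (trans (sym (ℚ.∣-p∣≡∣p∣ (seq x n ℚ.- seq y n))) (cong ∣_∣ (flip (seq x n) (seq y n)))) (h n ≤n)
  where
  flip : ∀ a b → ℚ.- (a ℚ.+ (ℚ.- b)) ≡ b ℚ.+ (ℚ.- a)
  flip = solve 2 (λ a b → :- (a :+ (:- b)) := b :+ (:- a)) refl

<-respˡ-≃ : ∀ {x x′ y} → x ≃ x′ → x < y → x′ < y
<-respˡ-≃ {x} {x′} {y} x≃ (ε , 0<ε , N , h) =
  let (M , g) = x≃ (half ε) (half>0 0<ε)
  in half ε , half>0 0<ε , N ⊔ M , λ n ≤n →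
    ℚ.<-trans (ℚ.<-≤-trans (ℚ.+-monoˡ-< (half ε) (near′ (seq x n) (seq x′ n) (g n (ℕ.m⊔n≤o⇒n≤o N M ≤n))))
                (ℚ.≤-reflexive (trans (ℚ.+-assoc (seq x n) (half ε) (half ε)) (cong (λ q → seq x n ℚ.+ q) (half+half ε)))))
              (h n (ℕ.m⊔n≤o⇒m≤o N M ≤n))

<-respʳ-≃ : ∀ {x y y′} → y ≃ y′ → x < y → x < y′
<-respʳ-≃ {x} {y} {y′} y≃ (ε , 0<ε , N , h) =
  let (M , g) = y≃ (half ε) (half>0 0<ε)
  in half ε , half>0 0<ε , N ⊔ M , λ n ≤n → cancel-< (half ε)
    (ℚ.≤-<-trans (ℚ.≤-reflexive (trans (ℚ.+-assoc (seq x n) (half ε) (half ε)) (cong (λ q → seq x n ℚ.+ q) (half+half ε))))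
      (ℚ.<-trans (h n (ℕ.m⊔n≤o⇒m≤o N M ≤n)) (near (seq y n) (seq y′ n) (g n (ℕ.m⊔n≤o⇒n≤o N M ≤n)))))

<-trans : ∀ {x y z} → x < y → y < z → x < z
<-trans {x} {y} {z} (ε , 0<ε , N , h) (δ , 0<δ , M , g) = ε , 0<ε , N ⊔ M , λ n ≤n →
  ℚ.<-trans (h n (ℕ.m⊔n≤o⇒m≤o N M ≤n)) (ℚ.<-trans (x<x+ε (seq y n) 0<δ) (g n (ℕ.m⊔n≤o⇒n≤o N M ≤n)))

<-irrefl : ∀ {x} → ¬ x < x
<-irrefl {x} (ε , 0<ε , N , h) = ℚ.<-irrefl refl (ℚ.<-trans (x<x+ε (seq x N) 0<ε) (h N ℕ.≤-refl))

<⇒≤ : ∀ {x y} → x < y → x ≤ y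
<⇒≤ {x} {y} x<y y<x = <-irrefl {x} (<-trans {x} {y} {x} x<y y<x)

abstract
  -- Decided at one sufficiently late index n₀, by comparing z with x + ε / 2.
  <-cotrans : ∀ {x y} → x < y → ∀ z → x < z ⊎ z < y
  <-cotrans {x} {y} (ε , 0<ε , N , h) z with cauchy x c 0<c | cauchy y c 0<c | cauchy z c 0<c
    where
    c : ℚ
    c = half (half (half ε))
    0<c : 0ℚ ℚ.< c
    0<c = half>0 (half>0 (half>0 0<ε))
  ... | Nx , hx | Ny , hy | Nz , hz = compare (seq z n₀ ℚ.<? seq x n₀ ℚ.+ (2c ℚ.+ 2c))
    where
    c 2c : ℚ
    c  = half (half (half ε))
    2c = c ℚ.+ c
    0<2c : 0ℚ ℚ.< 2c
    0<2c = ℚ.+-mono-< (half>0 (half>0 (half>0 0<ε))) (half>0 (half>0 (half>0 0<ε)))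
    n₀ : ℕ
    n₀ = N ⊔ (Nx ⊔ (Ny ⊔ Nz))
    N≤ : N ℕ.≤ n₀
    N≤ = ℕ.m≤m⊔n N _
    Nx≤ : Nx ℕ.≤ n₀
    Nx≤ = ℕ.≤-trans (ℕ.m≤m⊔n Nx _) (ℕ.m≤n⊔m N _)
    Ny≤ : Ny ℕ.≤ n₀
    Ny≤ = ℕ.≤-trans (ℕ.≤-trans (ℕ.m≤m⊔n Ny Nz) (ℕ.m≤n⊔m Nx _)) (ℕ.m≤n⊔m N _)
    Nz≤ : Nz ℕ.≤ n₀
    Nz≤ = ℕ.≤-trans (ℕ.≤-trans (ℕ.m≤n⊔m Ny Nz) (ℕ.m≤n⊔m Nx _)) (ℕ.m≤n⊔m N _)
    compare : Dec (seq z n₀ ℚ.< seq x n₀ ℚ.+ (2c ℚ.+ 2c)) → x < z ⊎ z < y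
    compare (yes z<) = inj₂ (2c , 0<2c , n₀ , λ n ≤n →
      cancel-< (seq z n₀ ℚ.+ seq x n₀ ℚ.+ seq y n₀ ℚ.+ (2c ℚ.+ 2c) ℚ.+ 2c)
        (subst₂ ℚ._<_ (lhs (seq z n) (seq z n₀) (seq x n₀) (seq y n₀) c) (rhs (seq y n) (seq z n₀) (seq x n₀) (seq y n₀) c)
          (ℚ.+-mono-< (ℚ.+-mono-< (near (seq z n) (seq z n₀) (hz n n₀ (ℕ.≤-trans Nz≤ ≤n) Nz≤)) z<)
                      (ℚ.+-mono-< (subst (λ q → seq x n₀ ℚ.+ q ℚ.< seq y n₀) (eighth ε) (h n₀ N≤))
                                  (near′ (seq y n) (seq y n₀) (hy n n₀ (ℕ.≤-trans Ny≤ ≤n) Ny≤))))))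
      where
      lhs : ∀ z z₀ x₀ y₀ c → (z ℚ.+ z₀) ℚ.+ ((x₀ ℚ.+ (((c ℚ.+ c) ℚ.+ (c ℚ.+ c)) ℚ.+ ((c ℚ.+ c) ℚ.+ (c ℚ.+ c)))) ℚ.+ y₀)
            ≡ (z ℚ.+ (c ℚ.+ c)) ℚ.+ (z₀ ℚ.+ x₀ ℚ.+ y₀ ℚ.+ ((c ℚ.+ c) ℚ.+ (c ℚ.+ c)) ℚ.+ (c ℚ.+ c))
      lhs = solve 5 (λ z z₀ x₀ y₀ c → (z :+ z₀) :+ ((x₀ :+ (((c :+ c) :+ (c :+ c)) :+ ((c :+ c) :+ (c :+ c)))) :+ y₀)
            := (z :+ (c :+ c)) :+ (z₀ :+ x₀ :+ y₀ :+ ((c :+ c) :+ (c :+ c)) :+ (c :+ c))) refl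
      rhs : ∀ y z₀ x₀ y₀ c → ((z₀ ℚ.+ c) ℚ.+ (x₀ ℚ.+ ((c ℚ.+ c) ℚ.+ (c ℚ.+ c)))) ℚ.+ (y₀ ℚ.+ (y ℚ.+ c))
            ≡ y ℚ.+ (z₀ ℚ.+ x₀ ℚ.+ y₀ ℚ.+ ((c ℚ.+ c) ℚ.+ (c ℚ.+ c)) ℚ.+ (c ℚ.+ c))
      rhs = solve 5 (λ y z₀ x₀ y₀ c → ((z₀ :+ c) :+ (x₀ :+ ((c :+ c) :+ (c :+ c)))) :+ (y₀ :+ (y :+ c))
            := y :+ (z₀ :+ x₀ :+ y₀ :+ ((c :+ c) :+ (c :+ c)) :+ (c :+ c))) refl
    compare (no ≮) = inj₁ (2c , 0<2c , n₀ , λ n ≤n →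
      cancel-< (seq x n₀ ℚ.+ seq z n₀ ℚ.+ 2c)
        (subst₂ ℚ._<_ (lhs (seq x n) (seq x n₀) (seq z n₀) c) (rhs (seq z n) (seq x n₀) (seq z n₀) c)
          (ℚ.+-mono-< (ℚ.+-mono-<-≤ (near (seq x n) (seq x n₀) (hx n n₀ (ℕ.≤-trans Nx≤ ≤n) Nx≤)) (ℚ.≮⇒≥ ≮))
                      (near′ (seq z n) (seq z n₀) (hz n n₀ (ℕ.≤-trans Nz≤ ≤n) Nz≤)))))
      where
      lhs : ∀ x x₀ z₀ c → (x ℚ.+ (x₀ ℚ.+ ((c ℚ.+ c) ℚ.+ (c ℚ.+ c)))) ℚ.+ z₀ ≡ (x ℚ.+ (c ℚ.+ c)) ℚ.+ (x₀ ℚ.+ z₀ ℚ.+ (c ℚ.+ c))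
      lhs = solve 4 (λ x x₀ z₀ c → (x :+ (x₀ :+ ((c :+ c) :+ (c :+ c)))) :+ z₀ := (x :+ (c :+ c)) :+ (x₀ :+ z₀ :+ (c :+ c))) refl
      rhs : ∀ z x₀ z₀ c → ((x₀ ℚ.+ c) ℚ.+ z₀) ℚ.+ (z ℚ.+ c) ≡ z ℚ.+ (x₀ ℚ.+ z₀ ℚ.+ (c ℚ.+ c))
      rhs = solve 4 (λ z x₀ z₀ c → ((x₀ :+ c) :+ z₀) :+ (z :+ c) := z :+ (x₀ :+ z₀ :+ (c :+ c))) refl

<-≤-trans : ∀ {x y z} → x < y → y ≤ z → x < z
<-≤-trans {x} {y} {z} x<y y≤z = [ id , (λ z<y → ⊥-elim (y≤z z<y)) ]′ (<-cotrans {x} {y} x<y z)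

≤-<-trans : ∀ {x y z} → x ≤ y → y < z → x < z
≤-<-trans {x} {y} {z} x≤y y<z = [ (λ y<x → ⊥-elim (x≤y y<x)) , id ]′ (<-cotrans {y} {z} y<z x)

-- The negative relation ≤ is antisymmetric up to equality of reals.
≤-tight : ∀ {x y} → x ≤ y → y ≤ x → x ≃ y
≤-tight {x} {y} x≤y y≤x ε 0<ε =
  let (δ , 0<δ , N , h) = close y x x≤y
      (γ , 0<γ , M , g) = close x y y≤x
  in N ⊔ M , λ n ≤n → between (seq x n) (seq y n)
       (ℚ.<-trans (x<x+ε (seq x n) 0<δ) (h n (ℕ.m⊔n≤o⇒m≤o N M ≤n)))
       (ℚ.<-trans (x<x+ε (seq y n) 0<γ) (g n (ℕ.m⊔n≤o⇒n≤o N M ≤n)))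
  where
  close : ∀ a b → b ≤ a → b < a + fromℚ ε
  close a b b≤a = ≤-<-trans {b} {a} {a + fromℚ ε} b≤a
    (half ε , half>0 0<ε , 0 , λ n _ → ℚ.+-monoʳ-< (seq a n)
      (subst (half ε ℚ.<_) (half+half ε) (x<x+ε (half ε) (half>0 0<ε))))
  between : ∀ a b → a ℚ.< b ℚ.+ ε → b ℚ.< a ℚ.+ ε → ∣ a ℚ.- b ∣ ℚ.< ε
  between a b a< b< with ℚ.∣p∣≡p∨∣p∣≡-p (a ℚ.- b)
  ... | inj₁ eq = subst (ℚ._< ε) (sym eq) (cancel-< b (subst₂ ℚ._<_ (p a b) (ℚ.+-comm b ε) a<))
    where
    p : ∀ a b → a ≡ (a ℚ.+ (ℚ.- b)) ℚ.+ b
    p = solve 2 (λ a b → a := (a :+ (:- b)) :+ b) refl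
  ... | inj₂ eq = subst (ℚ._< ε) (sym eq) (cancel-< a (subst₂ ℚ._<_ (p a b) (ℚ.+-comm a ε) b<))
    where
    p : ∀ a b → b ≡ (ℚ.- (a ℚ.+ (ℚ.- b))) ℚ.+ a
    p = solve 2 (λ a b → b := (:- (a :+ (:- b))) :+ a) refl

≃⇒≤ : ∀ {x y} → x ≃ y → x ≤ y
≃⇒≤ {x} {y} x≃y y<x = <-irrefl {y} (<-respʳ-≃ {y} {x} {y} x≃y y<x)

+-monoˡ-< : ∀ {x y} z → x < y → x + z < y + z
+-monoˡ-< {x} {y} z (ε , 0<ε , N , h) = ε , 0<ε , N , λ n ≤n →
  subst (ℚ._< seq y n ℚ.+ seq z n) (exchange (seq x n) ε (seq z n)) (ℚ.+-monoˡ-< (seq z n) (h n ≤n))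
  where
  exchange : ∀ x e z → x ℚ.+ e ℚ.+ z ≡ x ℚ.+ z ℚ.+ e
  exchange = solve 3 (λ x e z → x :+ e :+ z := x :+ z :+ e) refl

fromℚ-mono-< : ∀ {p q} → p ℚ.< q → fromℚ p < fromℚ q
fromℚ-mono-< {p} {q} p<q with ℚ.<-dense p<q
... | r , p<r , r<q = r ℚ.- p
  , subst (ℚ._< r ℚ.- p) (ℚ.+-inverseʳ p) (ℚ.+-monoˡ-< (ℚ.- p) p<r)
  , 0 , λ _ _ → subst (ℚ._< q) (undo p r) r<q
  where
  undo : ∀ p r → r ≡ p ℚ.+ (r ℚ.+ (ℚ.- p))
  undo = solve 2 (λ p r → r := p :+ (r :+ (:- p))) refl

fromℚ-cancel-< : ∀ {p q} → fromℚ p < fromℚ q → p ℚ.< q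
fromℚ-cancel-< {p} {q} (ε , 0<ε , N , h) = ℚ.<-trans (x<x+ε p 0<ε) (h N ℕ.≤-refl)

fraction-mono-< : ∀ {p q} → p ℚᵘ.< q → ℚ.fromℚᵘ p ℚ.< ℚ.fromℚᵘ q
fraction-mono-< {p} {q} p<q = ℚ.toℚᵘ-cancel-<
  (ℚᵘ.<-respˡ-≃ (ℚᵘ.≃-sym (ℚ.toℚᵘ-fromℚᵘ p)) (ℚᵘ.<-respʳ-≃ (ℚᵘ.≃-sym (ℚ.toℚᵘ-fromℚᵘ q)) p<q))

fraction-cancel-< : ∀ {p q} → ℚ.fromℚᵘ p ℚ.< ℚ.fromℚᵘ q → p ℚᵘ.< q
fraction-cancel-< {p} {q} h =
  ℚᵘ.<-respˡ-≃ (ℚ.toℚᵘ-fromℚᵘ p) (ℚᵘ.<-respʳ-≃ (ℚ.toℚᵘ-fromℚᵘ q) (ℚ.toℚᵘ-mono-< h))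

fromℕ-mono-< : ∀ {m n} → m ℕ.< n → fromℕ m < fromℕ n
fromℕ-mono-< {m} {n} m<n = fromℚ-mono-< (fraction-mono-< {ℚᵘ.mkℚᵘ (+ m) 0} {ℚᵘ.mkℚᵘ (+ n) 0}
  (ℚᵘ.*<* (ℤ.*-monoʳ-<-pos (+ 1) (ℤ.+<+ m<n))))

-- Subtraction of the integer k.
module Shift (k : ℕ) where

  shift-zero : fromℕ k - fromℕ k ≃ 0ℝ
  shift-zero = ≃-reflexive {fromℕ k - fromℕ k} {0ℝ} (λ n → ℚ.+-inverseʳ (+ k ℚ./ 1))

  shift-mono-< : ∀ {x y} → x < y → x - fromℕ k < y - fromℕ k
  shift-mono-< {x} {y} = +-monoˡ-< {x} {y} (- fromℕ k)

  k<⇒0<shift : ∀ {x} → fromℕ k < x → 0ℝ < x - fromℕ k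
  k<⇒0<shift {x} k<x = <-respˡ-≃ {fromℕ k - fromℕ k} {0ℝ} {x - fromℕ k} shift-zero (shift-mono-< {fromℕ k} {x} k<x)

  shift-cong : ∀ {x y} → x ≃ y → x - fromℕ k ≃ y - fromℕ k
  shift-cong {x} {y} x≃y ε 0<ε = let (N , h) = x≃y ε 0<ε in N , λ n ≤n →
    subst (λ q → ∣ q ∣ ℚ.< ε) (collapse (seq x n) (seq y n) (+ k ℚ./ 1)) (h n ≤n)
    where
    collapse : ∀ x y z → x ℚ.+ (ℚ.- y) ≡ (x ℚ.+ (ℚ.- z)) ℚ.+ (ℚ.- (y ℚ.+ (ℚ.- z)))
    collapse = solve 3 (λ x y z → x :+ (:- y) := (x :+ (:- z)) :+ (:- (y :+ (:- z)))) refl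

≤-trans : ∀ {x y z} → x ≤ y → y ≤ z → x ≤ z
≤-trans {x} {y} {z} x≤y y≤z z<x = y≤z (<-≤-trans {z} {x} {y} z<x x≤y)

fromℕ-mono-≤ : ∀ {m n} → m ℕ.≤ n → fromℕ m ≤ fromℕ n
fromℕ-mono-≤ {m} {n} m≤n n<m with ℕ.m≤n⇒m<n∨m≡n m≤n
... | inj₁ m<n  = <⇒≤ {fromℕ m} {fromℕ n} (fromℕ-mono-< m<n) n<m
... | inj₂ refl = <-irrefl {fromℕ m} n<m

fromℕ-cancel-< : ∀ {m n} → fromℕ m < fromℕ n → m ℕ.< n
fromℕ-cancel-< {m} {n} h = ℕ.≰⇒> (λ n≤m → fromℕ-mono-≤ n≤m h)

-- Age classes

k+k-mono : ∀ k l → k ℕ.≤ l → k ℕ.+ k ℕ.≤ l ℕ.+ l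
k+k-mono k l k≤l = ℕ.+-mono-≤ k≤l k≤l

k+k-mono-< : ∀ k l → k ℕ.< l → suc (k ℕ.+ k) ℕ.< l ℕ.+ l
k+k-mono-< k l k<l = subst (ℕ._≤ l ℕ.+ l) (cong suc (ℕ.+-suc k k)) (k+k-mono (suc k) l k<l)

k+k-cancel : ∀ k l → k ℕ.+ k ℕ.≤ suc (l ℕ.+ l) → k ℕ.≤ l
k+k-cancel k l h = ℕ.≮⇒≥ (λ l<k → ℕ.<⇒≱ (k+k-mono-< l k l<k) h)

parity : ∀ c → ∃[ k ] (c ≡ k ℕ.+ k ⊎ c ≡ suc (k ℕ.+ k))
parity zero    = 0 , inj₁ refl
parity (suc c) with parity c
... | k , inj₁ refl = k , inj₂ refl
... | k , inj₂ refl = suc k , inj₁ (cong suc (sym (ℕ.+-suc k k)))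

-- Relative to a bound b, ages fall into the classes 0 , ⋯ , 2 b + 1: class 2 k is the
-- integer k, class 2 k + 1 is the open interval from k to k + 1, or everything above
-- b if k is b. A class is characterised by the comparisons with integers.
record InClass (b c : ℕ) (x : ℝ) : Set where
  field
    ≤⇒ : ∀ {k} → k ℕ.≤ b → fromℕ k ≤ x → k ℕ.+ k ℕ.≤ c
    ≤⇐ : ∀ {k} → k ℕ.≤ b → k ℕ.+ k ℕ.≤ c → fromℕ k ≤ x
    <⇒ : ∀ {k} → k ℕ.≤ b → fromℕ k < x → k ℕ.+ k ℕ.< c
    <⇐ : ∀ {k} → k ℕ.≤ b → k ℕ.+ k ℕ.< c → fromℕ k < x

open InClass public

class-resp-≃ : ∀ {b c x y} → x ≃ y → InClass b c x → InClass b c y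
class-resp-≃ {x = x} {y} x≃y C = record
  { ≤⇒ = λ {k} k≤b k≤y → ≤⇒ C k≤b (λ x<k → k≤y (<-respˡ-≃ {x} {y} {fromℕ k} x≃y x<k))
  ; ≤⇐ = λ {k} k≤b h y<k → ≤⇐ C k≤b h (<-respˡ-≃ {y} {x} {fromℕ k} (≃-sym {x} {y} x≃y) y<k)
  ; <⇒ = λ {k} k≤b k<y → <⇒ C k≤b (<-respʳ-≃ {fromℕ k} {y} {x} (≃-sym {x} {y} x≃y) k<y)
  ; <⇐ = λ {k} k≤b h → <-respʳ-≃ {fromℕ k} {x} {y} x≃y (<⇐ C k≤b h)
  }

-- Between two distinct classes there is an integer that separates them.
class-≮ : ∀ {b c c′ x} → c ℕ.≤ suc (b ℕ.+ b) → c′ ℕ.≤ suc (b ℕ.+ b) → InClass b c x → InClass b c′ x → ¬ c ℕ.< c′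
class-≮ {b} {c} {c′} c≤ c′≤ C C′ c<c′ with parity c
... | k , inj₁ refl = ℕ.<-irrefl refl (<⇒ C {k} k≤b (<⇐ C′ {k} k≤b c<c′))
  where
  k≤b : k ℕ.≤ b
  k≤b = k+k-cancel k b c≤
... | k , inj₂ refl = ℕ.<⇒≱ ℕ.≤-refl (subst (ℕ._≤ suc (k ℕ.+ k)) 2+2k (≤⇒ C {suc k} k<b (≤⇐ C′ {suc k} k<b (subst (ℕ._≤ c′) (sym 2+2k) c<c′))))
  where
  2+2k : suc k ℕ.+ suc k ≡ suc (suc (k ℕ.+ k))
  2+2k = cong suc (ℕ.+-suc k k)
  k<b : suc k ℕ.≤ b
  k<b = k+k-cancel (suc k) b (subst (ℕ._≤ suc (b ℕ.+ b)) (sym 2+2k) (ℕ.≤-trans c<c′ c′≤))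

class-unique : ∀ {b c c′ x} → c ℕ.≤ suc (b ℕ.+ b) → c′ ℕ.≤ suc (b ℕ.+ b) → InClass b c x → InClass b c′ x → c ≡ c′
class-unique c≤ c′≤ C C′ = ℕ.≤-antisym (ℕ.≮⇒≥ (class-≮ c′≤ c≤ C′ C)) (ℕ.≮⇒≥ (class-≮ c≤ c′≤ C C′))

floor-unique : ∀ {x k l} → IsFloor x k → IsFloor x l → k ≡ l
floor-unique {x} {k} {l} (k≤x , x<k+1) (l≤x , x<l+1) = ℕ.≤-antisym
  (ℕ.≤-pred (fromℕ-cancel-< (≤-<-trans {fromℕ k} {x} {fromℕ (suc l)} k≤x x<l+1)))
  (ℕ.≤-pred (fromℕ-cancel-< (≤-<-trans {fromℕ l} {x} {fromℕ (suc k)} l≤x x<k+1)))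

class-integer : ∀ {b x k} → IsFloor x k → x ≤ fromℕ k → InClass b (k ℕ.+ k) x
class-integer {b} {x} {k} (k≤x , x<k+1) x≤k = record
  { ≤⇒ = λ {l} _ l≤x → k+k-mono l k (ℕ.≤-pred (fromℕ-cancel-< (≤-<-trans {fromℕ l} {x} {fromℕ (suc k)} l≤x x<k+1)))
  ; ≤⇐ = λ {l} _ h → ≤-trans {fromℕ l} {fromℕ k} {x} (fromℕ-mono-≤ (k+k-cancel l k (ℕ.m≤n⇒m≤1+n h))) k≤x
  ; <⇒ = λ {l} _ l<x → ℕ.<-trans (ℕ.n<1+n (l ℕ.+ l)) (k+k-mono-< l k (fromℕ-cancel-< (<-≤-trans {fromℕ l} {x} {fromℕ k} l<x x≤k)))
  ; <⇐ = λ {l} _ h → <-≤-trans {fromℕ l} {fromℕ k} {x} (fromℕ-mono-< (ℕ.≰⇒> (λ k≤l → ℕ.<⇒≱ h (k+k-mono k l k≤l)))) k≤x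
  }

class-fractional : ∀ {b x k} → fromℕ k < x → x < fromℕ (suc k) → InClass b (suc (k ℕ.+ k)) x
class-fractional {b} {x} {k} k<x x<k+1 = record
  { ≤⇒ = λ {l} _ l≤x → ℕ.m≤n⇒m≤1+n (k+k-mono l k (ℕ.≤-pred (fromℕ-cancel-< (≤-<-trans {fromℕ l} {x} {fromℕ (suc k)} l≤x x<k+1))))
  ; ≤⇐ = λ {l} _ h → <⇒≤ {fromℕ l} {x} (above {l} h)
  ; <⇒ = λ {l} _ l<x → s≤s (k+k-mono l k (ℕ.≤-pred (fromℕ-cancel-< (<-trans {fromℕ l} {x} {fromℕ (suc k)} l<x x<k+1))))
  ; <⇐ = λ {l} _ h → above {l} (ℕ.<⇒≤ h)
  }
  where
  above : ∀ {l} → l ℕ.+ l ℕ.≤ suc (k ℕ.+ k) → fromℕ l < x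
  above {l} h = ≤-<-trans {fromℕ l} {fromℕ k} {x} (fromℕ-mono-≤ (k+k-cancel l k h)) k<x

class-above : ∀ {b x} → fromℕ b < x → InClass b (suc (b ℕ.+ b)) x
class-above {b} {x} b<x = record
  { ≤⇒ = λ {k} k≤b _ → ℕ.m≤n⇒m≤1+n (k+k-mono k b k≤b)
  ; ≤⇐ = λ {k} k≤b _ → <⇒≤ {fromℕ k} {x} (above {k} k≤b)
  ; <⇒ = λ {k} k≤b _ → s≤s (k+k-mono k b k≤b)
  ; <⇐ = λ {k} k≤b _ → above {k} k≤b
  }
  where
  above : ∀ {l} → l ℕ.≤ b → fromℕ l < x
  above {l} l≤b = ≤-<-trans {fromℕ l} {fromℕ b} {x} (fromℕ-mono-≤ l≤b) b<x

private
  integer<half : ∀ k c → (fromℕ k < fromℚ (+ c ℚ./ 2) → k ℕ.+ k ℕ.< c) × (k ℕ.+ k ℕ.< c → fromℕ k < fromℚ (+ c ℚ./ 2))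
  integer<half k c =
      (λ h → fro (fraction-cancel-< {ℚᵘ.mkℚᵘ (+ k) 0} {ℚᵘ.mkℚᵘ (+ c) 1} (fromℚ-cancel-< h)))
    , (λ h → fromℚ-mono-< (fraction-mono-< {ℚᵘ.mkℚᵘ (+ k) 0} {ℚᵘ.mkℚᵘ (+ c) 1} (to h)))
    where
    lhs : + k ℤ.* + 2 ≡ + (k ℕ.+ k)
    lhs = trans (sym (ℤ.pos-* k 2)) (cong +_ (trans (ℕ.*-comm k 2) (cong (k ℕ.+_) (ℕ.+-identityʳ k))))
    rhs : + c ℤ.* + 1 ≡ + c
    rhs = ℤ.*-identityʳ (+ c)
    fro : ℚᵘ.mkℚᵘ (+ k) 0 ℚᵘ.< ℚᵘ.mkℚᵘ (+ c) 1 → k ℕ.+ k ℕ.< c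
    fro (ℚᵘ.*<* h) = ℤ.drop‿+<+ (subst₂ ℤ._<_ lhs rhs h)
    to : k ℕ.+ k ℕ.< c → ℚᵘ.mkℚᵘ (+ k) 0 ℚᵘ.< ℚᵘ.mkℚᵘ (+ c) 1
    to h = ℚᵘ.*<* (subst₂ ℤ._<_ (sym lhs) (sym rhs) (ℤ.+<+ h))

  half<integer : ∀ k c → (fromℚ (+ c ℚ./ 2) < fromℕ k → c ℕ.< k ℕ.+ k) × (c ℕ.< k ℕ.+ k → fromℚ (+ c ℚ./ 2) < fromℕ k)
  half<integer k c =
      (λ h → fro (fraction-cancel-< {ℚᵘ.mkℚᵘ (+ c) 1} {ℚᵘ.mkℚᵘ (+ k) 0} (fromℚ-cancel-< h)))
    , (λ h → fromℚ-mono-< (fraction-mono-< {ℚᵘ.mkℚᵘ (+ c) 1} {ℚᵘ.mkℚᵘ (+ k) 0} (to h)))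
    where
    rhs : + k ℤ.* + 2 ≡ + (k ℕ.+ k)
    rhs = trans (sym (ℤ.pos-* k 2)) (cong +_ (trans (ℕ.*-comm k 2) (cong (k ℕ.+_) (ℕ.+-identityʳ k))))
    lhs : + c ℤ.* + 1 ≡ + c
    lhs = ℤ.*-identityʳ (+ c)
    fro : ℚᵘ.mkℚᵘ (+ c) 1 ℚᵘ.< ℚᵘ.mkℚᵘ (+ k) 0 → c ℕ.< k ℕ.+ k
    fro (ℚᵘ.*<* h) = ℤ.drop‿+<+ (subst₂ ℤ._<_ lhs rhs h)
    to : c ℕ.< k ℕ.+ k → ℚᵘ.mkℚᵘ (+ c) 1 ℚᵘ.< ℚᵘ.mkℚᵘ (+ k) 0
    to h = ℚᵘ.*<* (subst₂ ℤ._<_ (sym lhs) (sym rhs) (ℤ.+<+ h))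

-- The representative c / 2 of class c.
representative : ℕ → ℝ≥0
representative c = mkℝ≥0 (fromℚ (+ c ℚ./ 2)) (λ h → ℕ.n≮0 (proj₁ (half<integer 0 c) h))

class-representative : ∀ b c → InClass b c (val (representative c))
class-representative b c = record
  { ≤⇒ = λ {k} _ k≤ → ℕ.≮⇒≥ (λ h → k≤ (proj₂ (half<integer k c) h))
  ; ≤⇐ = λ {k} _ h <k → ℕ.<⇒≱ (proj₁ (half<integer k c) <k) h
  ; <⇒ = λ {k} _ → proj₁ (integer<half k c)
  ; <⇐ = λ {k} _ → proj₂ (integer<half k c)
  }

-- The description of the classes by floors.
data Bounds (b : ℕ) (x : ℝ) : ℕ → Set where
  integer    : ∀ {k} → k ℕ.≤ b → IsFloor x k → x ≤ fromℕ k → Bounds b x (k ℕ.+ k)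
  fractional : ∀ {k} → k ℕ.< b → fromℕ k < x → x < fromℕ (suc k) → Bounds b x (suc (k ℕ.+ k))
  unbounded  : fromℕ b < x → Bounds b x (suc (b ℕ.+ b))

bounds⇒class : ∀ {b x c} → Bounds b x c → InClass b c x
bounds⇒class {x = x} (integer {k} _ k≤x x≤k)          = class-integer {x = x} {k = k} k≤x x≤k
bounds⇒class {x = x} (fractional {k} _ k<x x<k+1) = class-fractional {x = x} {k = k} k<x x<k+1
bounds⇒class {x = x} (unbounded b<x)                  = class-above {x = x} b<x

module Classical (em : ExcludedMiddle 0ℓ) where

  ≰⇒> : ∀ {x y} → ¬ x ≤ y → y < x
  ≰⇒> {x} {y} = decidable-stable (em {y < x})

  -- Every nonnegative real lies in a class, by comparison with b , b - 1 , ⋯ in turn.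
  floorBounds : ∀ b x → 0ℝ ≤ x → ∃[ c ] Bounds b x c
  floorBounds zero x 0≤x with em {0ℝ < x}
  ... | yes 0<x = 1 , unbounded 0<x
  ... | no 0≮x  = 0 , integer {k = 0} z≤n (0≤x , ≤-<-trans {x} {0ℝ} {fromℕ 1} 0≮x (fromℕ-mono-< {0} {1} (s≤s z≤n))) 0≮x
  floorBounds (suc b) x 0≤x with em {fromℕ (suc b) < x} | em {x < fromℕ (suc b)}
  ... | yes b+1<x | _         = _ , unbounded b+1<x
  ... | no b+1≮x  | no x≮b+1 = _ , integer {k = suc b} ℕ.≤-refl
          (x≮b+1 , ≤-<-trans {x} {fromℕ (suc b)} {fromℕ (suc (suc b))} b+1≮x (fromℕ-mono-< (ℕ.n<1+n (suc b)))) b+1≮x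
  ... | no _      | yes x<b+1 with floorBounds b x 0≤x
  ... | _ , integer {k} k≤b fl x≤k         = _ , integer {k = k} (ℕ.m≤n⇒m≤1+n k≤b) fl x≤k
  ... | _ , fractional {k} k<b k<x x<k+1   = _ , fractional {k = k} (ℕ.m≤n⇒m≤1+n k<b) k<x x<k+1
  ... | _ , unbounded b<x                      = _ , fractional {k = b} ℕ.≤-refl b<x x<b+1

  bounds-≤ : ∀ {b x c} → Bounds b x c → c ℕ.≤ suc (b ℕ.+ b)
  bounds-≤ {b} (integer {k} k≤b _ _)       = ℕ.m≤n⇒m≤1+n (k+k-mono k b k≤b)
  bounds-≤ {b} (fractional {k} k<b _ _)    = ℕ.<⇒≤ (ℕ.m≤n⇒m≤1+n (k+k-mono-< k b k<b))
  bounds-≤ (unbounded _)                       = ℕ.≤-refl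

-- Intervals contain whole classes

infix 4 _∈ᶜ_

-- The interval contains the class, provided that the bound of the classes is at least
-- the constants of the interval.
_∈ᶜ_ : ℕ → Interval → Set
c ∈ᶜ interval l b u = AboveLower b × BelowUpper u
  where
  AboveLower : Bracket → Set
  AboveLower closed = l ℕ.+ l ℕ.≤ c
  AboveLower open′  = l ℕ.+ l ℕ.< c

  BelowUpper : Upper → Set
  BelowUpper (finite m closed) = c ℕ.≤ m ℕ.+ m
  BelowUpper (finite m open′)  = c ℕ.< m ℕ.+ m
  BelowUpper ∞                 = ⊤

_∈ᶜ?_ : ∀ c I → Dec (c ∈ᶜ I)
c ∈ᶜ? interval l closed (finite m closed) = (l ℕ.+ l ℕ.≤? c) ×-dec (c ℕ.≤? m ℕ.+ m)
c ∈ᶜ? interval l closed (finite m open′)  = (l ℕ.+ l ℕ.≤? c) ×-dec (c ℕ.<? m ℕ.+ m)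
c ∈ᶜ? interval l closed ∞                 = (l ℕ.+ l ℕ.≤? c) ×-dec yes tt
c ∈ᶜ? interval l open′  (finite m closed) = (l ℕ.+ l ℕ.<? c) ×-dec (c ℕ.≤? m ℕ.+ m)
c ∈ᶜ? interval l open′  (finite m open′)  = (l ℕ.+ l ℕ.<? c) ×-dec (c ℕ.<? m ℕ.+ m)
c ∈ᶜ? interval l open′  ∞                 = (l ℕ.+ l ℕ.<? c) ×-dec yes tt

module _ (em : ExcludedMiddle 0ℓ) {b c : ℕ} {x : ℝ} (C : InClass b c x) where

  private
    below : ∀ {m} → m ℕ.≤ b → c ℕ.< m ℕ.+ m → x < fromℕ m
    below {m} m≤b c< = Classical.≰⇒> em {fromℕ m} {x} (λ m≤x → ℕ.<⇒≱ c< (≤⇒ C m≤b m≤x))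

    below⁻¹ : ∀ {m} → m ℕ.≤ b → x < fromℕ m → c ℕ.< m ℕ.+ m
    below⁻¹ m≤b x<m = ℕ.≰⇒> (λ ≤c → ≤⇐ C m≤b ≤c x<m)

    under : ∀ {m} → m ℕ.≤ b → c ℕ.≤ m ℕ.+ m → x ≤ fromℕ m
    under m≤b c≤ m<x = ℕ.<⇒≱ (<⇒ C m≤b m<x) c≤

    under⁻¹ : ∀ {m} → m ℕ.≤ b → x ≤ fromℕ m → c ℕ.≤ m ℕ.+ m
    under⁻¹ m≤b x≤m = ℕ.≮⇒≥ (λ m< → x≤m (<⇐ C m≤b m<))

  class⇒interval : ∀ I → All (ℕ._≤ b) (constants I) → c ∈ᶜ I → x ∈ᴵ I
  class⇒interval (interval l closed (finite m closed)) (l≤ ∷ m≤ ∷ []) (lo , hi) = ≤⇐ C {l} l≤ lo , under {m} m≤ hi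
  class⇒interval (interval l closed (finite m open′))  (l≤ ∷ m≤ ∷ []) (lo , hi) = ≤⇐ C {l} l≤ lo , below {m} m≤ hi
  class⇒interval (interval l closed ∞)                 (l≤ ∷ [])      (lo , _)  = ≤⇐ C {l} l≤ lo , tt
  class⇒interval (interval l open′ (finite m closed))  (l≤ ∷ m≤ ∷ []) (lo , hi) = <⇐ C {l} l≤ lo , under {m} m≤ hi
  class⇒interval (interval l open′ (finite m open′))   (l≤ ∷ m≤ ∷ []) (lo , hi) = <⇐ C {l} l≤ lo , below {m} m≤ hi
  class⇒interval (interval l open′ ∞)                  (l≤ ∷ [])      (lo , _)  = <⇐ C {l} l≤ lo , tt

  interval⇒class : ∀ I → All (ℕ._≤ b) (constants I) → x ∈ᴵ I → c ∈ᶜ I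
  interval⇒class (interval l closed (finite m closed)) (l≤ ∷ m≤ ∷ []) (lo , hi) = ≤⇒ C {l} l≤ lo , under⁻¹ {m} m≤ hi
  interval⇒class (interval l closed (finite m open′))  (l≤ ∷ m≤ ∷ []) (lo , hi) = ≤⇒ C {l} l≤ lo , below⁻¹ {m} m≤ hi
  interval⇒class (interval l closed ∞)                 (l≤ ∷ [])      (lo , _)  = ≤⇒ C {l} l≤ lo , tt
  interval⇒class (interval l open′ (finite m closed))  (l≤ ∷ m≤ ∷ []) (lo , hi) = <⇒ C {l} l≤ lo , under⁻¹ {m} m≤ hi
  interval⇒class (interval l open′ (finite m open′))   (l≤ ∷ m≤ ∷ []) (lo , hi) = <⇒ C {l} l≤ lo , below⁻¹ {m} m≤ hi
  interval⇒class (interval l open′ ∞)                  (l≤ ∷ [])      (lo , _)  = <⇒ C {l} l≤ lo , tt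

-- Positive delays

0<x⇒y<y+x : ∀ {x} y → 0ℝ < x → y < y + x
0<x⇒y<y+x {x} y 0<x =
  <-respˡ-≃ {0ℝ + y} {y} {y + x} (≃-reflexive {0ℝ + y} {y} (λ n → ℚ.+-identityˡ (seq y n)))
    (<-respʳ-≃ {0ℝ + y} {x + y} {y + x} (≃-reflexive {x + y} {y + x} (λ n → ℚ.+-comm (seq x n) (seq y n)))
      (+-monoˡ-< {0ℝ} {x} y 0<x))

sum-positive : ∀ x y → 0ℝ < x → 0ℝ ≤ y → 0ℝ < x + y
sum-positive x y 0<x 0≤y = ≤-<-trans {0ℝ} {y} {x + y} 0≤y
  (<-respʳ-≃ {y} {y + x} {x + y} (≃-reflexive {y + x} {x + y} (λ n → ℚ.+-comm (seq y n) (seq x n))) (0<x⇒y<y+x {x} y 0<x))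

sum-nonneg : ∀ {xs} → All (0ℝ <_) xs → 0ℝ ≤ foldr _+_ 0ℝ xs
sum-nonneg []                       = <-irrefl {0ℝ}
sum-nonneg {x ∷ xs} (0<x ∷ 0<xs) = <⇒≤ {0ℝ} {x + foldr _+_ 0ℝ xs} (sum-positive x (foldr _+_ 0ℝ xs) 0<x (sum-nonneg 0<xs))

module _ (N : TPN) where

  -- An infinite sequence of discrete transitions starts in M.
  InfiniteDiscrete : Marking N → Set
  InfiniteDiscrete M = Σ[ μ ∈ (ℕ → Marking N) ] _≋_ N (μ 0) M × (∀ i → Disc N (μ i) (μ (suc i)))

  finite-positive : ∀ {x xs} → 0ℝ < x → All (0ℝ <_) xs → ¬ HasSum N (inj₁ (x ∷ xs)) 0ℝ
  finite-positive {x} {xs} 0<x 0<xs ≃0 = ≃⇒≤ {x + foldr _+_ 0ℝ xs} {0ℝ} ≃0 (sum-positive x (foldr _+_ 0ℝ xs) 0<x (sum-nonneg 0<xs))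

  infinite-positive : ∀ {ds xs} → ds ≡ inj₂ xs → (∀ n → 0ℝ < xs n) → ¬ HasSum N ds 0ℝ
  infinite-positive {xs = xs} refl 0<xs lim with 0<xs 0
  ... | ε , 0<ε , K , h with ℚ.<-dense 0<ε
  ... | δ , 0<δ , δ<ε with lim δ 0<δ
  ... | L , g = <-irrefl {fromℚ δ} (<-trans {fromℚ δ} {partialSum N xs (suc L)} {fromℚ δ} (grows L)
        (<-respʳ-≃ {partialSum N xs (suc L)} {0ℝ + fromℚ δ} {fromℚ δ}
          (≃-reflexive {0ℝ + fromℚ δ} {fromℚ δ} (λ n → ℚ.+-identityˡ δ)) (proj₂ (g (suc L) (ℕ.n≤1+n L)))))
    where
    δ<x₀ : fromℚ δ < xs 0
    δ<x₀ = ε ℚ.- δ , subst (ℚ._< ε ℚ.- δ) (ℚ.+-inverseʳ δ) (ℚ.+-monoˡ-< (ℚ.- δ) δ<ε) , K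
         , λ n ≤n → subst (ℚ._< seq (xs 0) n) (undo δ ε) (h n ≤n)
      where
      undo : ∀ δ ε → 0ℚ ℚ.+ ε ≡ δ ℚ.+ (ε ℚ.+ (ℚ.- δ))
      undo = solve 2 (λ δ ε → con 0ℚ :+ ε := δ :+ (ε :+ (:- δ))) refl
    grows : ∀ n → fromℚ δ < partialSum N xs (suc n)
    grows zero    = <-respʳ-≃ {fromℚ δ} {xs 0} {0ℝ + xs 0}
      (≃-reflexive {xs 0} {0ℝ + xs 0} (λ n → sym (ℚ.+-identityˡ (seq (xs 0) n)))) δ<x₀
    grows (suc n) = <-trans {fromℚ δ} {partialSum N xs (suc n)} {partialSum N xs (suc (suc n))}
      (grows n) (0<x⇒y<y+x {xs (suc n)} (partialSum N xs (suc n)) (0<xs (suc n)))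

  -- All delays are positive.
  Positive : Delays N → Set
  Positive (inj₁ xs) = All (0ℝ <_) xs
  Positive (inj₂ xs) = ∀ n → 0ℝ < xs n

  cons-positive : ∀ {x ds} → 0ℝ < x → Positive ds → ¬ HasSum N (consDelay N x ds) 0ℝ
  cons-positive {x} {inj₁ xs} 0<x 0<xs = finite-positive {x} {xs} 0<x 0<xs
  cons-positive {x} {inj₂ xs} 0<x 0<xs = infinite-positive {consDelay N x (inj₂ xs)} refl λ { zero → 0<x ; (suc n) → 0<xs n }

  delaysᶠ-positive : ∀ {M} (π : FinitelyTimed N M) → All (0ℝ <_) (delaysᶠ N π)
  delaysᶠ-positive (discreteForever _ _ _) = []
  delaysᶠ-positive (phase _ x _ π)         = pos x ∷ delaysᶠ-positive π

  delaysᵈ-positive : ∀ {M} (π : InfDiscComputation N M) → Positive (delaysᵈ N π)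
  delaysᵈ-positive (finitely π)   = delaysᶠ-positive π
  delaysᵈ-positive (infinitely π) = λ i → pos (InfinitelyTimed.delay π i)

  zerotime⇒discrete : ∀ {M} → Zerotime N M → InfiniteDiscrete M
  zerotime⇒discrete (disc (finitely (discreteForever μ start steps)) , _) = μ , start , steps
  zerotime⇒discrete (disc (finitely (phase _ x _ π)) , Δ≃0) =
    ⊥-elim (finite-positive {val⁺ x} (pos x) (delaysᶠ-positive π) Δ≃0)
  zerotime⇒discrete (disc (infinitely π) , Δ≃0) =
    ⊥-elim (infinite-positive refl (λ i → pos (InfinitelyTimed.delay π i)) Δ≃0)
  zerotime⇒discrete (time x _ π , Δ≃0) =
    ⊥-elim (cons-positive {val⁺ x} {delaysᵈ N π} (pos x) (delaysᵈ-positive π) Δ≃0)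

  discrete⇒zerotime : ∀ {M} → InfiniteDiscrete M → Zerotime N M
  discrete⇒zerotime (μ , start , steps) = disc (finitely (discreteForever μ start steps)) , ≃-reflexive {0ℝ} {0ℝ} (λ _ → refl)

-- Multiplicities

module Count {A : Set} (_≟_ : DecidableEquality A) where

  -- The multiplicity of x.
  count : A → List A → ℕ
  count x l = length (filter (x ≟_) l)

  count-↭ : ∀ x {l l′} → l ↭ l′ → count x l ≡ count x l′
  count-↭ x p = ↭-length (filter-↭ (x ≟_) p)

  count-++ : ∀ x l l′ → count x (l ++ l′) ≡ count x l ℕ.+ count x l′
  count-++ x l l′ = trans (cong length (List.filter-++ (x ≟_) l l′)) (List.length-++ (filter (x ≟_) l))

  count-∷ : ∀ x y l → count x (y ∷ l) ≡ count x [ y ] ℕ.+ count x l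
  count-∷ x y l = count-++ x [ y ] l

  count-here : ∀ x l → count x (x ∷ l) ≡ suc (count x l)
  count-here x l = cong length (List.filter-accept (x ≟_) {x} {l} refl)

  count>0⇒∈ : ∀ x l → 0 ℕ.< count x l → x ∈ l
  count>0⇒∈ x (y ∷ l) h with x ≟ y
  ... | yes refl = here refl
  ... | no _     = there (count>0⇒∈ x l h)

  unique⇒count≤1 : ∀ x {l} → Unique l → count x l ℕ.≤ 1
  unique⇒count≤1 x []                  = z≤n
  unique⇒count≤1 x (_∷_ {y} {l} y∉ u) with x ≟ y
  ... | no _     = unique⇒count≤1 x u
  ... | yes refl = s≤s (ℕ.≮⇒≥ (λ h → All.lookup y∉ (count>0⇒∈ x l h) refl))

  -- Tokens whose keys form a given submultiset of all keys can be split off.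
  extract : ∀ {B : Set} (f : B → A) L M → (∀ x → count x L ℕ.≤ count x (map f M)) →
    ∃[ b ] ∃[ c ] M ↭ b ++ c × map f b ≡ L
  extract f []      M h = [] , M , refl , refl
  extract f (x ∷ L) M h
    with ∈-map⁻ f (count>0⇒∈ x (map f M) (ℕ.≤-trans (ℕ.≤-trans (s≤s z≤n) (ℕ.≤-reflexive (sym (count-here x L)))) (h x)))
  ... | y , y∈M , refl with ∈-∃++ y∈M
  ... | us , vs , refl with extract f L (us ++ vs) rest
    where
    rest : ∀ z → count z L ℕ.≤ count z (map f (us ++ vs))
    rest z = ℕ.+-cancelˡ-≤ (count z [ f y ]) _ _ (subst₂ ℕ._≤_ (count-∷ z (f y) L)
      (trans (count-↭ z (map⁺ f (shift y us vs))) (count-∷ z (f y) (map f (us ++ vs)))) (h z))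
  ... | b , c , perm , refl = y ∷ b , c , ↭-trans (shift y us vs) (prep y perm) , refl

-- The discrete part of a timed Petri net as a finite Petri net

∈⇒≤max : ∀ {k l} → k ∈ l → k ℕ.≤ foldr _⊔_ 0 l
∈⇒≤max (here refl)                = ℕ.m≤m⊔n _ _
∈⇒≤max {l = n ∷ l} (there k∈)     = ℕ.≤-trans (∈⇒≤max k∈) (ℕ.m≤n⊔m n (foldr _⊔_ 0 l))

-- The pairs (p , a p) for the places p with an arc.
onArcs : ∀ {n} {B : Set} → (Fin n → Maybe Interval) → (Fin n → B) → List (Fin n) → List (Fin n × B)
onArcs arcs a = mapMaybe (λ p → Maybe.map (λ _ → p , a p) (arcs p))

module _ {n : ℕ} (arcs : Fin n → Maybe Interval) where

  onArcs-place : ∀ {B : Set} (a : Fin n → B) ps {y} → y ∈ onArcs arcs a ps → proj₁ y ∈ ps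
  onArcs-place a (p ∷ ps) y∈ with arcs p
  onArcs-place a (p ∷ ps) (here refl) | just _  = here refl
  onArcs-place a (p ∷ ps) (there y∈)  | just _  = there (onArcs-place a ps y∈)
  onArcs-place a (p ∷ ps) y∈          | nothing = there (onArcs-place a ps y∈)

  onArcs-unique : ∀ {B : Set} (a : Fin n → B) {ps : List (Fin n)} → Unique ps → Unique (onArcs arcs a ps)
  onArcs-unique a [] = []
  onArcs-unique a (_∷_ {p} {ps} p∉ u) with arcs p
  ... | nothing = onArcs-unique a u
  ... | just _  = All.tabulate (λ { y∈ refl → All.lookup p∉ (onArcs-place a ps y∈) refl }) ∷ onArcs-unique a u

  onArcs-cong : ∀ {B : Set} {a a′ : Fin n → B} {ps : List (Fin n)} → All (λ p → a p ≡ a′ p) ps → onArcs arcs a ps ≡ onArcs arcs a′ ps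
  onArcs-cong []                = refl
  onArcs-cong (_∷_ {p} e es) with arcs p
  ... | nothing = onArcs-cong es
  ... | just _  = cong₂ _∷_ (cong (p ,_) e) (onArcs-cong es)

  map-onArcs : ∀ {B C : Set} (f : B → C) (a : Fin n → B) ps →
    map (λ (p , x) → p , f x) (onArcs arcs a ps) ≡ onArcs arcs (λ p → f (a p)) ps
  map-onArcs f a []       = refl
  map-onArcs f a (p ∷ ps) with arcs p
  ... | nothing = map-onArcs f a ps
  ... | just _  = cong (_ ∷_) (map-onArcs f a ps)

  -- Preimages of the values on the arcs, with a default where there is no arc.
  onArcs-lift : ∀ {B C : Set} → B → (f : B → C) (c : Fin n → C) {ps : List (Fin n)} → Unique ps → ∀ b →
    map (λ (p , x) → p , f x) b ≡ onArcs arcs c ps →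
    ∃[ a ] b ≡ onArcs arcs a ps × (∀ {p I} → p ∈ ps → arcs p ≡ just I → f (a p) ≡ c p)
  onArcs-lift d f c [] [] eq = (λ _ → d) , refl , λ ()
  onArcs-lift d f c (_∷_ {p} {ps} p∉ u) b eq with arcs p in arc
  onArcs-lift d f c (_∷_ {p} {ps} p∉ u) b eq | nothing with onArcs-lift d f c u b eq
  ... | a , b≡ , h = a , b≡ , λ { (here refl) eq′ → case (trans (sym arc) eq′) of λ () ; (there p∈) → h p∈ }
  onArcs-lift {B} d f c (_∷_ {p} {ps} p∉ u) ((q , x) ∷ b) eq | just I with onArcs-lift d f c u b (List.∷-injectiveʳ eq)
  ... | a , b≡ , h with cong proj₁ (List.∷-injectiveˡ eq) | cong proj₂ (List.∷-injectiveˡ eq)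
  ... | refl | fx≡ = a′
    , cong₂ _∷_ (cong (p ,_) (sym a′p)) (trans b≡ (onArcs-cong (All.tabulate (λ q∈ → sym (a′q q∈)))))
    , λ { (here refl) _ → trans (cong f a′p) fx≡ ; (there q∈) e → trans (cong f (a′q q∈)) (h q∈ e) }
    where
    a′ : Fin n → B
    a′ q with q Fin.≟ p
    ... | yes _ = x
    ... | no _  = a q
    a′p : a′ p ≡ x
    a′p with p Fin.≟ p
    ... | yes _  = refl
    ... | no p≢p = ⊥-elim (p≢p refl)
    a′q : ∀ {q} → q ∈ ps → a′ q ≡ a q
    a′q {q} q∈ with q Fin.≟ p
    ... | yes refl = ⊥-elim (All.lookup p∉ q∈ refl)
    ... | no _     = refl

module Abstraction (N : TPN) where
  open TPN N

  max : ℕ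
  max = maxConst N

  -- The classes 0 , ⋯ , 2 max + 1 of ages.
  Class : Set
  Class = Fin (suc (suc (max ℕ.+ max)))

  -- What remains of a token when its age is replaced by its class.
  Key : Set
  Key = Place × Class

  _≟ᴷ_ : DecidableEquality Key
  _≟ᴷ_ = ≡-dec Fin._≟_ Fin._≟_

  open Count _≟ᴷ_ public

  keys : List Key
  keys = cartesianProduct (allFin #P) (allFin _)

  keys-complete : ∀ x → x ∈ keys
  keys-complete (p , c) = ∈-cartesianProduct⁺ (∈-allFin p) (∈-allFin c)

  -- Assignments of classes to the places.
  Classes : Set
  Classes = Fin (suc (suc (max ℕ.+ max)) ℕ.^ #P)

  classAt : Classes → Place → Class
  classAt = Fin.finToFun

  classes : (Place → Class) → Classes
  classes = Fin.funToFin

  -- Every age of the class may be used on the arc.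
  Allowed : Maybe Interval → Class → Set
  Allowed nothing  c = ⊤
  Allowed (just I) c = toℕ c ∈ᶜ I

  allowed? : ∀ I c → Dec (Allowed I c)
  allowed? nothing  c = yes tt
  allowed? (just I) c = toℕ c ∈ᶜ? I

  -- A transition together with classes of its input and output tokens.
  Choice : Set
  Choice = Transition × Classes × Classes

  Valid : Choice → Set
  Valid (t , i , o) = (∀ p → Allowed (In t p) (classAt i p)) × (∀ p → Allowed (Out t p) (classAt o p))

  valid? : ∀ r → Dec (Valid r)
  valid? (t , i , o) = Fin.all? (λ p → allowed? (In t p) (classAt i p)) ×-dec Fin.all? (λ p → allowed? (Out t p) (classAt o p))

  choices : List Choice
  choices = filter valid? (cartesianProduct (allFin #T) (cartesianProduct (allFin _) (allFin _)))

  ∈-choices : ∀ {r} → Valid r → r ∈ choices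
  ∈-choices {t , i , o} = ∈-filter⁺ valid? (∈-cartesianProduct⁺ (∈-allFin t) (∈-cartesianProduct⁺ (∈-allFin i) (∈-allFin o)))

  inputs outputs : Choice → List Key
  inputs  (t , i , o) = onArcs (In t)  (classAt i) (allFin #P)
  outputs (t , i , o) = onArcs (Out t) (classAt o) (allFin #P)

  inputs-unique : ∀ r → Unique (inputs r)
  inputs-unique (t , i , o) = onArcs-unique (In t) (classAt i) (Unique.allFin⁺ #P)

  outputs-unique : ∀ r → Unique (outputs r)
  outputs-unique (t , i , o) = onArcs-unique (Out t) (classAt o) (Unique.allFin⁺ #P)

  -- The transitions of the finite net are the valid choices, by position.
  Step : Set
  Step = Fin (length choices)

  pre post : Step → Key → ℕ
  pre  s x = count x (inputs (lookup choices s))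
  post s x = count x (outputs (lookup choices s))

  pre≤1 : ∀ s x → pre s x ℕ.≤ 1
  pre≤1 s x = unique⇒count≤1 x (inputs-unique (lookup choices s))

  post≤1 : ∀ s x → post s x ℕ.≤ 1
  post≤1 s x = unique⇒count≤1 x (outputs-unique (lookup choices s))

  open FiniteNets pre post pre≤1 post≤1 (allFin _) ∈-allFin keys keys-complete public

  -- A list of keys as a marking of the finite net.
  multiplicity : List Key → Key → ℤ
  multiplicity l x = + count x l

  private
    constant≤max : ∀ {t p I} → In t p ≡ just I ⊎ Out t p ≡ just I → All (ℕ._≤ max) (constants I)
    constant≤max {t} {p} {I} arc = All.tabulate λ {k} k∈ → ∈⇒≤max
      (∈-concatMap⁺ (λ t → concatMap (λ p → onArc (In t p) ++ onArc (Out t p)) (allFin #P))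
        (lose (∈-allFin t) (∈-concatMap⁺ (λ p → onArc (In t p) ++ onArc (Out t p)) (lose (∈-allFin p) (side arc k∈)))))
      where
      onArc : Maybe Interval → List ℕ
      onArc = Maybe.maybe′ constants []
      side : In t p ≡ just I ⊎ Out t p ≡ just I → ∀ {k} → k ∈ constants I → k ∈ onArc (In t p) ++ onArc (Out t p)
      side (inj₁ eq) k∈ = ∈-++⁺ˡ (subst (λ m → _ ∈ onArc m) (sym eq) k∈)
      side (inj₂ eq) k∈ = ∈-++⁺ʳ (onArc (In t p)) (subst (λ m → _ ∈ onArc m) (sym eq) k∈)

  module Correct (em : ExcludedMiddle 0ℓ) where
    open Classical em

    -- The class of an age. Finding it requires comparing reals, hence excluded middle.
    classify : ℝ≥0 → Class
    classify x = Fin.fromℕ< (s≤s (bounds-≤ (proj₂ (floorBounds max (val x) (nonneg x)))))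

    classify-bounds : ∀ x → Bounds max (val x) (toℕ (classify x))
    classify-bounds x = subst (Bounds max (val x)) (sym (Fin.toℕ-fromℕ< _)) (proj₂ (floorBounds max (val x) (nonneg x)))

    classify-class : ∀ x → InClass max (toℕ (classify x)) (val x)
    classify-class x = bounds⇒class (classify-bounds x)

    classify-unique : ∀ {x c} → InClass max (toℕ c) (val x) → classify x ≡ c
    classify-unique {x} {c} C = Fin.toℕ-injective
      (class-unique (ℕ.≤-pred (Fin.toℕ<n (classify x))) (ℕ.≤-pred (Fin.toℕ<n c)) (classify-class x) C)

    key : Token N → Key
    key (p , x) = p , classify x

    abstraction : Marking N → List Key
    abstraction = map key

    abstraction-≋ : ∀ {M M′} → _≋_ N M M′ → abstraction M ↭ abstraction M′
    abstraction-≋ (Hom.refl eqs) = ↭-reflexive (pointwise eqs)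
      where
      pointwise : ∀ {M M′} → Pointwise (λ (p , x) (q , y) → p ≡ q × val x ≃ val y) M M′ → abstraction M ≡ abstraction M′
      pointwise []                         = refl
      pointwise (_∷_ {x , a} {y , b} (refl , a≃b) eqs) = cong₂ _∷_
        (cong (x ,_) (sym (classify-unique {b} (class-resp-≃ {x = val a} {val b} a≃b (classify-class a))))) (pointwise eqs)
    abstraction-≋ (Hom.prep {x = p , a} {_ , b} (refl , a≃b) perm) = ↭-trans
      (↭-reflexive (cong (λ c → (p , c) ∷ _) (sym (classify-unique {b} (class-resp-≃ {x = val a} {val b} a≃b (classify-class a))))))
      (prep _ (abstraction-≋ perm))
    abstraction-≋ (Hom.swap {x = p , a} {q , a′} {_ , b} {_ , b′} (refl , a≃b) (refl , a≃b′) perm) = ↭-trans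
      (↭-reflexive (cong₂ (λ c d → (p , c) ∷ (q , d) ∷ _)
        (sym (classify-unique {b} (class-resp-≃ {x = val a} {val b} a≃b (classify-class a))))
        (sym (classify-unique {b′} (class-resp-≃ {x = val a′} {val b′} a≃b′ (classify-class a′))))))
      (swap _ _ (abstraction-≋ perm))
    abstraction-≋ (Hom.trans p q) = ↭-trans (abstraction-≋ p) (abstraction-≋ q)

    marking : Marking N → Key → ℤ
    marking M = multiplicity (abstraction M)

    private
      onArcs-key : ∀ (arcs : Place → Maybe Interval) (a : Place → ℝ≥0) {cs} → (∀ p → classAt cs p ≡ classify (a p)) →
        abstraction (onArcs arcs a (allFin #P)) ≡ onArcs arcs (classAt cs) (allFin #P)
      onArcs-key arcs a h = trans (map-onArcs arcs classify a (allFin #P))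
        (onArcs-cong arcs (All.universal (λ p → sym (h p)) (allFin #P)))

      allowed : ∀ {arcs : Place → Maybe Interval} {a : Place → ℝ≥0} {cs} →
        (∀ {p I} → arcs p ≡ just I → All (ℕ._≤ max) (constants I)) →
        (∀ p I → arcs p ≡ just I → val (a p) ∈ᴵ I) → (∀ p → classAt cs p ≡ classify (a p)) →
        ∀ p → Allowed (arcs p) (classAt cs p)
      allowed {arcs} {a} consts inI h p with arcs p in arc
      ... | nothing = tt
      ... | just I  = subst (λ c → toℕ c ∈ᶜ I) (sym (h p)) (interval⇒class em (classify-class (a p)) I (consts arc) (inI p I arc))

      inInterval : ∀ {I c x} → All (ℕ._≤ max) (constants I) → Allowed (just I) c → InClass max (toℕ c) (val x) → val x ∈ᴵ I
      inInterval {I} consts ok C = class⇒interval em C I consts ok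

      balance : ∀ {m₁ m₂ b₁ b₂ c} → m₁ ≡ b₁ ℕ.+ c → m₂ ≡ c ℕ.+ b₂ → + m₂ ≡ + m₁ ℤ.+ (+ b₂ ℤ.- + b₁)
      balance {b₁ = b₁} {b₂} {c} refl refl = trans (ℤ.pos-+ c b₂)
        (trans (rearrange (+ b₁) (+ b₂) (+ c)) (cong (ℤ._+ (+ b₂ ℤ.- + b₁)) (sym (ℤ.pos-+ b₁ c))))
        where
        rearrange : ∀ b₁ b₂ c → c ℤ.+ b₂ ≡ (b₁ ℤ.+ c) ℤ.+ (b₂ ℤ.- b₁)
        rearrange = solve-∀

      count-split : ∀ {M b c bs} x → _≋_ N M (b ++ c) → abstraction b ↭ bs →
        count x (abstraction M) ≡ count x bs ℕ.+ count x (abstraction c)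
      count-split {b = b} {c} {bs} x M≋ b↭ = trans (count-↭ x (↭-trans (abstraction-≋ M≋)
          (↭-trans (↭-reflexive (List.map-++ key b c)) (++⁺ʳ (abstraction c) b↭))))
        (count-++ x bs (abstraction c))

      count-split′ : ∀ {M b c bs} x → _≋_ N M (c ++ b) → abstraction b ↭ bs →
        count x (abstraction M) ≡ count x (abstraction c) ℕ.+ count x bs
      count-split′ {b = b} {c} {bs} x M≋ b↭ = trans (count-↭ x (↭-trans (abstraction-≋ M≋)
          (↭-trans (↭-reflexive (List.map-++ key c b)) (++⁺ˡ (abstraction c) b↭))))
        (count-++ x (abstraction c) bs)

    -- The abstract effect of firing a transition.
    Fires : Step → Marking N → Marking N → Set
    Fires s M₁ M₂ = (∀ x → pre s x ℕ.≤ count x (abstraction M₁)) × (∀ x → marking M₂ x ≡ marking M₁ x ℤ.+ Δ x s)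

    disc⇒step : ∀ {M₁ M₂} → Disc N M₁ M₂ → ∃[ s ] Fires s M₁ M₂
    disc⇒step {M₁} {M₂} (t , b₁ , b₂ , c , (a₁ , in₁ , b₁≋) , (a₂ , in₂ , b₂≋) , M₁≋ , M₂≋) =
      Any.index r∈ , (λ x → subst (ℕ._≤ count x (abstraction M₁)) (cong (λ r → count x (inputs r)) r≡)
                              (subst (count x (inputs r) ℕ.≤_) (sym (m₁ x)) (ℕ.m≤m+n _ _)))
                   , (λ x → subst (λ r → marking M₂ x ≡ marking M₁ x ℤ.+ (+ count x (outputs r) ℤ.- + count x (inputs r))) r≡
                              (balance {b₁ = count x (inputs r)} (m₁ x) (m₂ x)))
      where
      i o : Classes
      i = classes (classify ∘ a₁)
      o = classes (classify ∘ a₂)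
      r : Choice
      r = t , i , o
      i≡ : ∀ p → classAt i p ≡ classify (a₁ p)
      i≡ = Fin.finToFun-funToFin (classify ∘ a₁)
      o≡ : ∀ p → classAt o p ≡ classify (a₂ p)
      o≡ = Fin.finToFun-funToFin (classify ∘ a₂)
      r∈ : r ∈ choices
      r∈ = ∈-choices (allowed {In t} {a₁} {i} (constant≤max ∘ inj₁) in₁ i≡ , allowed {Out t} {a₂} {o} (constant≤max ∘ inj₂) in₂ o≡)
      r≡ : r ≡ lookup choices (Any.index r∈)
      r≡ = lookup-index r∈
      m₁ : ∀ x → count x (abstraction M₁) ≡ count x (inputs r) ℕ.+ count x (abstraction c)
      m₁ x = count-split x M₁≋ (↭-trans (abstraction-≋ b₁≋) (↭-reflexive (onArcs-key (In t) a₁ i≡)))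
      m₂ : ∀ x → count x (abstraction M₂) ≡ count x (abstraction c) ℕ.+ count x (outputs r)
      m₂ x = count-split′ x M₂≋ (↭-trans (abstraction-≋ b₂≋) (↭-reflexive (onArcs-key (Out t) a₂ o≡)))

    ↭⇒≋ : ∀ {M M′} → M ↭ M′ → _≋_ N M M′
    ↭⇒≋ p = Hom.map (λ { {_ , x} refl → refl , ≃-reflexive {val x} {val x} (λ _ → refl) }) (↭⇒↭ₛ p)

    -- Input tokens of the chosen classes are taken from M₁; output tokens get the representative
    -- ages of the chosen classes.
    realise : ∀ r → Valid r → ∀ M₁ → (∀ x → count x (inputs r) ℕ.≤ count x (abstraction M₁)) →
      ∃[ M₂ ] Disc N M₁ M₂ × (∀ x → marking M₂ x ≡ marking M₁ x ℤ.+ (+ count x (outputs r) ℤ.- + count x (inputs r)))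
    realise (t , i , o) (okᵢ , okₒ) M₁ enough with extract key (inputs (t , i , o)) M₁ enough
    ... | b₁ , c , M₁↭ , b₁≡ with onArcs-lift (In t) (representative 0) classify (classAt i) (Unique.allFin⁺ #P) b₁ b₁≡
    ... | a₁ , refl , a₁≡ = c ++ b₂
      , (t , b₁ , b₂ , c , (a₁ , in₁ , ↭⇒≋ refl) , (a₂ , in₂ , ↭⇒≋ refl) , ↭⇒≋ M₁↭ , ↭⇒≋ refl)
      , λ x → balance {b₁ = count x (inputs (t , i , o))}
                (count-split x (↭⇒≋ M₁↭) (↭-reflexive b₁≡))
                (count-split′ {M = c ++ b₂} {b₂} {c} x (↭⇒≋ refl) (↭-reflexive (onArcs-key (Out t) a₂ (λ p → sym (a₂≡ p)))))
      where
      a₂ : Place → ℝ≥0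
      a₂ p = representative (toℕ (classAt o p))
      b₂ : Marking N
      b₂ = onArcs (Out t) a₂ (allFin #P)
      a₂≡ : ∀ p → classify (a₂ p) ≡ classAt o p
      a₂≡ p = classify-unique (class-representative max (toℕ (classAt o p)))
      in₁ : ∀ p I → In t p ≡ just I → val (a₁ p) ∈ᴵ I
      in₁ p I eq = inInterval {c = classAt i p} {a₁ p} (constant≤max (inj₁ eq)) (subst (λ m → Allowed m (classAt i p)) eq (okᵢ p))
        (subst (λ c → InClass max (toℕ c) (val (a₁ p))) (a₁≡ (∈-allFin p) eq) (classify-class (a₁ p)))
      in₂ : ∀ p I → Out t p ≡ just I → val (a₂ p) ∈ᴵ I
      in₂ p I eq = inInterval {c = classAt o p} {a₂ p} (constant≤max (inj₂ eq)) (subst (λ m → Allowed m (classAt o p)) eq (okₒ p))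
        (class-representative max (toℕ (classAt o p)))

    step⇒disc : ∀ s M₁ → (∀ x → pre s x ℕ.≤ count x (abstraction M₁)) → ∃[ M₂ ] Disc N M₁ M₂ × Fires s M₁ M₂
    step⇒disc s M₁ enough =
      let valid              = All.lookup (All.all-filter valid? (cartesianProduct (allFin #T) (cartesianProduct (allFin _) (allFin _)))) (∈-lookup {xs = choices} s)
          (M₂ , step , step≡) = realise (lookup choices s) valid M₁ enough
      in M₂ , step , enough , step≡

    zerotime⇒covering : ∀ {M} → Zerotime N M → ∃[ u ] ∃[ v ] Covering (marking M) u v
    zerotime⇒covering {M} zero-time =
      let (μ , start , steps) = zerotime⇒discrete N zero-time
          (u , v , C) = infinite⇒covering em (λ n x → count x (abstraction (μ n))) (λ n → proj₁ (disc⇒step (steps n)))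
            (λ n → proj₁ (proj₂ (disc⇒step (steps n)))) (λ n → proj₂ (proj₂ (disc⇒step (steps n))))
      in u , v , covering-mono (λ x → ℤ.≤-reflexive (cong +_ (count-↭ x (abstraction-≋ start)))) C

    covering⇒zerotime : ∀ {M u v} → Covering (marking M) u v → Zerotime N M
    covering⇒zerotime {M} {u} {v} (covering v≢[] run gain) =
      discrete⇒zerotime N (current ∘ states , ↭⇒≋ refl , λ i → proj₂ (advance (states i)))
      where
      -- The current marking and the rest of the current round.
      record State : Set where
        eta-equality
        constructor state
        field
          current : Marking N
          rest    : List Step
          ready   : Run everywhere (marking current) (rest ++ v)
      open State

      fireFirst : ∀ M s r → Run everywhere (marking M) ((s ∷ r) ++ v) → Σ[ S ∈ State ] Disc N M (current S)
      fireFirst M s r (en ∷ run) =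
        let (M₂ , step , _ , step≡) = step⇒disc s M (atEach (λ i → ℤ.drop‿+≤+ (en i)))
        in state M₂ r (run-mono everywhere (λ i → ℤ.≤-reflexive (sym (step≡ (everywhere i)))) run) , step

      advance : ∀ S → Σ[ S′ ∈ State ] Disc N (current S) (current S′)
      advance (state M (s ∷ r) run) = fireFirst M s r run
      advance (state M []      run) = newRound v v≢[] (run-++ everywhere v run
          (run-mono everywhere (λ i → after-grows (marking M) v (everywhere i) (gain (everywhere i))) run))
        where
        newRound : ∀ w → w ≢ [] → Run everywhere (marking M) (w ++ v) → Σ[ S′ ∈ State ] Disc N M (current S′)
        newRound []      w≢[] _   = ⊥-elim (w≢[] refl)
        newRound (s ∷ r) _    run = fireFirst M s r run

      -- A round fires v after the initial word u; the rest of the first round is u.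
      states : ℕ → State
      states zero    = state M u run
      states (suc i) = proj₁ (advance (states i))

-- Fractional parts

fractional-parts : ∀ {x y k l} → IsFloor x k → IsFloor y l →
  (FracLess x y → x - fromℕ k < y - fromℕ l) × (x - fromℕ k < y - fromℕ l → FracLess x y)
fractional-parts {x} {y} {k} {l} fx fy =
    (λ (f , g , (k′ , fx′ , f≃) , (l′ , fy′ , g≃) , f<g) →
       subst₂ (λ k l → x - fromℕ k < y - fromℕ l) (floor-unique {x} {k′} {k} fx′ fx) (floor-unique {y} {l′} {l} fy′ fy)
         (<-respˡ-≃ {f} {x - fromℕ k′} {y - fromℕ l′} f≃ (<-respʳ-≃ {f} {g} {y - fromℕ l′} g≃ f<g)))
  , (λ h → x - fromℕ k , y - fromℕ l , (k , fx , ≃-reflexive {x - fromℕ k} {x - fromℕ k} (λ _ → refl))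
         , (l , fy , ≃-reflexive {y - fromℕ l} {y - fromℕ l} (λ _ → refl)) , h)

-- The fractional part of an integer is zero, otherwise it is positive.
fractional-zero : ∀ {x k} → IsFloor x k → x ≤ fromℕ k → 0ℝ ≃ x - fromℕ k
fractional-zero {x} {k} (k≤x , _) x≤k = ≤-tight {0ℝ} {x - fromℕ k}
  (λ h → <-irrefl {fromℕ k - fromℕ k} (<-respˡ-≃ {x - fromℕ k} {fromℕ k - fromℕ k} {fromℕ k - fromℕ k} same
           (<-respʳ-≃ {x - fromℕ k} {0ℝ} {fromℕ k - fromℕ k} zero′ h)))
  (λ h → <-irrefl {fromℕ k - fromℕ k} (<-respʳ-≃ {fromℕ k - fromℕ k} {x - fromℕ k} {fromℕ k - fromℕ k} same
           (<-respˡ-≃ {0ℝ} {fromℕ k - fromℕ k} {x - fromℕ k} zero′ h)))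
  where
  open Shift k
  same : x - fromℕ k ≃ fromℕ k - fromℕ k
  same = shift-cong {x} {fromℕ k} (≤-tight {x} {fromℕ k} x≤k k≤x)
  zero′ : 0ℝ ≃ fromℕ k - fromℕ k
  zero′ = ≃-sym {fromℕ k - fromℕ k} {0ℝ} shift-zero

fractional-positive : ∀ {x k} → fromℕ k < x → 0ℝ < x - fromℕ k
fractional-positive {x} {k} = Shift.k<⇒0<shift k {x}

-- Elements of regions

fracZero⇒exact : ∀ {x k} → IsFloor x k → FracZero x → x ≤ fromℕ k
fracZero⇒exact {x} {k} fl (k′ , fl′ , 0≃) k<x = <-irrefl {x - fromℕ k′}
  (<-respˡ-≃ {0ℝ} {x - fromℕ k′} {x - fromℕ k′} 0≃
    (fractional-positive {x} {k′} (subst (λ k → fromℕ k < x) (floor-unique {x} {k} {k′} fl fl′) k<x)))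

exact⇒fracZero : ∀ {x k} → IsFloor x k → x ≤ fromℕ k → FracZero x
exact⇒fracZero {x} {k} fl x≤k = k , fl , fractional-zero {x} {k} fl x≤k

exact-≮-exact : ∀ {x y k l} → IsFloor x k → x ≤ fromℕ k → IsFloor y l → y ≤ fromℕ l → ¬ FracLess x y
exact-≮-exact {x} {y} {k} {l} fx x≤k fy y≤l less = <-irrefl {0ℝ}
  (<-respˡ-≃ {x - fromℕ k} {0ℝ} {0ℝ} (≃-sym {0ℝ} {x - fromℕ k} (fractional-zero {x} {k} fx x≤k))
    (<-respʳ-≃ {x - fromℕ k} {y - fromℕ l} {0ℝ} (≃-sym {0ℝ} {y - fromℕ l} (fractional-zero {y} {l} fy y≤l))
      (proj₁ (fractional-parts {x} {y} {k} {l} fx fy) less)))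

exact-<-fractional : ∀ {x y k l} → IsFloor x k → x ≤ fromℕ k → IsFloor y l → fromℕ l < y → FracLess x y
exact-<-fractional {x} {y} {k} {l} fx x≤k fy l<y = proj₂ (fractional-parts {x} {y} {k} {l} fx fy)
  (<-respˡ-≃ {0ℝ} {x - fromℕ k} {y - fromℕ l} (fractional-zero {x} {k} fx x≤k) (fractional-positive {y} {l} l<y))

fractional-≮-exact : ∀ {x y k l} → IsFloor x k → fromℕ k < x → IsFloor y l → y ≤ fromℕ l → ¬ FracLess x y
fractional-≮-exact {x} {y} {k} {l} fx k<x fy y≤l less = <⇒≤ {0ℝ} {x - fromℕ k} (fractional-positive {x} {k} k<x)
  (<-respʳ-≃ {x - fromℕ k} {y - fromℕ l} {0ℝ} (≃-sym {0ℝ} {y - fromℕ l} (fractional-zero {y} {l} fy y≤l))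
    (proj₁ (fractional-parts {x} {y} {k} {l} fx fy) less))

lookup-map : ∀ {A B : Set} (f : A → B) xs (eq : length (map f xs) ≡ length xs) i → lookup (map f xs) i ≡ f (lookup xs (cast eq i))
lookup-map f (x ∷ xs) eq zero    = refl
lookup-map f (x ∷ xs) eq (suc i) = lookup-map f xs (ℕ.suc-injective eq) i

map-lookup-cast : ∀ {A : Set} (xs : List A) {n} (eq : n ≡ length xs) → map (λ i → lookup xs (cast eq i)) (allFin n) ≡ xs
map-lookup-cast xs refl = trans (List.map-cong (λ i → cong (lookup xs) (Fin.cast-is-id refl i)) (allFin (length xs)))
  (trans (List.map-tabulate id (lookup xs)) (List.tabulate-lookup xs))

unique-↭ : ∀ {A : Set} {xs ys : List A} → Unique xs → Unique ys →
  (∀ {x} → x ∈ xs → x ∈ ys) → (∀ {x} → x ∈ ys → x ∈ xs) → xs ↭ ys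
unique-↭ uˣ uʸ ⊆ ⊇ = ∼bag⇒↭ (unique∧set⇒bag uˣ uʸ (mk⇔ ⊆ ⊇))

module Regions (N : TPN) where
  open TPN N
  open Abstraction N

  -- All elements of a region, each once.
  elements : (R : Region N) → List (Element N R)
  elements R = map inZero (allFin _) ++ concatMap (λ j → map (inWord j) (allFin _)) (allFin _) ++ map inMax (allFin _)

  module _ (R : Region N) where
    open Region R

    ∈-elements : ∀ e → e ∈ elements R
    ∈-elements (inZero i)   = ∈-++⁺ˡ (∈-map⁺ inZero (∈-allFin i))
    ∈-elements (inWord j i) = ∈-++⁺ʳ (map inZero (allFin _)) (∈-++⁺ˡ
      (∈-concatMap⁺ (λ j → map (inWord j) (allFin _)) (lose (∈-allFin j) (∈-map⁺ (inWord j) (∈-allFin i)))))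
    ∈-elements (inMax i)    = ∈-++⁺ʳ (map inZero (allFin _)) (∈-++⁺ʳ
      (concatMap (λ j → map (inWord j) (allFin _)) (allFin _)) (∈-map⁺ inMax (∈-allFin i)))

    private
      inZero-injective : ∀ {i i′} → inZero {N} {R} i ≡ inZero i′ → i ≡ i′
      inZero-injective refl = refl

      inMax-injective : ∀ {i i′} → inMax {N} {R} i ≡ inMax i′ → i ≡ i′
      inMax-injective refl = refl

      inWord-injective : ∀ {j i i′} → inWord {N} {R} j i ≡ inWord j i′ → i ≡ i′
      inWord-injective refl = refl

      wordElements : List (Fin (length w)) → List (Element N R)
      wordElements = concatMap (λ j → map (inWord j) (allFin _))

      ∈-wordElements⁻ : ∀ {js e} → e ∈ wordElements js → ∃[ j ] ∃[ i ] j ∈ js × e ≡ inWord j i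
      ∈-wordElements⁻ {js} e∈ with find (∈-concatMap⁻ (λ j → map (inWord j) (allFin _)) {xs = js} e∈)
      ... | j , j∈ , e∈j with ∈-map⁻ (inWord j) e∈j
      ... | i , _ , eq = j , i , j∈ , eq

      wordElements-unique : ∀ {js} → Unique js → Unique (wordElements js)
      wordElements-unique [] = []
      wordElements-unique {j ∷ js} (j∉ ∷ u) = Unique.++⁺ (Unique.map⁺ inWord-injective (Unique.allFin⁺ _)) (wordElements-unique u)
        λ (e∈j , e∈js) → disjoint (∈-map⁻ (inWord j) e∈j) (∈-wordElements⁻ {js} e∈js)
        where
        disjoint : ∀ {e} → ∃[ i ] i ∈ allFin _ × e ≡ inWord j i → ¬ (∃[ j′ ] ∃[ i ] j′ ∈ js × e ≡ inWord j′ i)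
        disjoint (_ , _ , refl) (_ , _ , j∈ , refl) = All.lookup j∉ j∈ refl

    elements-unique : Unique (elements R)
    elements-unique = Unique.++⁺ (Unique.map⁺ inZero-injective (Unique.allFin⁺ _))
      (Unique.++⁺ (wordElements-unique (Unique.allFin⁺ _)) (Unique.map⁺ inMax-injective (Unique.allFin⁺ _))
        λ (e∈w , e∈m) → word≢max (∈-wordElements⁻ {allFin _} e∈w) (∈-map⁻ inMax e∈m))
      λ (e∈z , e∈) → zero≢ (∈-map⁻ inZero e∈z) (∈-++⁻ (wordElements (allFin _)) e∈)
      where
      word≢max : ∀ {e} → ∃[ j ] ∃[ i ] j ∈ allFin _ × e ≡ inWord j i → ¬ (∃[ i ] i ∈ allFin _ × e ≡ inMax i)
      word≢max (_ , _ , _ , refl) (_ , _ , ())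
      zero≢ : ∀ {e} → ∃[ i ] i ∈ allFin _ × e ≡ inZero i → ¬ (e ∈ wordElements (allFin _) ⊎ e ∈ map inMax (allFin _))
      zero≢ (_ , _ , refl) (inj₁ e∈) with ∈-wordElements⁻ {allFin _} e∈
      ... | _ , _ , _ , ()
      zero≢ (_ , _ , refl) (inj₂ e∈) with ∈-map⁻ inMax e∈
      ... | _ , _ , ()

    zeroAt : Fin (length b₀) → ℕ
    zeroAt i = toℕ (proj₂ (lookup b₀ i))

    wordAt : (j : Fin (length w)) → Fin (List⁺.length (lookup w j)) → ℕ
    wordAt j i = toℕ (proj₂ (lookup (List⁺.toList (lookup w j)) i))

    -- The age x is one of those described by the element.
    Fits : Element N R → ℝ → Set
    Fits (inZero i)   x = IsFloor x (zeroAt i) × x ≤ fromℕ (zeroAt i)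
    Fits (inWord j i) x = fromℕ (wordAt j i) < x × x < fromℕ (suc (wordAt j i))
    Fits (inMax i)    x = fromℕ max < x

    private
      zeroClass : ∀ i → zeroAt i ℕ.+ zeroAt i ℕ.< suc (suc (max ℕ.+ max))
      zeroClass i = s≤s (ℕ.m≤n⇒m≤1+n (k+k-mono (zeroAt i) max (ℕ.≤-pred (Fin.toℕ<n (proj₂ (lookup b₀ i))))))

      wordClass : ∀ j i → suc (wordAt j i ℕ.+ wordAt j i) ℕ.< suc (suc (max ℕ.+ max))
      wordClass j i = s≤s (ℕ.<⇒≤ (ℕ.m≤n⇒m≤1+n
        (k+k-mono-< (wordAt j i) max (Fin.toℕ<n (proj₂ (lookup (List⁺.toList (lookup w j)) i))))))

    classOf : Element N R → Class
    classOf (inZero i)   = Fin.fromℕ< (zeroClass i)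
    classOf (inWord j i) = Fin.fromℕ< (wordClass j i)
    classOf (inMax i)    = Fin.fromℕ< {suc (max ℕ.+ max)} ℕ.≤-refl

    -- The common key of the tokens that the element describes.
    keyOf : Element N R → Key
    keyOf e = placeOf N R e , classOf e

    fits⇒class : ∀ e {x} → Fits e x → InClass max (toℕ (classOf e)) x
    fits⇒class (inZero i) {x} (fl , x≤) = subst (λ c → InClass max c x) (sym (Fin.toℕ-fromℕ< (zeroClass i)))
      (class-integer {max} {x} {zeroAt i} fl x≤)
    fits⇒class (inWord j i) {x} (k<x , x<) = subst (λ c → InClass max c x) (sym (Fin.toℕ-fromℕ< (wordClass j i)))
      (class-fractional {max} {x} {wordAt j i} k<x x<)
    fits⇒class (inMax i) {x} max<x = subst (λ c → InClass max c x) (sym (Fin.toℕ-fromℕ< {suc (max ℕ.+ max)} ℕ.≤-refl)) (class-above {max} {x} max<x)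

    -- The multiset of keys of a region; the order of the fractional parts is forgotten.
    flat : List Key
    flat = map keyOf (elements R)

  module Satisfaction (em : ExcludedMiddle 0ℓ) where
    open Correct em
    open Classical em

    module _ (R : Region N) where
      open Region R

      private
        -- The conditions on one token in the definition of satisfaction, combined.
        conditions⇒fits : ∀ e x → (block N R e ≡ suc (length w) ⇔ fromℕ max < x) →
          (x ≤ fromℕ max → ∃[ k ] integerOf N R e ≡ just k × IsFloor x k) →
          (x ≤ fromℕ max → FracZero x ⇔ block N R e ≡ 0) → Fits R e x
        conditions⇒fits (inZero i) x above integers zeros = fits (integers x≤max)
          where
          x≤max : x ≤ fromℕ max
          x≤max max<x = case Equivalence.from above max<x of λ ()
          fits : ∃[ k ] just (zeroAt R i) ≡ just k × IsFloor x k → Fits R (inZero i) x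
          fits (k , refl , fl) = fl , fracZero⇒exact {x} {k} fl (Equivalence.from (zeros x≤max) refl)
        conditions⇒fits (inWord j i) x above integers zeros = fits (integers x≤max)
          where
          x≤max : x ≤ fromℕ max
          x≤max max<x = ℕ.<⇒≢ (Fin.toℕ<n j) (ℕ.suc-injective (Equivalence.from above max<x))
          fits : ∃[ k ] just (wordAt R j i) ≡ just k × IsFloor x k → Fits R (inWord j i) x
          fits (k , refl , fl@(_ , x<)) = ≰⇒> {x} {fromℕ k} (λ x≤k → case Equivalence.to (zeros x≤max) (exact⇒fracZero {x} {k} fl x≤k) of λ ()) , x<
        conditions⇒fits (inMax i) x above integers zeros = Equivalence.to above refl

      module _ {M : Marking N} (S : Satisfies N R M) where
        open Satisfies S

        satisfies⇒fits : ∀ i → Fits R (h i) (x i)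
        satisfies⇒fits i = conditions⇒fits (h i) (x i) (above i) (integers i) (zeros i)

        satisfies⇒key : ∀ i → key (lookup M i) ≡ keyOf R (h i)
        satisfies⇒key i = cong₂ _,_ (sym (places i)) (classify-unique {proj₂ (lookup M i)} (fits⇒class R (h i) (satisfies⇒fits i)))

        -- A marking that satisfies a region has exactly the keys of the region.
        satisfies⇒flat : abstraction M ↭ flat R
        satisfies⇒flat = ↭-trans (↭-reflexive (trans (cong abstraction (sym (List.tabulate-lookup M)))
            (trans (List.map-tabulate (lookup M) key) (trans (List.tabulate-cong satisfies⇒key)
              (trans (sym (List.map-tabulate id (keyOf R ∘ h))) (List.map-∘ (allFin (length M))))))))
          (map⁺ (keyOf R) (unique-↭ (Unique.map⁺ (Bijection.injective bijection) (Unique.allFin⁺ _)) (elements-unique R)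
            (λ _ → ∈-elements R _) (λ {e} _ → subst (_∈ map h (allFin _)) (proj₂ (Bijection.surjective bijection e) refl) (∈-map⁺ h (∈-allFin _)))))

      module _ (tokenAt : Element N R → Token N)
        (place-ok : ∀ e → placeOf N R e ≡ proj₁ (tokenAt e))
        (fits : ∀ e → Fits R e (age N (tokenAt e)))
        (sorted : ∀ j i j′ i′ →
          age N (tokenAt (inWord j i)) - fromℕ (wordAt R j i) < age N (tokenAt (inWord j′ i′)) - fromℕ (wordAt R j′ i′) ⇔ toℕ j ℕ.< toℕ j′)
        where

        private
          M : Marking N
          M = map tokenAt (elements R)

          elementAt : Fin (length M) → Element N R
          elementAt i = lookup (elements R) (cast (List.length-map tokenAt (elements R)) i)

          lookup-M : ∀ i → lookup M i ≡ tokenAt (elementAt i)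
          lookup-M i = lookup-map tokenAt (elements R) (List.length-map tokenAt (elements R)) i

          elementAt-injective : ∀ {i j} → elementAt i ≡ elementAt j → i ≡ j
          elementAt-injective {i} {j} eq = Fin.toℕ-injective (trans (sym (Fin.toℕ-cast len i))
            (trans (cong toℕ (lookup-injective (elements-unique R) (cast len i) (cast len j) eq)) (Fin.toℕ-cast len j)))
            where
            len : length M ≡ length (elements R)
            len = List.length-map tokenAt (elements R)

          elementAt-surjective : ∀ e → ∃[ i ] elementAt i ≡ e
          elementAt-surjective e = cast (sym len) k
            , trans (cong (lookup (elements R)) (trans (Fin.cast-trans (sym len) len k) (Fin.cast-is-id refl k))) (sym (lookup-index (∈-elements R e)))
            where
            len : length M ≡ length (elements R)
            len = List.length-map tokenAt (elements R)
            k : Fin (length (elements R))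
            k = Any.index (∈-elements R e)

          ageAt : Element N R → ℝ
          ageAt e = age N (tokenAt e)

          fits⇒floor : ∀ e → ageAt e ≤ fromℕ max → ∃[ k ] integerOf N R e ≡ just k × IsFloor (ageAt e) k
          fits⇒floor e@(inZero i)   x≤max = _ , refl , proj₁ (fits e)
          fits⇒floor e@(inWord j i) x≤max = _ , refl , <⇒≤ {fromℕ (wordAt R j i)} {ageAt e} (proj₁ (fits e)) , proj₂ (fits e)
          fits⇒floor e@(inMax i)    x≤max = ⊥-elim (x≤max (fits e))

          above′ : ∀ e → block N R e ≡ suc (length w) ⇔ fromℕ max < ageAt e
          above′ e@(inZero i) = mk⇔ (λ ()) λ max<x → ⊥-elim (proj₂ (fits e)
            (≤-<-trans {fromℕ (zeroAt R i)} {fromℕ max} {ageAt e} (fromℕ-mono-≤ (ℕ.≤-pred (Fin.toℕ<n (proj₂ (lookup b₀ i))))) max<x))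
          above′ e@(inWord j i) = mk⇔ (λ eq → ⊥-elim (ℕ.<⇒≢ (Fin.toℕ<n j) (ℕ.suc-injective eq)))
            λ max<x → ⊥-elim (<⇒≤ {ageAt e} {fromℕ (suc (wordAt R j i))} (proj₂ (fits e))
              (≤-<-trans {fromℕ (suc (wordAt R j i))} {fromℕ max} {ageAt e}
                (fromℕ-mono-≤ (Fin.toℕ<n (proj₂ (lookup (List⁺.toList (lookup w j)) i)))) max<x))
          above′ e@(inMax i) = mk⇔ (λ _ → fits e) (λ _ → refl)

          zeroFloor : ∀ i → IsFloor (ageAt (inZero i)) (zeroAt R i)
          zeroFloor i = proj₁ (fits (inZero i))

          exact : ∀ i → ageAt (inZero i) ≤ fromℕ (zeroAt R i)
          exact i = proj₂ (fits (inZero i))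

          wordFloor : ∀ j i → IsFloor (ageAt (inWord j i)) (wordAt R j i)
          wordFloor j i = <⇒≤ {fromℕ (wordAt R j i)} {ageAt (inWord j i)} (proj₁ (fits (inWord j i))) , proj₂ (fits (inWord j i))

          lower : ∀ j i → fromℕ (wordAt R j i) < ageAt (inWord j i)
          lower j i = proj₁ (fits (inWord j i))

          zeros′ : ∀ e → ageAt e ≤ fromℕ max → FracZero (ageAt e) ⇔ block N R e ≡ 0
          zeros′ (inZero i) _ = mk⇔ (λ _ → refl)
            (λ _ → exact⇒fracZero {ageAt (inZero i)} {zeroAt R i} (zeroFloor i) (exact i))
          zeros′ (inWord j i) _ = mk⇔
            (λ zero → ⊥-elim (fracZero⇒exact {ageAt (inWord j i)} {wordAt R j i} (wordFloor j i) zero (lower j i))) (λ ())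
          zeros′ (inMax i) x≤max = ⊥-elim (x≤max (fits (inMax i)))

          order′ : ∀ e e′ → ageAt e < fromℕ max → ageAt e′ < fromℕ max →
            FracLess (ageAt e) (ageAt e′) ⇔ block N R e ℕ.< block N R e′
          order′ (inMax i) e′ x< _ = ⊥-elim (<⇒≤ {ageAt (inMax i)} {fromℕ max} x< (fits (inMax i)))
          order′ (inZero i) (inMax i′) _ y< = ⊥-elim (<⇒≤ {ageAt (inMax i′)} {fromℕ max} y< (fits (inMax i′)))
          order′ (inWord j i) (inMax i′) _ y< = ⊥-elim (<⇒≤ {ageAt (inMax i′)} {fromℕ max} y< (fits (inMax i′)))
          order′ (inZero i) (inZero i′) _ _ = mk⇔
            (λ less → ⊥-elim (exact-≮-exact {ageAt (inZero i)} {ageAt (inZero i′)} {zeroAt R i} {zeroAt R i′}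
              (zeroFloor i) (exact i) (zeroFloor i′) (exact i′) less))
            (λ ())
          order′ (inZero i) (inWord j′ i′) _ _ = mk⇔ (λ _ → s≤s z≤n)
            (λ _ → exact-<-fractional {ageAt (inZero i)} {ageAt (inWord j′ i′)} {zeroAt R i} {wordAt R j′ i′}
              (zeroFloor i) (exact i) (wordFloor j′ i′) (lower j′ i′))
          order′ (inWord j i) (inZero i′) _ _ = mk⇔
            (λ less → ⊥-elim (fractional-≮-exact {ageAt (inWord j i)} {ageAt (inZero i′)} {wordAt R j i} {zeroAt R i′}
              (wordFloor j i) (lower j i) (zeroFloor i′) (exact i′) less))
            (λ ())
          order′ (inWord j i) (inWord j′ i′) _ _ = mk⇔
            (λ less → s≤s (Equivalence.to (sorted j i j′ i′) (proj₁ parts less)))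
            (λ lt → proj₂ parts (Equivalence.from (sorted j i j′ i′) (ℕ.≤-pred lt)))
            where
            parts = fractional-parts {ageAt (inWord j i)} {ageAt (inWord j′ i′)} {wordAt R j i} {wordAt R j′ i′}
              (wordFloor j i) (wordFloor j′ i′)

        -- Tokens assigned to the elements form a marking that satisfies the region if places, ages,
        -- and the order of the fractional parts fit.
        fits⇒satisfies : Satisfies N R M
        fits⇒satisfies = record
          { bijection = mk⤖ (elementAt-injective , λ e → let (i , eq) = elementAt-surjective e in i , λ { refl → eq })
          ; places    = λ i → trans (place-ok (elementAt i)) (cong proj₁ (sym (lookup-M i)))
          ; above     = λ i → subst (λ t → block N R (elementAt i) ≡ suc (length w) ⇔ fromℕ max < age N t) (sym (lookup-M i)) (above′ (elementAt i))
          ; integers  = λ i → subst (λ t → age N t ≤ fromℕ max → ∃[ k ] integerOf N R (elementAt i) ≡ just k × IsFloor (age N t) k)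
              (sym (lookup-M i)) (fits⇒floor (elementAt i))
          ; zeros     = λ i → subst (λ t → age N t ≤ fromℕ max → FracZero (age N t) ⇔ block N R (elementAt i) ≡ 0)
              (sym (lookup-M i)) (zeros′ (elementAt i))
          ; order     = λ i₁ i₂ → subst₂ (λ t₁ t₂ → age N t₁ < fromℕ max → age N t₂ < fromℕ max →
                FracLess (age N t₁) (age N t₂) ⇔ block N R (elementAt i₁) ℕ.< block N R (elementAt i₂))
              (sym (lookup-M i₁)) (sym (lookup-M i₂)) (order′ (elementAt i₁) (elementAt i₂))
          }

-- Submultisets of bounded multiplicities

module Capping {A : Set} (_≟_ : DecidableEquality A) where
  open Count _≟_

  -- A sublist in which every key occurs at most c times, and c times if any occurrence was left
  -- out.
  cap : ∀ {B : Set} (f : B → A) c M → ∃[ M′ ] ∃[ rest ] M ↭ M′ ++ rest ×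
    (∀ x → count x (map f M′) ℕ.≤ c) × (∀ x → count x (map f M′) ℕ.< count x (map f M) → c ℕ.≤ count x (map f M′))
  cap f c []      = [] , [] , refl , (λ x → z≤n) , λ x ()
  cap f c (y ∷ M) with cap f c M
  ... | M′ , rest , perm , ≤c , full with count (f y) (map f M′) ℕ.<? c
  ... | yes <c = y ∷ M′ , rest , prep y perm , ≤c′ , full′
    where
    ≤c′ : ∀ x → count x (f y ∷ map f M′) ℕ.≤ c
    ≤c′ x with x ≟ f y
    ... | yes refl = <c
    ... | no _     = ≤c x
    full′ : ∀ x → count x (f y ∷ map f M′) ℕ.< count x (f y ∷ map f M) → c ℕ.≤ count x (f y ∷ map f M′)
    full′ x lt with x ≟ f y
    ... | yes refl = ℕ.m≤n⇒m≤1+n (full x (ℕ.≤-pred lt))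
    ... | no _     = full x lt
  ... | no ≮c = M′ , y ∷ rest , ↭-trans (prep y perm) (↭-sym (shift y M′ rest)) , ≤c , full′
    where
    full′ : ∀ x → count x (map f M′) ℕ.< count x (f y ∷ map f M) → c ℕ.≤ count x (map f M′)
    full′ x lt with x ≟ f y
    ... | yes refl = ℕ.≮⇒≥ ≮c
    ... | no _     = full x lt

  -- A list over ks in which every entry occurs at most c times has at most c entries for each
  -- member of ks.
  length≤ : ∀ c ks l → (∀ {x} → x ∈ l → x ∈ ks) → (∀ x → count x l ℕ.≤ c) → length l ℕ.≤ length ks ℕ.* c
  length≤ c []       []      ⊆ ≤c = z≤n
  length≤ c []       (x ∷ l) ⊆ ≤c = case ⊆ (here refl) of λ ()
  length≤ c (k ∷ ks) l       ⊆ ≤c = ℕ.≤-trans (ℕ.≤-reflexive (sym (partition l)))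
    (ℕ.+-mono-≤ (≤c k) (length≤ c ks others others⊆ (λ x → ℕ.≤-trans (others≤ x l) (≤c x))))
    where
    others : List A
    others = filter (¬? ∘ (k ≟_)) l
    partition : ∀ l → count k l ℕ.+ length (filter (¬? ∘ (k ≟_)) l) ≡ length l
    partition []      = refl
    partition (x ∷ l) with k ≟ x
    ... | yes _ = cong suc (partition l)
    ... | no _  = trans (ℕ.+-suc _ _) (cong suc (partition l))
    others⊆ : ∀ {x} → x ∈ others → x ∈ ks
    others⊆ x∈ with ∈-filter⁻ (¬? ∘ (k ≟_)) {xs = l} x∈
    ... | x∈l , k≢x with ⊆ x∈l
    ... | here x≡k  = ⊥-elim (k≢x (sym x≡k))
    ... | there x∈ks = x∈ks
    others≤ : ∀ x l → count x (filter (¬? ∘ (k ≟_)) l) ℕ.≤ count x l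
    others≤ x []      = z≤n
    others≤ x (y ∷ l) with k ≟ y
    ... | yes _ with x ≟ y
    ...   | yes _ = ℕ.m≤n⇒m≤1+n (others≤ x l)
    ...   | no _  = others≤ x l
    others≤ x (y ∷ l) | no _ with x ≟ y
    ...   | yes _ = s≤s (others≤ x l)
    ...   | no _  = others≤ x l

-- Sorting into blocks by a real-valued key

module Blocks {A : Set} (f : A → ℝ) (em : ExcludedMiddle 0ℓ) where

  -- The members of a block have the value of its head.
  Block : List⁺ A → Set
  Block (a ∷ as) = All (λ b → f a ≤ f b × f b ≤ f a) as

  -- Blocks are compared by their heads.
  _before_ : List⁺ A → List⁺ A → Set
  b before c = f (List⁺.head b) < f (List⁺.head c)

  -- A new item joins the block of equal value, or forms a block of its own in between.
  insert : A → List (List⁺ A) → List (List⁺ A)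
  insert x []             = [ x ∷ [] ]
  insert x ((a ∷ as) ∷ w) with em {f x < f a} | em {f a < f x}
  ... | yes _ | _     = (x ∷ []) ∷ (a ∷ as) ∷ w
  ... | no _  | yes _ = (a ∷ as) ∷ insert x w
  ... | no _  | no _  = (a ∷ x ∷ as) ∷ w

  insert-heads : ∀ {P : A → Set} x w → P x → All (λ b → P (List⁺.head b)) w → All (λ b → P (List⁺.head b)) (insert x w)
  insert-heads x []             px [] = px ∷ []
  insert-heads x ((a ∷ as) ∷ w) px (pa ∷ pw) with em {f x < f a} | em {f a < f x}
  ... | yes _ | _     = px ∷ pa ∷ pw
  ... | no _  | yes _ = pa ∷ insert-heads x w px pw
  ... | no _  | no _  = pa ∷ pw

  insert-blocks : ∀ x w → All Block w → All Block (insert x w)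
  insert-blocks x []             [] = [] ∷ []
  insert-blocks x ((a ∷ as) ∷ w) (b ∷ bs) with em {f x < f a} | em {f a < f x}
  ... | yes _  | _      = [] ∷ b ∷ bs
  ... | no _   | yes _  = b ∷ insert-blocks x w bs
  ... | no x≮a | no a≮x = ((x≮a , a≮x) ∷ b) ∷ bs

  insert-sorted : ∀ x w → AllPairs _before_ w → AllPairs _before_ (insert x w)
  insert-sorted x []             [] = [] ∷ []
  insert-sorted x ((a ∷ as) ∷ w) (b ∷ bs) with em {f x < f a} | em {f a < f x}
  ... | yes x<a | _      = (x<a ∷ All.map (λ {c} → <-trans {f x} {f a} {f (List⁺.head c)} x<a) b) ∷ b ∷ bs
  ... | no _    | yes a<x = insert-heads x w a<x b ∷ insert-sorted x w bs
  ... | no _    | no _   = b ∷ bs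

  members : List (List⁺ A) → List A
  members = concatMap List⁺.toList

  insert-members : ∀ x w → members (insert x w) ↭ x ∷ members w
  insert-members x []             = refl
  insert-members x ((a ∷ as) ∷ w) with em {f x < f a} | em {f a < f x}
  ... | yes _ | _     = refl
  ... | no _  | yes _ = ↭-trans (++⁺ˡ (a ∷ as) (insert-members x w)) (shift x (a ∷ as) (members w))
  ... | no _  | no _  = swap a x refl

  sort : ∀ l → ∃[ w ] members w ↭ l × All Block w × AllPairs _before_ w
  sort []      = [] , refl , [] , []
  sort (x ∷ l) with sort l
  ... | w , perm , blocks , sorted =
    insert x w , ↭-trans (insert-members x w) (prep x perm) , insert-blocks x w blocks , insert-sorted x w sorted

  private
    near-head : ∀ {b} → Block b → ∀ i → f (List⁺.head b) ≤ f (lookup (List⁺.toList b) i) × f (lookup (List⁺.toList b) i) ≤ f (List⁺.head b)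
    near-head {a ∷ as} B zero    = <-irrefl {f a} , <-irrefl {f a}
    near-head {a ∷ as} B (suc i) = All.lookup B (∈-lookup i)

    before : ∀ {w} → AllPairs _before_ w → ∀ {i j} → i Fin.< j → lookup w i before lookup w j
    before (b ∷ bs) {zero}  {suc j} (s≤s _)   = All.lookup b (∈-lookup j)
    before (b ∷ bs) {suc i} {suc j} (s≤s i<j) = before bs i<j

  -- Members are compared as their blocks.
  block-order : ∀ {w} → All Block w → AllPairs _before_ w → ∀ j i j′ i′ →
    f (lookup (List⁺.toList (lookup w j)) i) < f (lookup (List⁺.toList (lookup w j′)) i′) ⇔ toℕ j ℕ.< toℕ j′
  block-order {w} blocks sorted j i j′ i′ = mk⇔ to from
    where
    head-of : Fin (length w) → ℝ
    head-of j = f (List⁺.head (lookup w j))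
    member : ∀ j → Fin (List⁺.length (lookup w j)) → ℝ
    member j i = f (lookup (List⁺.toList (lookup w j)) i)
    close : ∀ j i → head-of j ≤ member j i × member j i ≤ head-of j
    close j = near-head {lookup w j} (All.lookup blocks (∈-lookup j))
    ordered : ∀ {j i j′ i′} → j Fin.< j′ → member j i < member j′ i′
    ordered {j} {i} {j′} {i′} j<j′ = ≤-<-trans {member j i} {head-of j} {member j′ i′} (proj₂ (close j i))
      (<-≤-trans {head-of j} {head-of j′} {member j′ i′} (before sorted j<j′) (proj₁ (close j′ i′)))
    from : toℕ j ℕ.< toℕ j′ → member j i < member j′ i′
    from = ordered {j} {i} {j′} {i′}
    to : member j i < member j′ i′ → toℕ j ℕ.< toℕ j′
    to less with Fin.<-cmp j j′
    ... | tri< j<j′ _ _ = j<j′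
    ... | tri> _ _ j′<j = ⊥-elim (<-irrefl {member j i} (<-trans {member j i} {member j′ i′} {member j i} less (ordered {j′} {i′} {j} {i} j′<j)))
    ... | tri≈ _ refl _ = ⊥-elim (<-irrefl {head-of j} (≤-<-trans {head-of j} {member j i} {head-of j} (proj₁ (close j i))
            (<-≤-trans {member j i} {member j i′} {head-of j} less (proj₂ (close j i′)))))

lookup-block : ∀ {A B : Set} (g : A → B) {c : List⁺ B} (b : List⁺ A) → c ≡ List⁺.map g b →
  (len : List⁺.length c ≡ List⁺.length b) (i : Fin (List⁺.length c)) →
  lookup (List⁺.toList c) i ≡ g (lookup (List⁺.toList b) (cast len i))
lookup-block g (x ∷ xs) refl len i = lookup-map g (x ∷ xs) len i

module Enumeration (N : TPN) where
  open TPN N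
  open Abstraction N using (max)

  wordElements : List (Place × Fin max)
  wordElements = cartesianProduct (allFin #P) (allFin max)

  -- Finitely many regions, among them all with at most n blocks and at most n elements in
  -- each part.
  regionsUpTo : ℕ → List (Region N)
  regionsUpTo n = cartesianProductWith (λ b₀ (w , bmax) → region b₀ w bmax)
    (listsUpTo n (cartesianProduct (allFin #P) (allFin (suc max))))
    (cartesianProduct (listsUpTo n (cartesianProductWith _∷_ wordElements (listsUpTo n wordElements))) (listsUpTo n (allFin #P)))

  ∈-regionsUpTo : ∀ {n b₀ w bmax} → length b₀ ℕ.≤ n → length w ℕ.≤ n → All (λ b → List⁺.length b ℕ.≤ n) w →
    length bmax ℕ.≤ n → region b₀ w bmax ∈ regionsUpTo n
  ∈-regionsUpTo {n} {b₀} {w} {bmax} b₀≤ w≤ blocks≤ bmax≤ = ∈-cartesianProductWith⁺ (λ b₀ (w , bmax) → region b₀ w bmax)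
    (∈-listsUpTo n (All.universal (λ (p , k) → ∈-cartesianProduct⁺ (∈-allFin p) (∈-allFin k)) b₀) b₀≤)
    (∈-cartesianProduct⁺
      (∈-listsUpTo n (All.map (λ { {e ∷ es} b≤ → ∈-cartesianProductWith⁺ _∷_ (element∈ e)
          (∈-listsUpTo n (All.universal element∈ es) (ℕ.≤-trans (ℕ.n≤1+n _) b≤)) }) blocks≤) w≤)
      (∈-listsUpTo n (All.universal ∈-allFin bmax) bmax≤))
    where
    element∈ : ∀ e → e ∈ wordElements
    element∈ (p , k) = ∈-cartesianProduct⁺ (∈-allFin p) (∈-allFin k)

module Arrangement (N : TPN) (em : ExcludedMiddle 0ℓ) where
  open TPN N
  open Abstraction N
  open Correct em
  open Classical em
  open Regions N
  open Satisfaction em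
  open Enumeration N

  -- The three kinds of tokens that regions distinguish: of integer age at most max, of
  -- fractional age below max, and of age above max.
  record ZeroToken : Set where
    field
      place : Place
      int   : Fin (suc max)
      clock : ℝ≥0
      floor : IsFloor (val clock) (toℕ int)
      exact : val clock ≤ fromℕ (toℕ int)

  record FracToken : Set where
    field
      place : Place
      int   : Fin max
      clock : ℝ≥0
      lower : fromℕ (toℕ int) < val clock
      upper : val clock < fromℕ (suc (toℕ int))

  record MaxToken : Set where
    field
      place : Place
      clock : ℝ≥0
      big   : fromℕ max < val clock

  module Z = ZeroToken
  module F = FracToken
  module X = MaxToken

  zeroToken : ZeroToken → Token N
  zeroToken z = Z.place z , Z.clock z

  fracToken : FracToken → Token N
  fracToken f = F.place f , F.clock f

  maxToken : MaxToken → Token N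
  maxToken m = X.place m , X.clock m

  zeroElement : ZeroToken → Place × Fin (suc max)
  zeroElement z = Z.place z , Z.int z

  fracElement : FracToken → Place × Fin max
  fracElement f = F.place f , F.int f

  -- The fractional part of the age.
  frac : FracToken → ℝ
  frac f = val (F.clock f) - fromℕ (toℕ (F.int f))

  open Blocks frac em

  tokens : List ZeroToken → List FracToken → List MaxToken → Marking N
  tokens zs fs ms = map zeroToken zs ++ map fracToken fs ++ map maxToken ms

  -- Every marking consists of tokens of the three kinds.
  split : ∀ M → ∃[ zs ] ∃[ fs ] ∃[ ms ] M ↭ tokens zs fs ms
  split []            = [] , [] , [] , refl
  split ((p , a) ∷ M) with split M | floorBounds max (val a) (nonneg a)
  ... | zs , fs , ms , perm | _ , integer {k} k≤max fl a≤k =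
    record { place = p ; int = Fin.fromℕ< k< ; clock = a
           ; floor = subst (IsFloor (val a)) k≡ fl ; exact = subst (λ k → val a ≤ fromℕ k) k≡ a≤k } ∷ zs
    , fs , ms , prep (p , a) perm
    where
    k< : k ℕ.< suc max
    k< = s≤s k≤max
    k≡ : k ≡ toℕ (Fin.fromℕ< k<)
    k≡ = sym (Fin.toℕ-fromℕ< k<)
  ... | zs , fs , ms , perm | _ , fractional {k} k<max k<a a<k+1 =
    zs
    , record { place = p ; int = Fin.fromℕ< k<max ; clock = a
             ; lower = subst (λ k → fromℕ k < val a) k≡ k<a ; upper = subst (λ k → val a < fromℕ (suc k)) k≡ a<k+1 } ∷ fs
    , ms , ↭-trans (prep (p , a) perm) (↭-sym (shift (p , a) (map zeroToken zs) _))
    where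
    k≡ : k ≡ toℕ (Fin.fromℕ< k<max)
    k≡ = sym (Fin.toℕ-fromℕ< k<max)
  ... | zs , fs , ms , perm | _ , unbounded max<a =
    zs , fs , record { place = p ; clock = a ; big = max<a } ∷ ms
    , ↭-trans (prep (p , a) perm) (↭-trans (↭-sym (shift (p , a) (map zeroToken zs) _))
        (++⁺ˡ (map zeroToken zs) (↭-sym (shift (p , a) (map fracToken fs) (map maxToken ms)))))

  module _ (zs : List ZeroToken) (w : List (List⁺ FracToken)) (ms : List MaxToken)
    (blocks : All Block w) (sorted : AllPairs _before_ w) where

    -- The region of tokens whose fractional ones are sorted into blocks.
    arranged : Region N
    arranged = region (map zeroElement zs) (map (List⁺.map fracElement) w) (map X.place ms)

    private
      zeroLen : length (map zeroElement zs) ≡ length zs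
      zeroLen = List.length-map zeroElement zs

      wordLen : length (map (List⁺.map fracElement) w) ≡ length w
      wordLen = List.length-map (List⁺.map fracElement) w

      maxLen : length (map X.place ms) ≡ length ms
      maxLen = List.length-map X.place ms

      zeroOf : Fin (length (map zeroElement zs)) → ZeroToken
      zeroOf i = lookup zs (cast zeroLen i)

      zeroOf≡ : ∀ i → lookup (map zeroElement zs) i ≡ zeroElement (zeroOf i)
      zeroOf≡ = lookup-map zeroElement zs zeroLen

      blockOf : Fin (length (map (List⁺.map fracElement) w)) → List⁺ FracToken
      blockOf j = lookup w (cast wordLen j)

      blockOf≡ : ∀ j → lookup (map (List⁺.map fracElement) w) j ≡ List⁺.map fracElement (blockOf j)
      blockOf≡ = lookup-map (List⁺.map fracElement) w wordLen

      blockLen : ∀ j → List⁺.length (lookup (map (List⁺.map fracElement) w) j) ≡ List⁺.length (blockOf j)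
      blockLen j = trans (cong List⁺.length (blockOf≡ j)) (cong suc (List.length-map fracElement (List⁺.tail (blockOf j))))

      fracOf : ∀ j → Fin (List⁺.length (lookup (map (List⁺.map fracElement) w) j)) → FracToken
      fracOf j i = lookup (List⁺.toList (blockOf j)) (cast (blockLen j) i)

      fracOf≡ : ∀ j i → lookup (List⁺.toList (lookup (map (List⁺.map fracElement) w) j)) i ≡ fracElement (fracOf j i)
      fracOf≡ j = lookup-block fracElement (blockOf j) (blockOf≡ j) (blockLen j)

      maxOf : Fin (length (map X.place ms)) → MaxToken
      maxOf i = lookup ms (cast maxLen i)

      -- The token at the position of an element. Positions are transported along the map that
      -- forgets the ages.
      tokenAt : Element N arranged → Token N
      tokenAt (inZero i)   = zeroToken (zeroOf i)
      tokenAt (inWord j i) = fracToken (fracOf j i)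
      tokenAt (inMax i)    = maxToken (maxOf i)

      place-ok : ∀ e → placeOf N arranged e ≡ proj₁ (tokenAt e)
      place-ok (inZero i)   = cong proj₁ (zeroOf≡ i)
      place-ok (inWord j i) = cong proj₁ (fracOf≡ j i)
      place-ok (inMax i)    = lookup-map X.place ms maxLen i

      zeroAt≡ : ∀ i → toℕ (Z.int (zeroOf i)) ≡ zeroAt arranged i
      zeroAt≡ i = cong (toℕ ∘ proj₂) (sym (zeroOf≡ i))

      wordAt≡ : ∀ j i → toℕ (F.int (fracOf j i)) ≡ wordAt arranged j i
      wordAt≡ j i = cong (toℕ ∘ proj₂) (sym (fracOf≡ j i))

      fits : ∀ e → Fits arranged e (age N (tokenAt e))
      fits (inZero i)   = subst (λ k → IsFloor (val (Z.clock (zeroOf i))) k × val (Z.clock (zeroOf i)) ≤ fromℕ k) (zeroAt≡ i)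
                            (Z.floor (zeroOf i) , Z.exact (zeroOf i))
      fits (inWord j i) = subst (λ k → fromℕ k < val (F.clock (fracOf j i)) × val (F.clock (fracOf j i)) < fromℕ (suc k)) (wordAt≡ j i)
                            (F.lower (fracOf j i) , F.upper (fracOf j i))
      fits (inMax i)    = X.big (maxOf i)

      ordered : ∀ j i j′ i′ →
        age N (tokenAt (inWord j i)) - fromℕ (wordAt arranged j i) < age N (tokenAt (inWord j′ i′)) - fromℕ (wordAt arranged j′ i′) ⇔ toℕ j ℕ.< toℕ j′
      ordered j i j′ i′ = subst₂ (λ k k′ → (val (F.clock (fracOf j i)) - fromℕ k < val (F.clock (fracOf j′ i′)) - fromℕ k′) ⇔ toℕ j ℕ.< toℕ j′)
        (wordAt≡ j i) (wordAt≡ j′ i′)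
        (subst₂ (λ m m′ → (frac (fracOf j i) < frac (fracOf j′ i′)) ⇔ m ℕ.< m′) (Fin.toℕ-cast wordLen j) (Fin.toℕ-cast wordLen j′)
          (block-order blocks sorted (cast wordLen j) (cast (blockLen j) i) (cast wordLen j′) (cast (blockLen j′) i′)))

      map-Fin : ∀ {A B C : Set} (xs : List A) (t : A → B) (e : C → B) {n} (c : Fin n → C) (eq : n ≡ length xs) →
        (∀ i → e (c i) ≡ t (lookup xs (cast eq i))) → map e (map c (allFin n)) ≡ map t xs
      map-Fin xs t e {n} c eq h = trans (sym (List.map-∘ (allFin n))) (trans (List.map-cong h (allFin n))
        (trans (List.map-∘ (allFin n)) (cong (map t) (map-lookup-cast xs eq))))

      wordTokens : map tokenAt (concatMap (λ j → map (inWord j) (allFin _)) (allFin _)) ≡ map fracToken (members w)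
      wordTokens = trans (List.map-concatMap tokenAt (λ j → map (inWord j) (allFin _)) (allFin _))
        (trans (List.concatMap-cong (λ j → map-Fin (List⁺.toList (blockOf j)) fracToken tokenAt (inWord j) (blockLen j) (λ i → refl)) (allFin _))
          (trans (cong concat (trans (List.map-∘ (allFin _)) (cong (map (map fracToken ∘ List⁺.toList)) (map-lookup-cast w wordLen))))
            (sym (List.map-concatMap fracToken List⁺.toList w))))

    arranged-tokens : map tokenAt (elements arranged) ≡ tokens zs (members w) ms
    arranged-tokens = trans (List.map-++ tokenAt (map inZero (allFin _)) _) (cong₂ _++_
      (map-Fin zs zeroToken tokenAt inZero zeroLen (λ i → refl))
      (trans (List.map-++ tokenAt (concatMap (λ j → map (inWord j) (allFin _)) (allFin _)) _)
        (cong₂ _++_ wordTokens (map-Fin ms maxToken tokenAt inMax maxLen (λ i → refl)))))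

    arranged-satisfies : Satisfies N arranged (tokens zs (members w) ms)
    arranged-satisfies = subst (Satisfies N arranged) arranged-tokens (fits⇒satisfies arranged tokenAt place-ok fits ordered)

    arranged∈ : ∀ {n} → length (tokens zs (members w) ms) ℕ.≤ n → arranged ∈ regionsUpTo n
    arranged∈ {n} len = ∈-regionsUpTo
      (subst (ℕ._≤ n) (sym zeroLen) (ℕ.≤-trans (ℕ.m≤m+n _ _) sum≤))
      (subst (ℕ._≤ n) (sym wordLen) (ℕ.≤-trans (blocks≤members w) members≤))
      (All.map⁺ (All.map (λ {b} → subst (ℕ._≤ n) (cong suc (sym (List.length-map fracElement (List⁺.tail b)))))
        (All.map (λ b≤ → ℕ.≤-trans b≤ members≤) (block≤members w))))
      (subst (ℕ._≤ n) (sym maxLen) (ℕ.≤-trans (ℕ.m≤n+m _ (length (members w))) (ℕ.≤-trans (ℕ.m≤n+m _ (length zs)) sum≤)))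
      where
      sum≤ : length zs ℕ.+ (length (members w) ℕ.+ length ms) ℕ.≤ n
      sum≤ = subst (ℕ._≤ n) (trans (List.length-++ (map zeroToken zs)) (cong₂ ℕ._+_ (List.length-map zeroToken zs)
        (trans (List.length-++ (map fracToken (members w))) (cong₂ ℕ._+_ (List.length-map fracToken (members w)) (List.length-map maxToken ms))))) len
      members≤ : length (members w) ℕ.≤ n
      members≤ = ℕ.≤-trans (ℕ.m≤m+n _ _) (ℕ.≤-trans (ℕ.m≤n+m _ (length zs)) sum≤)
      blocks≤members : ∀ w → length w ℕ.≤ length (members w)
      blocks≤members []             = z≤n
      blocks≤members ((a ∷ as) ∷ w) = s≤s (ℕ.≤-trans (blocks≤members w)
        (subst (length (members w) ℕ.≤_) (sym (List.length-++ as)) (ℕ.m≤n+m _ (length as))))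
      block≤members : ∀ w → All (λ b → List⁺.length b ℕ.≤ length (members w)) w
      block≤members []      = []
      block≤members (b ∷ w) = subst (List⁺.length b ℕ.≤_) (sym (List.length-++ (List⁺.toList b))) (ℕ.m≤m+n _ _)
        ∷ All.map (λ {c} c≤ → subst (List⁺.length c ℕ.≤_) (sym (List.length-++ (List⁺.toList b))) (ℕ.m≤n⇒m≤o+n (List⁺.length b) c≤)) (block≤members w)

  -- Every marking satisfies some region, after reordering its tokens.
  arrange : ∀ M {n} → length M ℕ.≤ n → ∃[ R ] ∃[ M′ ] R ∈ regionsUpTo n × M ↭ M′ × Satisfies N R M′
  arrange M {n} len = fromSplit (split M)
    where
    fromSplit : ∃[ zs ] ∃[ fs ] ∃[ ms ] M ↭ tokens zs fs ms → ∃[ R ] ∃[ M′ ] R ∈ regionsUpTo n × M ↭ M′ × Satisfies N R M′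
    fromSplit (zs , fs , ms , M↭) = fromSort (sort fs)
      where
      fromSort : ∃[ w ] members w ↭ fs × All Block w × AllPairs _before_ w → ∃[ R ] ∃[ M′ ] R ∈ regionsUpTo n × M ↭ M′ × Satisfies N R M′
      fromSort (w , w↭ , blocks , sorted) = arranged zs w ms blocks sorted , tokens zs (members w) ms
        , arranged∈ zs w ms blocks sorted (subst (ℕ._≤ n) (↭-length perm) len)
        , perm , arranged-satisfies zs w ms blocks sorted
        where
        perm : M ↭ tokens zs (members w) ms
        perm = ↭-trans M↭ (++⁺ˡ (map zeroToken zs) (++⁺ʳ (map maxToken ms) (map⁺ fracToken (↭-sym w↭))))

-- The computed regions

-- The bound on the size of the parts is the number of tokens that a short run can use: at most
-- one of each key per step.
zerotimeRegions : (N : TPN) → MRUC N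
zerotimeRegions N = filter (λ R → shortlyCovering? (multiplicity (flat R))) (regionsUpTo (length keys ℕ.* bound))
  where
  open Abstraction N
  open Regions N
  open Enumeration N

module _ (em : ExcludedMiddle 0ℓ) (N : TPN) (M : Marking N) where
  open Abstraction N
  open Correct em
  open Regions N
  open Satisfaction em
  open Enumeration N
  open Arrangement N em using (arrange)
  open Capping _≟ᴷ_

  denotation⇒zerotime : denotation N (zerotimeRegions N) M → Zerotime N M
  denotation⇒zerotime M∈ =
    let (R , R∈ , M′ , S , (c , M≋)) = find M∈
        ((u , v) , _ , C , _) = find (proj₂ (∈-filter⁻ (λ R → shortlyCovering? (multiplicity (flat R))) {xs = regionsUpTo (length keys ℕ.* bound)} R∈))
    in covering⇒zerotime (covering-mono (λ x → ℤ.+≤+ (subst₂ ℕ._≤_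
         (count-↭ x (satisfies⇒flat R S))
         (sym (trans (count-↭ x (↭-trans (abstraction-≋ M≋) (↭-reflexive (List.map-++ key M′ c)))) (count-++ x (abstraction M′) (abstraction c))))
         (ℕ.m≤m+n _ _))) C)

  zerotime⇒denotation : Zerotime N M → denotation N (zerotimeRegions N) M
  zerotime⇒denotation Z = fromCovering (zerotime⇒covering Z)
    where
    fromArranged : ∀ {M₁ rest} → M ↭ M₁ ++ rest → ShortlyCovering (marking M₁) →
      ∃[ R ] ∃[ M₂ ] R ∈ regionsUpTo (length keys ℕ.* bound) × M₁ ↭ M₂ × Satisfies N R M₂ →
      denotation N (zerotimeRegions N) M
    fromArranged {M₁} {rest} M↭ covering₁ (R , M₂ , R∈ , M₁↭ , S) = lose
      (∈-filter⁺ (λ R → shortlyCovering? (multiplicity (flat R))) R∈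
        (shortlyCovering-mono (λ x → ℤ.≤-reflexive (cong +_ (count-↭ x (↭-trans (map⁺ key M₁↭) (satisfies⇒flat R S))))) covering₁))
      (M₂ , S , rest , ↭⇒≋ (↭-trans M↭ (++⁺ʳ rest M₁↭)))

    fromCapped : ∀ {u v} → Covering (marking M) u v → length (u ++ v) ℕ.≤ bound →
      (∃[ M₁ ] ∃[ rest ] M ↭ M₁ ++ rest × (∀ x → count x (abstraction M₁) ℕ.≤ bound) ×
        (∀ x → count x (abstraction M₁) ℕ.< count x (abstraction M) → bound ℕ.≤ count x (abstraction M₁))) →
      denotation N (zerotimeRegions N) M
    fromCapped (covering v≢[] run gain) len (M₁ , rest , M↭ , ≤bound , full) = fromArranged M↭
      (covering⇒shortly (λ _ → ℤ.+≤+ z≤n)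
        (covering v≢[] (run-cap bound len (λ i lt → ℤ.+≤+ (full (everywhere i) (ℤ.drop‿+<+ lt))) run) gain))
      (arrange M₁ (ℕ.≤-trans (ℕ.≤-reflexive (sym (List.length-map key M₁)))
                     (length≤ bound keys (abstraction M₁) (λ _ → keys-complete _) ≤bound)))

    fromShort : ∃[ u ] ∃[ v ] Covering (marking M) u v × length (u ++ v) ℕ.≤ bound → denotation N (zerotimeRegions N) M
    fromShort (u , v , C , len) = fromCapped C len (cap key bound M)

    fromCovering : ∃[ u ] ∃[ v ] Covering (marking M) u v → denotation N (zerotimeRegions N) M
    fromCovering (u , v , C) = fromShort (shortCover keys keys-complete (length keys) everywhere (λ _ → ℤ.+≤+ z≤n) C)

theorem5p12 : Σ[ zerotime ∈ ((N : TPN) → MRUC N) ]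
    (ExcludedMiddle 0ℓ → (N : TPN) (M : Marking N) →
    denotation N (zerotime N) M ⇔ Zerotime N M)
theorem5p12 = zerotimeRegions , λ em N M → mk⇔ (denotation⇒zerotime em N M) (zerotime⇒denotation em N M)
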